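{- Let $G$ be a connected unicyclic graph on $n\geq 10$ vertices such that $p(G)=q(G)$ and $G$ contains no pendant path $P_3$. Then $$m_{L(G)}(1)\leq \frac{n}{4},$$ and equality holds if and only if $n=4k$ for some integer $k$ and $G$ is isomorphic to the graph obtained from a cycle $c_1a_1b_1c_2a_2b_2\cdots c_ka_kb_kc_1$ of length $3k$ by attaching exactly one pendant vertex to each of $c_1,\dots,c_k$ (so every cycle vertex has degree $2$ or $3$, and consecutive degree-$3$ cycle vertices are separated by exactly two degree-$2$ cycle vertices).
   Context: All graphs are finite, simple and undirected; a unicyclic graph is a connected graph with exactly one cycle. $L(G)=D(G)-A(G)$ is the Laplacian matrix, and $m_{L(G)}(1)$ is the multiplicity of $1$ as an eigenvalue of $L(G)$. A pendant vertex has degree $1$; a quasi-pendant vertex is adjacent to a pendant vertex; $p(G)$, $q(G)$ are the numbers of pendant and quasi-pendant vertices. A pendant path $P_k$ of $G$ means that $G$ is obtained from a graph $G_1$ and a path $P_k$ by joining one end vertex of $P_k$ to a vertex of $G_1$ by an edge. -}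

module Defs where

open import Data.Bool using (Bool; true; false; if_then_else_; _∧_; _∨_)
open import Data.Nat using (ℕ; zero; suc; _+_; _*_; _∸_; _≡ᵇ_; _<ᵇ_; _≤ᵇ_)
open import Data.Fin using (Fin; toℕ) renaming (zero to fzero; suc to fsuc)
open import Data.Fin.Properties using (_≟_)
open import Data.Product using (Σ; _×_; ∃)
open import Data.Sum using (_⊎_)
open import Data.Rational using (ℚ; 0ℚ; 1ℚ; -_) renaming (_+_ to _+ℚ_; _*_ to _*ℚ_; _-_ to _-ℚ_)
open import Relation.Binary.PropositionalEquality using (_≡_; _≢_)
open import Relation.Nullary using (¬_; yes; no)
open import Function.Bundles using (_↔_; Inverse)

record Graph (n : ℕ) : Set where
  field
    adj   : Fin n → Fin n → Bool
    sym   : ∀ i j → adj i j ≡ adj j i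
    irrefl : ∀ i → adj i i ≡ false
open Graph public

sumℕ : ∀ {n} → (Fin n → ℕ) → ℕ
sumℕ {zero}  f = 0
sumℕ {suc n} f = f fzero + sumℕ (λ i → f (fsuc i))

sumℚ : ∀ {n} → (Fin n → ℚ) → ℚ
sumℚ {zero}  f = 0ℚ
sumℚ {suc n} f = f fzero +ℚ sumℚ (λ i → f (fsuc i))

count : ∀ {n} → (Fin n → Bool) → ℕ
count P = sumℕ (λ i → if P i then 1 else 0)

degR : ∀ {n} → (Fin n → Fin n → Bool) → Fin n → ℕ
degR R i = count (R i)

deg : ∀ {n} → Graph n → Fin n → ℕ
deg G = degR (adj G)

anyFin : ∀ {n} → (Fin n → Bool) → Bool
anyFin {zero}  P = false
anyFin {suc n} P = P fzero ∨ anyFin (λ i → P (fsuc i))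

data Reach {n} (R : Fin n → Fin n → Bool) : Fin n → Fin n → Set where
  here : ∀ {i} → Reach R i i
  step : ∀ {i j k} → R i j ≡ true → Reach R j k → Reach R i k

Connected : ∀ {n} → Graph n → Set
Connected {n} G = ∀ (i j : Fin n) → Reach (adj G) i j

-- Cycles, as edge sets: a nonempty symmetric subset C of the edges such
-- that every vertex has C-degree 0 or 2 and the vertices of positive
-- C-degree are connected through C-edges.

IsCycle : ∀ {n} → Graph n → (Fin n → Fin n → Bool) → Set
IsCycle {n} G C =
    (∀ i j → C i j ≡ true → adj G i j ≡ true)
  × (∀ i j → C i j ≡ C j i)
  × (∀ i → degR C i ≡ 0 ⊎ degR C i ≡ 2)
  × (Σ (Fin n) λ i → Σ (Fin n) λ j → C i j ≡ true)
  × (∀ i j → degR C i ≡ 2 → degR C j ≡ 2 → Reach C i j)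

Unicyclic : ∀ {n} → Graph n → Set
Unicyclic {n} G = Connected G ×
  (Σ (Fin n → Fin n → Bool) λ C → IsCycle G C ×
     (∀ C' → IsCycle G C' → ∀ i j → C' i j ≡ C i j))

isPendant : ∀ {n} → Graph n → Fin n → Bool
isPendant G i = deg G i ≡ᵇ 1

isQuasiPendant : ∀ {n} → Graph n → Fin n → Bool
isQuasiPendant G i = anyFin (λ j → adj G i j ∧ isPendant G j)

p : ∀ {n} → Graph n → ℕ
p G = count (isPendant G)

q : ∀ {n} → Graph n → ℕ
q G = count (isQuasiPendant G)

-- G has a pendant path P_3: a path x1 - x2 - x3 where x1 is pendant,
-- x2 has no other neighbours, and x3 is joined by exactly one further
-- edge to a vertex v of the rest G_1 of the graph.
HasPendantP3 : ∀ {n} → Graph n → Set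
HasPendantP3 {n} G = Σ (Fin n) λ x1 → Σ (Fin n) λ x2 → Σ (Fin n) λ x3 → Σ (Fin n) λ v →
    adj G x1 x2 ≡ true × adj G x2 x3 ≡ true × adj G x3 v ≡ true
  × v ≢ x2
  × deg G x1 ≡ 1 × deg G x2 ≡ 2 × deg G x3 ≡ 2

fromℕℚ : ℕ → ℚ
fromℕℚ zero = 0ℚ
fromℕℚ (suc k) = 1ℚ +ℚ fromℕℚ k

δ : ∀ {n} → Fin n → Fin n → ℚ
δ i j with i ≟ j
... | yes _ = 1ℚ
... | no  _ = 0ℚ

Laplacian : ∀ {n} → Graph n → Fin n → Fin n → ℚ
Laplacian G i j = (δ i j *ℚ fromℕℚ (deg G i)) -ℚ (if adj G i j then 1ℚ else 0ℚ)

Vector : ℕ → Set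
Vector n = Fin n → ℚ

InEigenspace : ∀ {n} → (Fin n → Fin n → ℚ) → ℚ → Vector n → Set
InEigenspace M λ' v = ∀ i → sumℚ (λ j → M i j *ℚ v j) ≡ λ' *ℚ v i

LinIndep : ∀ {n d} → (Fin d → Vector n) → Set
LinIndep {n} {d} vs = ∀ (c : Fin d → ℚ) →
  (∀ i → sumℚ (λ t → c t *ℚ vs t i) ≡ 0ℚ) → ∀ t → c t ≡ 0ℚ

IndepEigenFamily : ∀ {n} → (Fin n → Fin n → ℚ) → ℚ → ℕ → Set
IndepEigenFamily {n} M λ' d =
  Σ (Fin d → Vector n) λ vs → LinIndep vs × (∀ t → InEigenspace M λ' (vs t))

-- m is the multiplicity of λ as an eigenvalue of the symmetric matrix M
-- (= dimension of the λ-eigenspace)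
IsEigenMultiplicity : ∀ {n} → (Fin n → Fin n → ℚ) → ℚ → ℕ → Set
IsEigenMultiplicity M λ' m = IndepEigenFamily M λ' m × ¬ IndepEigenFamily M λ' (suc m)

IsMultL1 : ∀ {n} → Graph n → ℕ → Set
IsMultL1 G m = IsEigenMultiplicity (Laplacian G) 1ℚ m

IsoTo : ∀ {n m} → Graph n → (Fin m → Fin m → Bool) → Set
IsoTo {n} {m} G B = Σ (Fin n ↔ Fin m) λ f →
  ∀ i j → B (Inverse.to f i) (Inverse.to f j) ≡ adj G i j

-- Extremal graph H_k on 4k vertices: cycle 0,1,...,3k-1 (vertex 3t is c_{t+1},
-- 3t+1 is a_{t+1}, 3t+2 is b_{t+1}), and pendant vertex 3k+t attached to 3t.

cycE : ℕ → ℕ → ℕ → Bool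
cycE k i j = ((i <ᵇ 3 * k) ∧ (j <ᵇ 3 * k)) ∧ ((suc i ≡ᵇ j) ∨ ((suc i ≡ᵇ 3 * k) ∧ (j ≡ᵇ 0)))

penE : ℕ → ℕ → ℕ → Bool
penE k i j = ((3 * k ≤ᵇ i) ∧ (i <ᵇ 4 * k)) ∧ (j ≡ᵇ 3 * (i ∸ 3 * k))

adjH : (k : ℕ) → Fin (4 * k) → Fin (4 * k) → Bool
adjH k i j = cycE k (toℕ i) (toℕ j) ∨ cycE k (toℕ j) (toℕ i)
           ∨ penE k (toℕ i) (toℕ j) ∨ penE k (toℕ j) (toℕ i)

{-# OPTIONS --safe #-}
module Submission where

-- Orienting the cycle cyclically and every other edge towards it turns G into the graph of a map f with v – f v as
-- its edges.  Eigenvectors for 1 vanish on quasi-pendant vertices, and the multiplicity m is at most |Z| for every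
-- set Z on which no nonzero eigenvector vanishes.  Let q be the number of pendant vertices and r the number of
-- vertices that are neither pendant nor quasi-pendant (inner), so n = 2q + r.
--
-- If u is a quasi-pendant vertex on the cycle, the pendant vertices with the one at u replaced by f u form such a
-- set: the edges meeting the support have no end of degree one there, so they would have to contain the cycle.
-- Either class of the 2-colouring of the inner vertices by the parity of the distance to u along f is another one, since an
-- inner vertex has degree at least 2.  Hence m ≤ q and 2m ≤ r.  If the whole cycle is inner, the same sets adapted
-- to a branch vertex c of the cycle give 4m < n; when c is the only branch vertex and has degree 3 this uses that on
-- the rest of the cycle an eigenvector follows the recurrence of period 6.
--
-- Equality forces every inner vertex to have degree 2 and exactly one inner neighbour, and no two quasi-pendant
-- vertices to be adjacent.  Without pendant P₃ all nonpendant vertices then lie on the cycle, in the order c a b.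

open import Defs hiding (sym; irrefl)
open import Algebra.Bundles using (CommutativeRing)
import Algebra.Properties.CommutativeMonoid.Sum as CMSum
import Algebra.Properties.Semiring.Sum as SRSum
open import Data.Bool using (Bool; true; false; if_then_else_; _∧_; _∨_; not; T)
import Data.Bool.Properties as Bool
open import Data.Empty using (⊥)
open import Data.Fin using (Fin; toℕ; punchIn; punchOut; fromℕ; fromℕ<; inject₁; inject≤; cast; join; splitAt; combine; remQuot) renaming (zero to fzero; suc to fsuc)
open import Data.Fin.Properties using (_≟_; any?; toℕ-fromℕ<; toℕ-fromℕ; toℕ-inject₁; toℕ-injective; toℕ<n; toℕ-cast; toℕ-combine; toℕ-↑ˡ; toℕ-↑ʳ; cast-involutive; splitAt-join; join-splitAt; remQuot-combine; combine-remQuot; pigeonhole; punchOut-injective; inject≤-injective)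
open import Data.Nat using (ℕ; zero; suc; _+_; _*_; _∸_; _≤_; _<_; z≤n; s≤s; _≡ᵇ_; _<ᵇ_; _≤ᵇ_)
import Data.Nat.Properties as ℕ
open import Data.Nat.Tactic.RingSolver using (solve-∀)
open import Data.Product using (Σ; _×_; _,_; proj₁; proj₂)
open import Data.Rational using (ℚ; 0ℚ; 1ℚ; -_; 1/_; Positive; NonNegative; nonNegative; nonPositive; ≢-nonZero) renaming (_+_ to _+ℚ_; _*_ to _*ℚ_; _-_ to _-ℚ_; _≤_ to _≤ℚ_)
import Data.Rational.Properties as ℚ
open import Data.Rational.Solver using (module +-*-Solver)
open import Data.Sum using (_⊎_; inj₁; inj₂; swap)
open import Data.Vec.Functional using (insertAt)
open import Data.Vec.Functional.Properties using (insertAt-lookup; insertAt-punchIn)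
open import Function using (_∘_)
open import Function.Bundles using (Equivalence; Inverse; mk↔ₛ′; mk⇔; _⇔_)
open import Relation.Binary.Definitions using (tri<; tri≈; tri>)
open import Relation.Binary.PropositionalEquality hiding ([_])
open import Relation.Nullary using (¬_; Dec; yes; no; does; ¬?; contradiction; _×-dec_; _⊎-dec_)
open import Relation.Nullary.Decidable using (decidable-stable; dec-true; dec-false; does-⇔)

-- Eigenvectors satisfy `(deg i - 1) * x i = sum of x over the neighbours of i`, so a vertex with
-- value zero determines its last unknown neighbour. The orientation replaces induction over trees:
-- nonzero values are traced backwards along `f`, and such a trace must stop at a pendant vertex or
-- reach a chosen root on the cycle.
--
-- When the cycle has a quasi-pendant vertex, `n` is a sum of four numbers that are each at least
-- `m`: the number of pendant vertices, taken twice, and the sizes of the two colour classes of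
-- inner vertices. Equality makes all four equal to `m`, so every structural claim is proved by
-- showing that its failure would save a vertex in one of the determining sets.
--
-- The obstacle is an odd cycle, which has no proper 2-colouring. The parity of the distance to a
-- root leaves at most one bad edge, from the root to its image. A quasi-pendant root makes that
-- edge harmless, since the root is not inner; on an all-inner cycle the degree 3 of the root has to
-- compensate. From length 6 on, the recurrence along the cycle can close up with nonzero values;
-- the long cycle then pays for two extra vertices by its own six inner ones.

private
  module Σℕ = CMSum ℕ.+-0-commutativeMonoid
  module Σℚ = CMSum ℚ.+-0-commutativeMonoid
  module Σℚ* = SRSum (CommutativeRing.semiring ℚ.+-*-commutativeRing)

-- Finite sums and counting.

sumℕ≡ : ∀ {n} (f : Fin n → ℕ) → sumℕ f ≡ Σℕ.sum f
sumℕ≡ {zero}  f = refl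
sumℕ≡ {suc n} f = cong (f fzero +_) (sumℕ≡ (f ∘ fsuc))

sumℚ≡ : ∀ {n} (f : Fin n → ℚ) → sumℚ f ≡ Σℚ.sum f
sumℚ≡ {zero}  f = refl
sumℚ≡ {suc n} f = cong (f fzero +ℚ_) (sumℚ≡ (f ∘ fsuc))

sumℕ-cong : ∀ {n} {f g : Fin n → ℕ} → (∀ i → f i ≡ g i) → sumℕ f ≡ sumℕ g
sumℕ-cong {zero}  h = refl
sumℕ-cong {suc n} h = cong₂ _+_ (h fzero) (sumℕ-cong (h ∘ fsuc))

sumℚ-cong : ∀ {n} {f g : Fin n → ℚ} → (∀ i → f i ≡ g i) → sumℚ f ≡ sumℚ g
sumℚ-cong {zero}  h = refl
sumℚ-cong {suc n} h = cong₂ _+ℚ_ (h fzero) (sumℚ-cong (h ∘ fsuc))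

sumℕ-mono : ∀ {n} {f g : Fin n → ℕ} → (∀ i → f i ≤ g i) → sumℕ f ≤ sumℕ g
sumℕ-mono {zero}  h = z≤n
sumℕ-mono {suc n} h = ℕ.+-mono-≤ (h fzero) (sumℕ-mono (h ∘ fsuc))

sumℕ-+ : ∀ {n} (f g : Fin n → ℕ) → sumℕ (λ i → f i + g i) ≡ sumℕ f + sumℕ g
sumℕ-+ f g rewrite sumℕ≡ f | sumℕ≡ g | sumℕ≡ (λ i → f i + g i) = Σℕ.∑-distrib-+ f g

sumℚ-+ : ∀ {n} (f g : Fin n → ℚ) → sumℚ (λ i → f i +ℚ g i) ≡ sumℚ f +ℚ sumℚ g
sumℚ-+ f g rewrite sumℚ≡ f | sumℚ≡ g | sumℚ≡ (λ i → f i +ℚ g i) = Σℚ.∑-distrib-+ f g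

sumℕ-swap : ∀ {n k} (f : Fin n → Fin k → ℕ) → sumℕ (λ i → sumℕ (f i)) ≡ sumℕ (λ j → sumℕ (λ i → f i j))
sumℕ-swap f = trans (sumℕ-cong (λ i → sumℕ≡ (f i))) (trans (sumℕ≡ (λ i → Σℕ.sum (f i)))
  (trans (Σℕ.∑-comm f) (sym (trans (sumℕ-cong (λ j → sumℕ≡ (λ i → f i j))) (sumℕ≡ (λ j → Σℕ.sum (λ i → f i j)))))))

sumℚ-swap : ∀ {n k} (f : Fin n → Fin k → ℚ) → sumℚ (λ i → sumℚ (f i)) ≡ sumℚ (λ j → sumℚ (λ i → f i j))
sumℚ-swap f = trans (sumℚ-cong (λ i → sumℚ≡ (f i))) (trans (sumℚ≡ (λ i → Σℚ.sum (f i)))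
  (trans (Σℚ.∑-comm f) (sym (trans (sumℚ-cong (λ j → sumℚ≡ (λ i → f i j))) (sumℚ≡ (λ j → Σℚ.sum (λ i → f i j)))))))

sumℚ-*ˡ : ∀ {n} (c : ℚ) (f : Fin n → ℚ) → sumℚ (λ i → c *ℚ f i) ≡ c *ℚ sumℚ f
sumℚ-*ˡ c f rewrite sumℚ≡ f | sumℚ≡ (λ i → c *ℚ f i) = sym (Σℚ*.*-distribˡ-sum c f)

sumℚ-*ʳ : ∀ {n} (c : ℚ) (f : Fin n → ℚ) → sumℚ (λ i → f i *ℚ c) ≡ sumℚ f *ℚ c
sumℚ-*ʳ c f rewrite sumℚ≡ f | sumℚ≡ (λ i → f i *ℚ c) = sym (Σℚ*.*-distribʳ-sum c f)

sumℚ-punchIn : ∀ {n} (i : Fin (suc n)) (f : Fin (suc n) → ℚ) → sumℚ f ≡ f i +ℚ sumℚ (λ j → f (punchIn i j))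
sumℚ-punchIn i f = trans (sumℚ≡ f) (trans (Σℚ.sum-remove {i = i} f) (cong (f i +ℚ_) (sym (sumℚ≡ (λ j → f (punchIn i j))))))

sumℕ-const0 : ∀ {n} {f : Fin n → ℕ} → (∀ i → f i ≡ 0) → sumℕ f ≡ 0
sumℕ-const0 {zero}  h = refl
sumℕ-const0 {suc n} h rewrite h fzero = sumℕ-const0 (h ∘ fsuc)

sumℚ-const0 : ∀ {n} {f : Fin n → ℚ} → (∀ i → f i ≡ 0ℚ) → sumℚ f ≡ 0ℚ
sumℚ-const0 {zero}  h = refl
sumℚ-const0 {suc n} h = trans (cong₂ _+ℚ_ (h fzero) (sumℚ-const0 (h ∘ fsuc))) (ℚ.+-identityˡ 0ℚ)

sumℕ-single : ∀ {n} (f : Fin n → ℕ) i → (∀ j → j ≢ i → f j ≡ 0) → sumℕ f ≡ f i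
sumℕ-single {suc n} f fzero    h = trans (cong (f fzero +_) (sumℕ-const0 (λ j → h (fsuc j) (λ ())))) (ℕ.+-identityʳ _)
sumℕ-single {suc n} f (fsuc i) h rewrite h fzero (λ ()) =
  sumℕ-single (f ∘ fsuc) i (λ j j≢i → h (fsuc j) (λ { refl → j≢i refl }))

sumℚ-single : ∀ {n} (f : Fin n → ℚ) i → (∀ j → j ≢ i → f j ≡ 0ℚ) → sumℚ f ≡ f i
sumℚ-single {suc n} f fzero    h = trans (cong (f fzero +ℚ_) (sumℚ-const0 (λ j → h (fsuc j) (λ ())))) (ℚ.+-identityʳ _)
sumℚ-single {suc n} f (fsuc i) h = trans (cong₂ _+ℚ_ (h fzero (λ ()))
  (sumℚ-single (f ∘ fsuc) i (λ j j≢i → h (fsuc j) (λ { refl → j≢i refl })))) (ℚ.+-identityˡ _)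

private
  only-at except : ∀ {n} → Fin n → (Fin n → ℚ) → Fin n → ℚ
  only-at i f j = if does (j ≟ i) then f j else 0ℚ
  except i f j = if does (j ≟ i) then 0ℚ else f j

  except-≢ : ∀ {n} {i j : Fin n} (f : Fin n → ℚ) → j ≢ i → except i f j ≡ f j
  except-≢ {i = i} {j} f j≢i rewrite dec-false (j ≟ i) j≢i = refl

  except-zero : ∀ {n} {i j : Fin n} (f : Fin n → ℚ) → (j ≢ i → f j ≡ 0ℚ) → except i f j ≡ 0ℚ
  except-zero {i = i} {j} f h with j ≟ i
  ... | yes _   = refl
  ... | no  j≢i = h j≢i

  sumℚ-except : ∀ {n} i (f : Fin n → ℚ) → sumℚ f ≡ f i +ℚ sumℚ (except i f)
  sumℚ-except i f = trans (sumℚ-cong split) (trans (sumℚ-+ (only-at i f) (except i f))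
    (cong (_+ℚ sumℚ (except i f)) (trans (sumℚ-single (only-at i f) i away) at)))
    where
    split : ∀ j → f j ≡ only-at i f j +ℚ except i f j
    split j with j ≟ i
    ... | yes _ = sym (ℚ.+-identityʳ _)
    ... | no  _ = sym (ℚ.+-identityˡ _)
    away : ∀ j → j ≢ i → only-at i f j ≡ 0ℚ
    away j j≢i rewrite dec-false (j ≟ i) j≢i = refl
    at : only-at i f i ≡ f i
    at rewrite dec-true (i ≟ i) refl = refl

sumℚ-pair : ∀ {n} (f : Fin n → ℚ) i k → i ≢ k → (∀ j → j ≢ i → j ≢ k → f j ≡ 0ℚ) → sumℚ f ≡ f i +ℚ f k
sumℚ-pair f i k i≢k h = trans (sumℚ-except i f) (cong (f i +ℚ_)
  (trans (sumℚ-single (except i f) k (λ j j≢k → except-zero f (λ j≢i → h j j≢i j≢k))) (except-≢ f (i≢k ∘ sym))))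

sumℚ-triple : ∀ {n} (f : Fin n → ℚ) i k l → i ≢ k → i ≢ l → k ≢ l →
  (∀ j → j ≢ i → j ≢ k → j ≢ l → f j ≡ 0ℚ) → sumℚ f ≡ f i +ℚ (f k +ℚ f l)
sumℚ-triple f i k l i≢k i≢l k≢l h = trans (sumℚ-except i f) (cong (f i +ℚ_)
  (trans (sumℚ-pair (except i f) k l k≢l (λ j j≢k j≢l → except-zero f (λ j≢i → h j j≢i j≢k j≢l)))
         (cong₂ _+ℚ_ (except-≢ f (i≢k ∘ sym)) (except-≢ f (i≢l ∘ sym)))))

χ : Bool → ℕ
χ b = if b then 1 else 0

count-cong : ∀ {n} {P Q : Fin n → Bool} → (∀ i → P i ≡ Q i) → count P ≡ count Q
count-cong h = sumℕ-cong (λ i → cong χ (h i))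

count-split : ∀ {n} (P C : Fin n → Bool) → count P ≡ count (λ i → P i ∧ C i) + count (λ i → P i ∧ not (C i))
count-split P C = trans (sumℕ-cong (λ i → lem (P i) (C i))) (sumℕ-+ (λ i → χ (P i ∧ C i)) (λ i → χ (P i ∧ not (C i))))
  where
  lem : ∀ a b → χ a ≡ χ (a ∧ b) + χ (a ∧ not b)
  lem false b     = refl
  lem true  false = refl
  lem true  true  = refl

count-split-does : ∀ {n} (P C : Fin n → Bool) →
  count P ≡ count (λ i → P i ∧ does (C i Bool.≟ true)) + count (λ i → P i ∧ does (C i Bool.≟ false))
count-split-does P C = trans (count-split P C)
  (cong₂ _+_ (count-cong (λ i → cong (P i ∧_) (is-true (C i)))) (count-cong (λ i → cong (P i ∧_) (is-false (C i)))))
  where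
  is-true : ∀ b → b ≡ does (b Bool.≟ true)
  is-true true  = refl
  is-true false = refl
  is-false : ∀ b → not b ≡ does (b Bool.≟ false)
  is-false true  = refl
  is-false false = refl

count-singleton : ∀ {n} (a : Fin n) → count (λ i → does (i ≟ a)) ≡ 1
count-singleton a = trans (sumℕ-single _ a (λ j j≢a → cong χ (dec-false (j ≟ a) j≢a))) (cong χ (dec-true (a ≟ a) refl))

_∪₁_ _∖₁_ : ∀ {n} → (Fin n → Bool) → Fin n → Fin n → Bool
(P ∪₁ a) i = P i ∨ does (i ≟ a)
(P ∖₁ a) i = P i ∧ not (does (i ≟ a))

∪₁-here : ∀ {n} (P : Fin n → Bool) a → (P ∪₁ a) a ≡ true
∪₁-here P a with P a
... | true  = refl
... | false = dec-true (a ≟ a) refl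

∪₁-there : ∀ {n} (P : Fin n → Bool) a {i} → P i ≡ true → (P ∪₁ a) i ≡ true
∪₁-there P a {i} h rewrite h = refl

∖₁-intro : ∀ {n} (P : Fin n → Bool) a {i} → P i ≡ true → i ≢ a → (P ∖₁ a) i ≡ true
∖₁-intro P a {i} h i≢a rewrite h | dec-false (i ≟ a) i≢a = refl

count-∪₁ : ∀ {n} (P : Fin n → Bool) a → count (P ∪₁ a) ≤ suc (count P)
count-∪₁ P a = ℕ.≤-trans (sumℕ-mono (λ i → lem (P i) (does (i ≟ a))))
  (ℕ.≤-reflexive (trans (sumℕ-+ (λ i → χ (does (i ≟ a))) (λ i → χ (P i))) (cong (_+ count P) (count-singleton a))))
  where
  lem : ∀ x y → χ (x ∨ y) ≤ χ y + χ x
  lem true  y = ℕ.m≤n+m 1 (χ y)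
  lem false y = ℕ.m≤m+n (χ y) 0

count-∖₁ : ∀ {n} (P : Fin n → Bool) a → P a ≡ true → count P ≡ suc (count (P ∖₁ a))
count-∖₁ P a Pa = trans (count-split P (λ i → does (i ≟ a)))
  (cong (_+ count (P ∖₁ a)) (trans (count-cong same) (count-singleton a)))
  where
  same : ∀ i → P i ∧ does (i ≟ a) ≡ does (i ≟ a)
  same i with i ≟ a
  ... | yes refl rewrite Pa = refl
  ... | no  _    with P i
  ...   | true  = refl
  ...   | false = refl

count-true : ∀ n → count {n} (λ _ → true) ≡ n
count-true zero    = refl
count-true (suc n) = cong suc (count-true n)

-- Double counting of the pairs `(v , g v)` with `P v`: each such `v` gives one pair, and each `u`
-- in `Q` occurs in at least one.
count-surj : ∀ {n k} (P : Fin n → Bool) (Q : Fin k → Bool) (g : Fin n → Fin k) →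
  (∀ u → Q u ≡ true → Σ (Fin n) λ v → P v ≡ true × g v ≡ u) → count Q ≤ count P
count-surj P Q g h = ℕ.≤-trans (sumℕ-mono col) (ℕ.≤-reflexive (trans (sumℕ-swap (λ u v → χ (P v ∧ does (g v ≟ u)))) (sumℕ-cong row)))
  where
  at : ∀ v → χ (P v ∧ does (g v ≟ g v)) ≡ χ (P v)
  at v rewrite dec-true (g v ≟ g v) refl with P v
  ... | true  = refl
  ... | false = refl
  row : ∀ v → sumℕ (λ u → χ (P v ∧ does (g v ≟ u))) ≡ χ (P v)
  row v = trans (sumℕ-single _ (g v) off) (at v)
    where
    off : ∀ u → u ≢ g v → χ (P v ∧ does (g v ≟ u)) ≡ 0
    off u u≢ rewrite dec-false (g v ≟ u) (u≢ ∘ sym) with P v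
    ... | true  = refl
    ... | false = refl
  term≤ : ∀ {n} (f : Fin n → ℕ) i → f i ≤ sumℕ f
  term≤ f fzero    = ℕ.m≤m+n _ _
  term≤ f (fsuc i) = ℕ.≤-trans (term≤ (f ∘ fsuc) i) (ℕ.m≤n+m _ (f fzero))
  col : ∀ u → χ (Q u) ≤ sumℕ (λ v → χ (P v ∧ does (g v ≟ u)))
  col u with Q u in eq
  ... | false = z≤n
  ... | true with h u eq
  ...   | v , Pv , refl = ℕ.≤-trans (ℕ.≤-reflexive (sym (trans (at v) (cong χ Pv)))) (term≤ (λ v' → χ (P v' ∧ does (g v' ≟ g v))) v)

-- Gaussian elimination

-- Induction on the coordinates. A vector that is nonzero at a coordinate of `Z` serves as pivot: it
-- clears this coordinate from the other vectors and is set aside. One condition and one vector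
-- disappear together, so there remain more vectors than conditions.
nontrivial-relation : ∀ {n m} (Z : Fin n → Bool) (ws : Fin m → Vector n) → count Z < m →
  Σ (Fin m → ℚ) λ c → (Σ (Fin m) λ t → c t ≢ 0ℚ) × (∀ i → Z i ≡ true → sumℚ (λ t → c t *ℚ ws t i) ≡ 0ℚ)
nontrivial-relation {zero} {suc m} Z ws _ = (λ _ → 1ℚ) , (fzero , λ ()) , λ ()
nontrivial-relation {suc n} {m} Z ws lt with Z fzero in eq
... | false with nontrivial-relation (Z ∘ fsuc) (λ t → ws t ∘ fsuc) lt
...   | c , nz , zero-on = c , nz , λ { fzero Z0 → contradiction (trans (sym eq) Z0) (λ ()) ; (fsuc i) → zero-on i }
nontrivial-relation {suc n} {m} Z ws lt | true with any? (λ t → ¬? (ws t fzero ℚ.≟ 0ℚ))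
... | no none with nontrivial-relation (Z ∘ fsuc) (λ t → ws t ∘ fsuc) (ℕ.<⇒≤ lt)
...   | c , nz , zero-on = c , nz , λ { fzero _ → sumℚ-const0 (λ t → trans (cong (c t *ℚ_) (row0 t)) (ℚ.*-zeroʳ (c t))) ; (fsuc i) → zero-on i }
  where
  row0 : ∀ t → ws t fzero ≡ 0ℚ
  row0 t = decidable-stable (ws t fzero ℚ.≟ 0ℚ) (λ ne → none (t , ne))
nontrivial-relation {suc n} {suc m} Z ws (s≤s lt) | true | yes (j , pivot≢0)
  with nontrivial-relation (Z ∘ fsuc) (λ t i → ws (punchIn j t) (fsuc i) -ℚ (ws (punchIn j t) fzero *ℚ (1/ ws j fzero) {{≢-nonZero pivot≢0}}) *ℚ ws j (fsuc i)) lt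
... | c' , (t₀ , c't₀≢0) , zero-on = c , (punchIn j t₀ , λ e → c't₀≢0 (trans (sym (insertAt-punchIn c' j e₀ t₀)) e)) , rows
  where
  instance nzp = ≢-nonZero pivot≢0
  r : Fin m → ℚ
  r t = ws (punchIn j t) fzero *ℚ 1/ ws j fzero
  -- The coefficient of the pivot vector collects what the reduction subtracted: the combination of
  -- the original vectors then equals the combination `c'` of the reduced ones.
  e₀ : ℚ
  e₀ = - sumℚ (λ t → c' t *ℚ r t)
  c : Fin (suc m) → ℚ
  c = insertAt c' j e₀
  red : ∀ i → sumℚ (λ t → c t *ℚ ws t i) ≡ sumℚ (λ t → c' t *ℚ (ws (punchIn j t) i -ℚ r t *ℚ ws j i))
  red i = begin
    sumℚ (λ t → c t *ℚ ws t i)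
      ≡⟨ sumℚ-punchIn j (λ t → c t *ℚ ws t i) ⟩
    c j *ℚ ws j i +ℚ sumℚ (λ t → c (punchIn j t) *ℚ ws (punchIn j t) i)
      ≡⟨ cong₂ _+ℚ_ (trans (cong (_*ℚ ws j i) (insertAt-lookup c' j e₀))
                      (solve 2 (λ s w → :- s :* w := con 0ℚ :- s :* w) refl (sumℚ (λ t → c' t *ℚ r t)) (ws j i)))
           (sumℚ-cong (λ t → cong (_*ℚ ws (punchIn j t) i) (insertAt-punchIn c' j e₀ t))) ⟩
    (0ℚ -ℚ sumℚ (λ t → c' t *ℚ r t) *ℚ ws j i) +ℚ A
      ≡⟨ cong (λ z → (0ℚ -ℚ z) +ℚ A) (sym (sumℚ-*ʳ (ws j i) (λ t → c' t *ℚ r t))) ⟩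
    (0ℚ -ℚ B) +ℚ A
      ≡⟨ solve 2 (λ a b → (con 0ℚ :- b) :+ a := a :+ con (- 1ℚ) :* b) refl A B ⟩
    A +ℚ (- 1ℚ) *ℚ B
      ≡⟨ cong (A +ℚ_) (sym (sumℚ-*ˡ (- 1ℚ) (λ t → (c' t *ℚ r t) *ℚ ws j i))) ⟩
    A +ℚ sumℚ (λ t → (- 1ℚ) *ℚ ((c' t *ℚ r t) *ℚ ws j i))
      ≡⟨ sym (sumℚ-+ (λ t → c' t *ℚ ws (punchIn j t) i) (λ t → (- 1ℚ) *ℚ ((c' t *ℚ r t) *ℚ ws j i))) ⟩
    sumℚ (λ t → c' t *ℚ ws (punchIn j t) i +ℚ (- 1ℚ) *ℚ ((c' t *ℚ r t) *ℚ ws j i))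
      ≡⟨ sumℚ-cong (λ t → solve 4 (λ a b s w → a :* b :+ con (- 1ℚ) :* ((a :* s) :* w) := a :* (b :- s :* w)) refl
                          (c' t) (ws (punchIn j t) i) (r t) (ws j i)) ⟩
    sumℚ (λ t → c' t *ℚ (ws (punchIn j t) i -ℚ r t *ℚ ws j i)) ∎
    where
    open ≡-Reasoning
    open +-*-Solver
    A = sumℚ (λ t → c' t *ℚ ws (punchIn j t) i)
    B = sumℚ (λ t → (c' t *ℚ r t) *ℚ ws j i)
  rows : ∀ i → Z i ≡ true → sumℚ (λ t → c t *ℚ ws t i) ≡ 0ℚ
  rows (fsuc i) Zi = trans (red (fsuc i)) (zero-on i Zi)
  rows fzero    _  = trans (red fzero) (sumℚ-const0 (λ t → trans (cong (c' t *ℚ_) (cancel t)) (ℚ.*-zeroʳ (c' t))))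
    where
    cancel : ∀ t → ws (punchIn j t) fzero -ℚ r t *ℚ ws j fzero ≡ 0ℚ
    cancel t = trans (cong (w -ℚ_) (trans (ℚ.*-assoc w (1/ ws j fzero) (ws j fzero))
      (trans (cong (w *ℚ_) (ℚ.*-inverseˡ (ws j fzero))) (ℚ.*-identityʳ w)))) (ℚ.+-inverseʳ w)
      where w = ws (punchIn j t) fzero

-- More than `count Z` vectors have a nontrivial combination vanishing on `Z`. It lies in the
-- eigenspace, hence is zero everywhere, against independence.
determining-bound : ∀ {n m} (M : Fin n → Fin n → ℚ) (λ' : ℚ) (Z : Fin n → Bool) →
  (∀ x → InEigenspace M λ' x → (∀ i → Z i ≡ true → x i ≡ 0ℚ) → ∀ i → x i ≡ 0ℚ) →
  IndepEigenFamily M λ' m → m ≤ count Z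
determining-bound {n} {m} M λ' Z determined (vs , indep , eig) with m ℕ.≤? count Z
... | yes le = le
... | no ¬le with nontrivial-relation Z vs (ℕ.≰⇒> ¬le)
...   | c , (t , ct≢0) , zero-on = contradiction (indep c (determined y y-eig zero-on) t) ct≢0
  where
  y : Vector n
  y i = sumℚ (λ s → c s *ℚ vs s i)
  open ≡-Reasoning
  open +-*-Solver
  y-eig : InEigenspace M λ' y
  y-eig i = begin
    sumℚ (λ j → M i j *ℚ y j)
      ≡⟨ sumℚ-cong (λ j → sym (sumℚ-*ˡ (M i j) (λ s → c s *ℚ vs s j))) ⟩
    sumℚ (λ j → sumℚ (λ s → M i j *ℚ (c s *ℚ vs s j)))
      ≡⟨ sumℚ-swap (λ j s → M i j *ℚ (c s *ℚ vs s j)) ⟩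
    sumℚ (λ s → sumℚ (λ j → M i j *ℚ (c s *ℚ vs s j)))
      ≡⟨ sumℚ-cong (λ s → trans (sumℚ-cong (λ j → solve 3 (λ a b d → a :* (b :* d) := b :* (a :* d)) refl (M i j) (c s) (vs s j)))
                                (sumℚ-*ˡ (c s) (λ j → M i j *ℚ vs s j))) ⟩
    sumℚ (λ s → c s *ℚ sumℚ (λ j → M i j *ℚ vs s j))
      ≡⟨ sumℚ-cong (λ s → trans (cong (c s *ℚ_) (eig s i))
           (solve 3 (λ a b d → b :* (a :* d) := a :* (b :* d)) refl λ' (c s) (vs s i))) ⟩
    sumℚ (λ s → λ' *ℚ (c s *ℚ vs s i))
      ≡⟨ sumℚ-*ˡ λ' (λ s → c s *ℚ vs s i) ⟩
    λ' *ℚ y i ∎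

-- Witnesses from counts; positivity of rational multiples and sums.

true≢false : true ≢ false
true≢false ()

∧-true : ∀ {a b} → a ∧ b ≡ true → a ≡ true × b ≡ true
∧-true {true} {true} _ = refl , refl

¬true : ∀ {b} → b ≢ true → b ≡ false
¬true {true}  h = contradiction refl h
¬true {false} h = refl

∖₁-elim : ∀ {n} (P : Fin n → Bool) a {i} → (P ∖₁ a) i ≡ true → P i ≡ true × i ≢ a
∖₁-elim P a {i} h with P i | i ≟ a
... | true | no i≢a = refl , i≢a

count-witness : ∀ {n} (P : Fin n → Bool) → count P ≢ 0 → Σ (Fin n) λ i → P i ≡ true
count-witness P h with any? (λ i → P i Bool.≟ true)
... | yes w = w
... | no no-w = contradiction (sumℕ-const0 (λ i → cong χ (¬true (λ e → no-w (i , e))))) h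

count-unique : ∀ {n} (P : Fin n → Bool) → count P ≡ 1 → ∀ {a b} → P a ≡ true → P b ≡ true → b ≡ a
count-unique P c1 {a} {b} Pa Pb with b ≟ a
... | yes e = e
... | no b≢a = contradiction (trans (sym c1) (trans (count-∖₁ P a Pa) (cong suc (count-∖₁ (P ∖₁ a) b (∖₁-intro P a Pb b≢a))))) (λ ())

count-two : ∀ {n} (P : Fin n → Bool) → count P ≡ 2 → ∀ {a b c} → P a ≡ true → P b ≡ true → a ≢ b → P c ≡ true → c ≡ a ⊎ c ≡ b
count-two P c2 {a} {b} {c} Pa Pb a≢b Pc with c ≟ a
... | yes e = inj₁ e
... | no c≢a = inj₂ (count-unique (P ∖₁ a) (ℕ.suc-injective (trans (sym (count-∖₁ P a Pa)) c2))
                 (∖₁-intro P a Pb (a≢b ∘ sym)) (∖₁-intro P a Pc c≢a))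

count-other : ∀ {n} (P : Fin n → Bool) {a} → P a ≡ true → count P ≢ 1 → Σ (Fin n) λ b → P b ≡ true × b ≢ a
count-other P {a} Pa ne with count-witness (P ∖₁ a) (λ e → ne (trans (count-∖₁ P a Pa) (cong suc e)))
... | b , h = b , ∖₁-elim P a h

count-≥2 : ∀ {n} (P : Fin n → Bool) {a} → P a ≡ true → count P ≢ 1 → Σ ℕ λ d → count P ≡ suc (suc d)
count-≥2 P {a} Pa ne with count-other P Pa ne
... | b , Pb , b≢a = _ , trans (count-∖₁ P a Pa) (cong suc (count-∖₁ (P ∖₁ a) b (∖₁-intro P a Pb b≢a)))

fromℕℚ-nonNeg : ∀ k → NonNegative (fromℕℚ k)
fromℕℚ-nonNeg zero    = _
fromℕℚ-nonNeg (suc k) = ℚ.nonNeg+nonNeg⇒nonNeg 1ℚ (fromℕℚ k) {{fromℕℚ-nonNeg k}}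

fromℕℚ-pos : ∀ k → Positive (fromℕℚ (suc k))
fromℕℚ-pos k = ℚ.pos+nonNeg⇒pos 1ℚ (fromℕℚ k) {{fromℕℚ-nonNeg k}}

fromℕℚ-cancel-≤ : ∀ k {y z} → fromℕℚ (suc k) *ℚ y ≤ℚ fromℕℚ (suc k) *ℚ z → y ≤ℚ z
fromℕℚ-cancel-≤ k = ℚ.*-cancelˡ-≤-pos (fromℕℚ (suc k)) {{fromℕℚ-pos k}}

fromℕℚ-cancel-0 : ∀ k {y} → fromℕℚ (suc k) *ℚ y ≡ 0ℚ → y ≡ 0ℚ
fromℕℚ-cancel-0 k {y} e = ℚ.≤-antisym (fromℕℚ-cancel-≤ k (ℚ.≤-reflexive e')) (fromℕℚ-cancel-≤ k (ℚ.≤-reflexive (sym e')))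
  where e' = trans e (sym (ℚ.*-zeroʳ (fromℕℚ (suc k))))

fromℕℚ-+ : ∀ a b → fromℕℚ (a + b) ≡ fromℕℚ a +ℚ fromℕℚ b
fromℕℚ-+ zero    b = sym (ℚ.+-identityˡ _)
fromℕℚ-+ (suc a) b = trans (cong (1ℚ +ℚ_) (fromℕℚ-+ a b)) (sym (ℚ.+-assoc 1ℚ (fromℕℚ a) (fromℕℚ b)))

ind : Bool → ℚ → ℚ
ind b z = if b then z else 0ℚ

fromℕℚ-count : ∀ {n} (P : Fin n → Bool) → fromℕℚ (count P) ≡ sumℚ (λ j → ind (P j) 1ℚ)
fromℕℚ-count {zero}  P = refl
fromℕℚ-count {suc n} P = trans (fromℕℚ-+ (χ (P fzero)) _) (cong₂ _+ℚ_ (lem (P fzero)) (fromℕℚ-count (P ∘ fsuc)))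
  where
  lem : ∀ b → fromℕℚ (χ b) ≡ ind b 1ℚ
  lem true  = ℚ.+-identityʳ 1ℚ
  lem false = refl

nonNeg-sum-zero : ∀ {n} (g : Fin n → ℚ) → (∀ i → 0ℚ ≤ℚ g i) → sumℚ g ≡ 0ℚ → ∀ i → g i ≡ 0ℚ
nonNeg-sum : ∀ {n} (g : Fin n → ℚ) → (∀ i → 0ℚ ≤ℚ g i) → 0ℚ ≤ℚ sumℚ g
nonNeg-sum {zero}  g h = ℚ.≤-refl
nonNeg-sum {suc n} g h = subst (_≤ℚ sumℚ g) (ℚ.+-identityˡ 0ℚ) (ℚ.+-mono-≤ (h fzero) (nonNeg-sum (g ∘ fsuc) (h ∘ fsuc)))
nonNeg-sum-zero {suc n} g h e = λ { fzero → head0 ; (fsuc i) → nonNeg-sum-zero (g ∘ fsuc) (h ∘ fsuc) tail0 i }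
  where
  S = sumℚ (g ∘ fsuc)
  head0 : g fzero ≡ 0ℚ
  head0 = ℚ.≤-antisym (subst₂ _≤ℚ_ (ℚ.+-identityʳ (g fzero)) e (ℚ.+-monoʳ-≤ (g fzero) (nonNeg-sum (g ∘ fsuc) (h ∘ fsuc)))) (h fzero)
  tail0 : S ≡ 0ℚ
  tail0 = trans (sym (ℚ.+-identityˡ S)) (trans (cong (_+ℚ S) (sym head0)) e)

-- Eigenvectors for the eigenvalue 1

Eig : ∀ {n} → Graph n → Vector n → Set
Eig G = InEigenspace (Laplacian G) 1ℚ

nbSum : ∀ {n} → Graph n → Vector n → Fin n → ℚ
nbSum G x i = sumℚ (λ j → ind (adj G i j) (x j))

δ-refl : ∀ {n} (i : Fin n) → δ i i ≡ 1ℚ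
δ-refl i with i ≟ i
... | yes _ = refl
... | no ne = contradiction refl ne

δ-≢ : ∀ {n} {i j : Fin n} → i ≢ j → δ i j ≡ 0ℚ
δ-≢ {i = i} {j} ne with i ≟ j
... | yes e = contradiction e ne
... | no  _ = refl

module _ {n} (G : Graph n) where
  open ≡-Reasoning
  open +-*-Solver

  laplacian-apply : ∀ (x : Vector n) i → sumℚ (λ j → Laplacian G i j *ℚ x j) ≡ fromℕℚ (deg G i) *ℚ x i -ℚ nbSum G x i
  laplacian-apply x i = begin
    sumℚ (λ j → Laplacian G i j *ℚ x j)
      ≡⟨ sumℚ-cong (λ j → term j (adj G i j)) ⟩
    sumℚ (λ j → (δ i j *ℚ D) *ℚ x j +ℚ (- 1ℚ) *ℚ ind (adj G i j) (x j))
      ≡⟨ sumℚ-+ (λ j → (δ i j *ℚ D) *ℚ x j) (λ j → (- 1ℚ) *ℚ ind (adj G i j) (x j)) ⟩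
    sumℚ (λ j → (δ i j *ℚ D) *ℚ x j) +ℚ sumℚ (λ j → (- 1ℚ) *ℚ ind (adj G i j) (x j))
      ≡⟨ cong₂ _+ℚ_ (trans (sumℚ-single (λ j → (δ i j *ℚ D) *ℚ x j) i off) (cong (λ z → (z *ℚ D) *ℚ x i) (δ-refl i)))
                    (sumℚ-*ˡ (- 1ℚ) (λ j → ind (adj G i j) (x j))) ⟩
    (1ℚ *ℚ D) *ℚ x i +ℚ (- 1ℚ) *ℚ nbSum G x i
      ≡⟨ solve 3 (λ d y s → (con 1ℚ :* d) :* y :+ con (- 1ℚ) :* s := d :* y :- s) refl D (x i) (nbSum G x i) ⟩
    D *ℚ x i -ℚ nbSum G x i ∎
    where
    D = fromℕℚ (deg G i)
    off : ∀ j → j ≢ i → (δ i j *ℚ D) *ℚ x j ≡ 0ℚ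
    off j j≢i = trans (cong (λ z → (z *ℚ D) *ℚ x j) (δ-≢ (j≢i ∘ sym))) (trans (cong (_*ℚ x j) (ℚ.*-zeroˡ D)) (ℚ.*-zeroˡ (x j)))
    term : ∀ j b → (δ i j *ℚ D -ℚ (if b then 1ℚ else 0ℚ)) *ℚ x j ≡ (δ i j *ℚ D) *ℚ x j +ℚ (- 1ℚ) *ℚ ind b (x j)
    term j true  = solve 2 (λ a y → (a :- con 1ℚ) :* y := a :* y :+ con (- 1ℚ) :* y) refl (δ i j *ℚ D) (x j)
    term j false = solve 2 (λ a y → (a :- con 0ℚ) :* y := a :* y :+ con (- 1ℚ) :* con 0ℚ) refl (δ i j *ℚ D) (x j)

  eig-degree : ∀ {x} → Eig G x → ∀ i → fromℕℚ (deg G i) *ℚ x i ≡ x i +ℚ nbSum G x i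
  eig-degree {x} ex i = begin
    d                          ≡⟨ solve 2 (λ a b → a := (a :- b) :+ b) refl d (nbSum G x i) ⟩
    (d -ℚ nbSum G x i) +ℚ nbSum G x i  ≡⟨ cong (_+ℚ nbSum G x i) (trans (sym (laplacian-apply x i)) (trans (ex i) (ℚ.*-identityˡ (x i)))) ⟩
    x i +ℚ nbSum G x i ∎
    where d = fromℕℚ (deg G i) *ℚ x i

  -- This form of the Laplacian hides the degree. It is the convenient one at vertices whose
  -- neighbours are listed explicitly.
  difference-sum : ∀ (x : Vector n) i → sumℚ (λ j → ind (adj G i j) (x i -ℚ x j)) ≡ fromℕℚ (deg G i) *ℚ x i -ℚ nbSum G x i
  difference-sum x i = begin
    sumℚ (λ j → ind (adj G i j) (x i -ℚ x j))
      ≡⟨ sumℚ-cong (λ j → term j (adj G i j)) ⟩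
    sumℚ (λ j → x i *ℚ ind (adj G i j) 1ℚ +ℚ (- 1ℚ) *ℚ ind (adj G i j) (x j))
      ≡⟨ sumℚ-+ (λ j → x i *ℚ ind (adj G i j) 1ℚ) (λ j → (- 1ℚ) *ℚ ind (adj G i j) (x j)) ⟩
    sumℚ (λ j → x i *ℚ ind (adj G i j) 1ℚ) +ℚ sumℚ (λ j → (- 1ℚ) *ℚ ind (adj G i j) (x j))
      ≡⟨ cong₂ _+ℚ_ (trans (sumℚ-*ˡ (x i) (λ j → ind (adj G i j) 1ℚ)) (cong (x i *ℚ_) (sym (fromℕℚ-count (adj G i)))))
                    (sumℚ-*ˡ (- 1ℚ) (λ j → ind (adj G i j) (x j))) ⟩
    x i *ℚ D +ℚ (- 1ℚ) *ℚ nbSum G x i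
      ≡⟨ solve 3 (λ d y s → y :* d :+ con (- 1ℚ) :* s := d :* y :- s) refl D (x i) (nbSum G x i) ⟩
    D *ℚ x i -ℚ nbSum G x i ∎
    where
    D = fromℕℚ (deg G i)
    term : ∀ j b → ind b (x i -ℚ x j) ≡ x i *ℚ ind b 1ℚ +ℚ (- 1ℚ) *ℚ ind b (x j)
    term j true  = solve 2 (λ y z → y :- z := y :* con 1ℚ :+ con (- 1ℚ) :* z) refl (x i) (x j)
    term j false = solve 1 (λ y → con 0ℚ := y :* con 0ℚ :+ con (- 1ℚ) :* con 0ℚ) refl (x i)

  eig-difference : ∀ {x} → Eig G x → ∀ i → sumℚ (λ j → ind (adj G i j) (x i -ℚ x j)) ≡ x i
  eig-difference {x} ex i = trans (difference-sum x i) (trans (sym (laplacian-apply x i)) (trans (ex i) (ℚ.*-identityˡ (x i))))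

  difference-eig : ∀ {x} → (∀ i → sumℚ (λ j → ind (adj G i j) (x i -ℚ x j)) ≡ x i) → Eig G x
  difference-eig {x} h i = trans (laplacian-apply x i) (trans (sym (difference-sum x i)) (trans (h i) (sym (ℚ.*-identityˡ (x i)))))

  nbSum-single : ∀ (x : Vector n) {i j₀} → adj G i j₀ ≡ true → (∀ j → adj G i j ≡ true → j ≢ j₀ → x j ≡ 0ℚ) → nbSum G x i ≡ x j₀
  nbSum-single x {i} {j₀} a h = trans (sumℚ-single _ j₀ off) (cong (λ b → ind b (x j₀)) a)
    where
    off : ∀ j → j ≢ j₀ → ind (adj G i j) (x j) ≡ 0ℚ
    off j ne with adj G i j in eq
    ... | true  = h j eq ne
    ... | false = refl

  nbSum-zero : ∀ (x : Vector n) {i} → (∀ j → adj G i j ≡ true → x j ≡ 0ℚ) → nbSum G x i ≡ 0ℚ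
  nbSum-zero x {i} h = sumℚ-const0 off
    where
    off : ∀ j → ind (adj G i j) (x j) ≡ 0ℚ
    off j with adj G i j in eq
    ... | true  = h j eq
    ... | false = refl

  difference-two : ∀ (x : Vector n) {i a b} → adj G i a ≡ true → adj G i b ≡ true → a ≢ b →
    (∀ j → adj G i j ≡ true → j ≡ a ⊎ j ≡ b) →
    sumℚ (λ j → ind (adj G i j) (x i -ℚ x j)) ≡ (x i -ℚ x a) +ℚ (x i -ℚ x b)
  difference-two x {i} {a} {b} ia ib a≢b only = trans (sumℚ-pair (λ j → ind (adj G i j) (x i -ℚ x j)) a b a≢b off)
    (cong₂ _+ℚ_ (cong (λ c → ind c (x i -ℚ x a)) ia) (cong (λ c → ind c (x i -ℚ x b)) ib))
    where
    off : ∀ j → j ≢ a → j ≢ b → ind (adj G i j) (x i -ℚ x j) ≡ 0ℚ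
    off j j≢a j≢b with adj G i j in eq
    ... | false = refl
    ... | true with only j eq
    ...   | inj₁ e = contradiction e j≢a
    ...   | inj₂ e = contradiction e j≢b

  difference-three : ∀ (x : Vector n) {i a b c} → adj G i a ≡ true → adj G i b ≡ true → adj G i c ≡ true → a ≢ b → a ≢ c → b ≢ c →
    (∀ j → adj G i j ≡ true → j ≡ a ⊎ j ≡ b ⊎ j ≡ c) →
    sumℚ (λ j → ind (adj G i j) (x i -ℚ x j)) ≡ (x i -ℚ x a) +ℚ ((x i -ℚ x b) +ℚ (x i -ℚ x c))
  difference-three x {i} {a} {b} {c} ia ib ic a≢b a≢c b≢c only = trans (sumℚ-triple (λ j → ind (adj G i j) (x i -ℚ x j)) a b c a≢b a≢c b≢c off)
    (cong₂ _+ℚ_ (cong (λ d → ind d (x i -ℚ x a)) ia)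
      (cong₂ _+ℚ_ (cong (λ d → ind d (x i -ℚ x b)) ib) (cong (λ d → ind d (x i -ℚ x c)) ic)))
    where
    off : ∀ j → j ≢ a → j ≢ b → j ≢ c → ind (adj G i j) (x i -ℚ x j) ≡ 0ℚ
    off j j≢a j≢b j≢c with adj G i j in eq
    ... | false = refl
    ... | true with only j eq
    ...   | inj₁ e = contradiction e j≢a
    ...   | inj₂ (inj₁ e) = contradiction e j≢b
    ...   | inj₂ (inj₂ e) = contradiction e j≢c

  difference-one : ∀ (x : Vector n) {i a} → adj G i a ≡ true → (∀ j → adj G i j ≡ true → j ≡ a) →
    sumℚ (λ j → ind (adj G i j) (x i -ℚ x j)) ≡ x i -ℚ x a
  difference-one x {i} {a} ia only = trans (sumℚ-single (λ j → ind (adj G i j) (x i -ℚ x j)) a off) (cong (λ c → ind c (x i -ℚ x a)) ia)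
    where
    off : ∀ j → j ≢ a → ind (adj G i j) (x i -ℚ x j) ≡ 0ℚ
    off j j≢a with adj G i j in eq
    ... | false = refl
    ... | true  = contradiction (only j eq) j≢a

  module _ {x : Vector n} (ex : Eig G x) where

    -- At a vertex of degree 1 the degree equals the eigenvalue, so both sides cancel and the sum
    -- over the neighbours, which is `x u`, is zero.
    pendant-neighbour-zero : ∀ {i u} → deg G i ≡ 1 → adj G i u ≡ true → x u ≡ 0ℚ
    pendant-neighbour-zero {i} {u} d1 iu = begin
      x u                        ≡⟨ solve 2 (λ a b → a := (b :+ a) :- b) refl (x u) (x i) ⟩
      (x i +ℚ x u) -ℚ x i        ≡⟨ cong (_-ℚ x i) (begin
        x i +ℚ x u               ≡⟨ cong (x i +ℚ_) (sym (nbSum-single x iu (λ j ij j≢u → contradiction (count-unique (adj G i) d1 iu ij) j≢u))) ⟩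
        x i +ℚ nbSum G x i       ≡⟨ sym (eig-degree ex i) ⟩
        fromℕℚ (deg G i) *ℚ x i  ≡⟨ cong (λ d → fromℕℚ d *ℚ x i) d1 ⟩
        fromℕℚ 1 *ℚ x i          ≡⟨ ℚ.*-identityˡ (x i) ⟩
        x i ∎) ⟩
      x i -ℚ x i                 ≡⟨ ℚ.+-inverseʳ (x i) ⟩
      0ℚ ∎

    nbSum-at-zero : ∀ {i} → x i ≡ 0ℚ → nbSum G x i ≡ 0ℚ
    nbSum-at-zero {i} xi = begin
      nbSum G x i                ≡⟨ sym (ℚ.+-identityˡ (nbSum G x i)) ⟩
      0ℚ +ℚ nbSum G x i          ≡⟨ cong (_+ℚ nbSum G x i) (sym xi) ⟩
      x i +ℚ nbSum G x i         ≡⟨ sym (eig-degree ex i) ⟩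
      fromℕℚ (deg G i) *ℚ x i    ≡⟨ cong (fromℕℚ (deg G i) *ℚ_) xi ⟩
      fromℕℚ (deg G i) *ℚ 0ℚ     ≡⟨ ℚ.*-zeroʳ (fromℕℚ (deg G i)) ⟩
      0ℚ ∎

    forcing : ∀ {i j₀} → x i ≡ 0ℚ → adj G i j₀ ≡ true → (∀ j → adj G i j ≡ true → j ≢ j₀ → x j ≡ 0ℚ) → x j₀ ≡ 0ℚ
    forcing {i} {j₀} xi a h = trans (sym (nbSum-single x a h)) (nbSum-at-zero xi)

    -- The factor is `deg G i - 1`, written as a successor so that it is visibly positive and can be
    -- cancelled.
    degree-scaled : ∀ {i d} → deg G i ≡ suc (suc d) → fromℕℚ (suc d) *ℚ x i ≡ nbSum G x i
    degree-scaled {i} {d} dg = begin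
      D *ℚ x i                         ≡⟨ solve 2 (λ a y → a :* y := (con 1ℚ :+ a) :* y :- y) refl D (x i) ⟩
      fromℕℚ (suc (suc d)) *ℚ x i -ℚ x i ≡⟨ cong (λ k → fromℕℚ k *ℚ x i -ℚ x i) (sym dg) ⟩
      fromℕℚ (deg G i) *ℚ x i -ℚ x i    ≡⟨ cong (_-ℚ x i) (eig-degree ex i) ⟩
      (x i +ℚ nbSum G x i) -ℚ x i      ≡⟨ solve 2 (λ a b → (b :+ a) :- b := a) refl (nbSum G x i) (x i) ⟩
      nbSum G x i ∎
      where D = fromℕℚ (suc d)

    all-neighbours-zero : ∀ {i d} → deg G i ≡ suc (suc d) → (∀ j → adj G i j ≡ true → x j ≡ 0ℚ) → x i ≡ 0ℚ
    all-neighbours-zero {i} {d} dg h = fromℕℚ-cancel-0 d (trans (degree-scaled dg) (nbSum-zero x h))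

    -- The neighbours of a zero sum to zero. The scalar `t` allows their common sign to be unknown:
    -- it will be the value of `x` at a reference vertex.
    sign-forcing : ∀ {i} t → x i ≡ 0ℚ → (∀ j → adj G i j ≡ true → 0ℚ ≤ℚ t *ℚ x j) → ∀ j → adj G i j ≡ true → t *ℚ x j ≡ 0ℚ
    sign-forcing {i} t xi h j ij = subst (λ b → ind b (t *ℚ x j) ≡ 0ℚ) ij (nonNeg-sum-zero g g≥0 total j)
      where
      g : Fin n → ℚ
      g k = ind (adj G i k) (t *ℚ x k)
      g≥0 : ∀ k → 0ℚ ≤ℚ g k
      g≥0 k with adj G i k in eq
      ... | true  = h k eq
      ... | false = ℚ.≤-refl
      pull : ∀ b k → ind b (t *ℚ x k) ≡ t *ℚ ind b (x k)
      pull true  k = refl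
      pull false k = sym (ℚ.*-zeroʳ t)
      total : sumℚ g ≡ 0ℚ
      total = trans (sumℚ-cong (λ k → pull (adj G i k) k)) (trans (sumℚ-*ˡ t (λ k → ind (adj G i k) (x k)))
        (trans (cong (t *ℚ_) (nbSum-at-zero xi)) (ℚ.*-zeroʳ t)))

    -- At degree 2 the equation is `x i = x a + x b`: along a path this is a second-order recurrence
    -- of period 6.
    eig-two : ∀ {i a b} → adj G i a ≡ true → adj G i b ≡ true → a ≢ b →
      (∀ j → adj G i j ≡ true → j ≡ a ⊎ j ≡ b) → x b ≡ x i -ℚ x a
    eig-two {i} {a} {b} ia ib a≢b only = begin
      x b ≡⟨ solve 3 (λ u v w → w := (u :- v) :- (((u :- v) :+ (u :- w)) :- u)) refl (x i) (x a) (x b) ⟩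
      (x i -ℚ x a) -ℚ (((x i -ℚ x a) +ℚ (x i -ℚ x b)) -ℚ x i)
        ≡⟨ cong (λ z → (x i -ℚ x a) -ℚ (z -ℚ x i)) (trans (sym (difference-two x ia ib a≢b only)) (eig-difference ex i)) ⟩
      (x i -ℚ x a) -ℚ (x i -ℚ x i)
        ≡⟨ solve 2 (λ u v → (u :- v) :- (u :- u) := u :- v) refl (x i) (x a) ⟩
      x i -ℚ x a ∎

    eig-three : ∀ {i a b c} → adj G i a ≡ true → adj G i b ≡ true → adj G i c ≡ true → a ≢ b → a ≢ c → b ≢ c →
      (∀ j → adj G i j ≡ true → j ≡ a ⊎ j ≡ b ⊎ j ≡ c) → x i +ℚ x i ≡ x a +ℚ (x b +ℚ x c)
    eig-three {i} {a} {b} {c} ia ib ic a≢b a≢c b≢c only = begin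
      x i +ℚ x i ≡⟨ solve 4 (λ u v w y → u :+ u := (((u :- v) :+ ((u :- w) :+ (u :- y))) :- u) :+ (v :+ (w :+ y))) refl (x i) (x a) (x b) (x c) ⟩
      (((x i -ℚ x a) +ℚ ((x i -ℚ x b) +ℚ (x i -ℚ x c))) -ℚ x i) +ℚ (x a +ℚ (x b +ℚ x c))
        ≡⟨ cong (λ z → (z -ℚ x i) +ℚ (x a +ℚ (x b +ℚ x c))) (trans (sym (difference-three x ia ib ic a≢b a≢c b≢c only)) (eig-difference ex i)) ⟩
      (x i -ℚ x i) +ℚ (x a +ℚ (x b +ℚ x c))
        ≡⟨ solve 2 (λ u v → (u :- u) :+ v := v) refl (x i) (x a +ℚ (x b +ℚ x c)) ⟩
      x a +ℚ (x b +ℚ x c) ∎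

-- Boolean tests, pendant and quasi-pendant vertices.

anyFin-true : ∀ {n} (P : Fin n → Bool) → anyFin P ≡ true → Σ (Fin n) λ i → P i ≡ true
anyFin-true {suc n} P h with P fzero in eq
... | true  = fzero , eq
... | false with anyFin-true (P ∘ fsuc) h
...   | i , Pi = fsuc i , Pi

true-anyFin : ∀ {n} (P : Fin n → Bool) i → P i ≡ true → anyFin P ≡ true
true-anyFin P fzero    h rewrite h = refl
true-anyFin P (fsuc i) h with P fzero
... | true  = refl
... | false = true-anyFin (P ∘ fsuc) i h

≡ᵇ-true : ∀ m n → (m ≡ᵇ n) ≡ true → m ≡ n
≡ᵇ-true m n h = ℕ.≡ᵇ⇒≡ m n (subst T (sym h) _)

true-≡ᵇ : ∀ m n → m ≡ n → (m ≡ᵇ n) ≡ true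
true-≡ᵇ m n h = Equivalence.to Bool.T-≡ (ℕ.≡⇒≡ᵇ m n h)

module _ {n} (G : Graph n) where
  Pendant Quasi : Fin n → Set
  Pendant v = isPendant G v ≡ true
  Quasi   v = isQuasiPendant G v ≡ true

  pendant⇒deg : ∀ {v} → Pendant v → deg G v ≡ 1
  pendant⇒deg {v} = ≡ᵇ-true (deg G v) 1

  deg⇒pendant : ∀ {v} → deg G v ≡ 1 → Pendant v
  deg⇒pendant {v} = true-≡ᵇ (deg G v) 1

  quasi-pendant : ∀ {u} → Quasi u → Σ (Fin n) λ v → adj G u v ≡ true × Pendant v
  quasi-pendant {u} h with anyFin-true (λ j → adj G u j ∧ isPendant G j) h
  ... | v , e = v , ∧-true e

  pendant-quasi : ∀ {u v} → adj G u v ≡ true → Pendant v → Quasi u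
  pendant-quasi {u} {v} uv pv = true-anyFin _ v (cong₂ _∧_ uv pv)

does-true : ∀ {A : Set} (d : Dec A) → does d ≡ true → A
does-true (yes a) _ = a

-- Iterates, walks and spanning trees.

iter : ∀ {A : Set} → (A → A) → ℕ → A → A
iter f zero    v = v
iter f (suc k) v = f (iter f k v)

iter-+ : ∀ {A : Set} (f : A → A) a b v → iter f (a + b) v ≡ iter f a (iter f b v)
iter-+ f zero    b v = refl
iter-+ f (suc a) b v = cong f (iter-+ f a b v)

iter-comm : ∀ {A : Set} (f : A → A) a b v → iter f a (iter f b v) ≡ iter f b (iter f a v)
iter-comm f a b v = trans (sym (iter-+ f a b v)) (trans (cong (λ k → iter f k v) (ℕ.+-comm a b)) (iter-+ f b a v))

iter-suc : ∀ {A : Set} (f : A → A) k v → iter f (suc k) v ≡ iter f k (f v)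
iter-suc f k v = iter-comm f 1 k v

least : (P : ℕ → Bool) → ∀ k → P k ≡ true → Σ ℕ λ m → P m ≡ true × (∀ j → P j ≡ true → m ≤ j)
least P k Pk with P 0 in eq
... | true  = 0 , eq , λ _ _ → z≤n
least P zero    Pk | false = contradiction (trans (sym Pk) eq) true≢false
least P (suc k) Pk | false with least (P ∘ suc) k Pk
... | m , Pm , min = suc m , Pm , λ { zero P0 → contradiction (trans (sym P0) eq) true≢false ; (suc j) Pj → s≤s (min j Pj) }

sum-bound : ∀ {n} (g : Fin n → ℕ) i → g i ≤ sumℕ g
sum-bound g fzero    = ℕ.m≤m+n _ _
sum-bound g (fsuc i) = ℕ.≤-trans (sum-bound (g ∘ fsuc) i) (ℕ.m≤n+m _ (g fzero))

Rel₂ : ℕ → Set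
Rel₂ n = Fin n → Fin n → Bool

Symmetric₂ : ∀ {n} → Rel₂ n → Set
Symmetric₂ R = ∀ i j → R i j ≡ R j i

reach-trans : ∀ {n} {R : Rel₂ n} {i j k} → Reach R i j → Reach R j k → Reach R i k
reach-trans here       q = q
reach-trans (step e p) q = step e (reach-trans p q)

reach-sym : ∀ {n} {R : Rel₂ n} → Symmetric₂ R → ∀ {i j} → Reach R i j → Reach R j i
reach-sym s here = here
reach-sym s (step {i} {j} e p) = reach-trans (reach-sym s p) (step (trans (s j i) e) here)

record SpanningTree {n} (R : Rel₂ n) (ρ : Fin n) : Set where
  field
    parent : Fin n → Fin n
    dist   : Fin n → ℕ
    parent-edge : ∀ v → v ≢ ρ → R v (parent v) ≡ true
    parent-dist : ∀ v → v ≢ ρ → dist v ≡ suc (dist (parent v))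

module _ {n} (R : Rel₂ n) (ρ : Fin n) where
  private
    walk : ℕ → Fin n → Bool
    walk zero    v = does (v ≟ ρ)
    walk (suc k) v = anyFin (λ j → R v j ∧ walk k j)

    walk-step : ∀ {k v j} → R v j ≡ true → walk k j ≡ true → walk (suc k) v ≡ true
    walk-step {k} {v} {j} e w = true-anyFin (λ j → R v j ∧ walk k j) j (cong₂ _∧_ e w)

    reach-walk : ∀ {v} → Reach R v ρ → Σ ℕ λ k → walk k v ≡ true
    reach-walk here = 0 , dec-true (ρ ≟ ρ) refl
    reach-walk (step e p) with reach-walk p
    ... | k , w = suc k , walk-step {k} e w

    module _ (conn : ∀ v → Reach R v ρ) where
      shortest : ∀ v → Σ ℕ λ m → walk m v ≡ true × (∀ j → walk j v ≡ true → m ≤ j)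
      shortest v = least (λ k → walk k v) (proj₁ (reach-walk (conn v))) (proj₂ (reach-walk (conn v)))

      d : Fin n → ℕ
      d v = proj₁ (shortest v)

      step-back : ∀ v → v ≢ ρ → Σ (Fin n) λ j → R v j ≡ true × d v ≡ suc (d j)
      step-back v v≢ρ with shortest v
      ... | zero  , w , min = contradiction (does-true (v ≟ ρ) w) v≢ρ
      ... | suc m , w , min with anyFin-true (λ j → R v j ∧ walk m j) w
      ...   | j , e = j , proj₁ (∧-true e) , ℕ.≤-antisym
                (min (suc (d j)) (walk-step {d j} (proj₁ (∧-true e)) (proj₁ (proj₂ (shortest j)))))
                (s≤s (proj₂ (proj₂ (shortest j)) m (proj₂ (∧-true e))))

      choose : ∀ v → Dec (v ≡ ρ) → Fin n
      choose v (yes _)  = v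
      choose v (no v≢ρ) = proj₁ (step-back v v≢ρ)

      choose-spec : ∀ v (c : Dec (v ≡ ρ)) → v ≢ ρ → R v (choose v c) ≡ true × d v ≡ suc (d (choose v c))
      choose-spec v (yes e)  v≢ρ = contradiction e v≢ρ
      choose-spec v (no ne)  v≢ρ = proj₂ (step-back v ne)

  abstract
    -- The parent of `v` is the second vertex of a shortest walk from `v` to the root.
    spanningTree : (∀ v → Reach R v ρ) → SpanningTree R ρ
    spanningTree conn = record
      { parent = λ v → choose conn v (v ≟ ρ)
      ; dist = d conn
      ; parent-edge = λ v ne → proj₁ (choose-spec conn v (v ≟ ρ) ne)
      ; parent-dist = λ v ne → proj₂ (choose-spec conn v (v ≟ ρ) ne)
      }

module _ {n} {R : Rel₂ n} {ρ : Fin n} (t : SpanningTree R ρ) where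
  open SpanningTree t

  tree-connects : (R' : Rel₂ n) → Symmetric₂ R' → (∀ v → v ≢ ρ → R' v (parent v) ≡ true) → ∀ i j → Reach R' i j
  tree-connects R' s keep i j = reach-trans (down (dist i) i ℕ.≤-refl) (reach-sym s (down (dist j) j ℕ.≤-refl))
    where
    down : ∀ k v → dist v ≤ k → Reach R' v ρ
    down k v le with v ≟ ρ
    ... | yes refl = here
    down zero    v le | no ne = contradiction (ℕ.≤-trans (ℕ.≤-reflexive (sym (parent-dist v ne))) le) (λ ())
    down (suc k) v le | no ne = step (keep v ne) (down k (parent v) (ℕ.≤-pred (ℕ.≤-trans (ℕ.≤-reflexive (sym (parent-dist v ne))) le)))

sameEdge : ∀ {n} (u v i j : Fin n) → Dec ((i ≡ u × j ≡ v) ⊎ (i ≡ v × j ≡ u))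
sameEdge u v i j = ((i ≟ u) ×-dec (j ≟ v)) ⊎-dec ((i ≟ v) ×-dec (j ≟ u))

delete : ∀ {n} → Rel₂ n → Fin n → Fin n → Rel₂ n
delete R u v i j = R i j ∧ not (does (sameEdge u v i j))

module _ {n} {R : Rel₂ n} {u v : Fin n} where
  delete-sym : Symmetric₂ R → Symmetric₂ (delete R u v)
  delete-sym s i j = cong₂ (λ a b → a ∧ not b) (s i j) (does-⇔ (mk⇔ turn turn) (sameEdge u v i j) (sameEdge u v j i))
    where
    turn : ∀ {i j : Fin n} → (i ≡ u × j ≡ v) ⊎ (i ≡ v × j ≡ u) → (j ≡ u × i ≡ v) ⊎ (j ≡ v × i ≡ u)
    turn (inj₁ (a , b)) = inj₂ (b , a)
    turn (inj₂ (a , b)) = inj₁ (b , a)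

  delete-⊂ : ∀ {i j} → delete R u v i j ≡ true → R i j ≡ true
  delete-⊂ = proj₁ ∘ ∧-true

  delete-keep : ∀ {i j} → R i j ≡ true → ¬ ((i ≡ u × j ≡ v) ⊎ (i ≡ v × j ≡ u)) → delete R u v i j ≡ true
  delete-keep {i} {j} r ne rewrite r | dec-false (sameEdge u v i j) ne = refl

  delete-gone : delete R u v u v ≡ false
  delete-gone rewrite dec-true (sameEdge u v u v) (inj₁ (refl , refl)) = Bool.∧-zeroʳ (R u v)

-- Orienting a unicyclic graph

count-exactly-two : ∀ {n} (P : Fin n → Bool) a b → P a ≡ true → P b ≡ true → a ≢ b → (∀ c → P c ≡ true → c ≡ a ⊎ c ≡ b) → count P ≡ 2
count-exactly-two P a b Pa Pb a≢b only = trans (count-∖₁ P a Pa) (cong suc (trans (count-∖₁ (P ∖₁ a) b Pb') (cong suc (sumℕ-const0 none))))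
  where
  Pb' = ∖₁-intro P a Pb (a≢b ∘ sym)
  none : ∀ i → χ (((P ∖₁ a) ∖₁ b) i) ≡ 0
  none i with ((P ∖₁ a) ∖₁ b) i in eq
  ... | false = refl
  ... | true with ∖₁-elim (P ∖₁ a) b eq
  ...   | e , i≢b with ∖₁-elim P a e
  ...     | Pi , i≢a with only i Pi
  ...       | inj₁ i≡a = contradiction i≡a i≢a
  ...       | inj₂ i≡b = contradiction i≡b i≢b

module OrbitCycle {n} (G : Graph n) (h : Fin n → Fin n) (u : Fin n) (K : ℕ) (closed : iter h (suc K) u ≡ u)
  (h-adj : ∀ v → adj G v (h v) ≡ true) (no2 : ∀ v → h (h v) ≢ v) where

  OnOrbit : Fin n → Set
  OnOrbit i = Σ ℕ λ k → k < suc K × iter h k u ≡ i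

  onOrbit? : ∀ i → Dec (OnOrbit i)
  onOrbit? i = ℕ.anyUpTo? (λ k → iter h k u ≟ i) (suc K)

  on-next : ∀ {i} → OnOrbit i → OnOrbit (h i)
  on-next (k , k<K , refl) with suc k ℕ.<? suc K
  ... | yes lt = suc k , lt , refl
  ... | no ¬lt = 0 , s≤s z≤n , sym (trans (cong (λ z → iter h (suc z) u) (ℕ.≤-antisym (ℕ.≤-pred k<K) (ℕ.≤-pred (ℕ.≮⇒≥ ¬lt)))) closed)

  on-iter : ∀ m {i} → OnOrbit i → OnOrbit (iter h m i)
  on-iter zero    o = o
  on-iter (suc m) o = on-next (on-iter m o)

  -- `suc K` steps close the orbit, so `K` steps undo one. This gives an inverse of `h` on the orbit
  -- even if `suc K` is only a multiple of the true period.
  round : ∀ {i} → OnOrbit i → iter h K (h i) ≡ i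
  round {i} (k , _ , refl) = trans (sym (iter-suc h K (iter h k u))) (trans (iter-comm h (suc K) k u) (cong (iter h k) closed))

  edge? : ∀ i j → Dec ((OnOrbit i × h i ≡ j) ⊎ (OnOrbit j × h j ≡ i))
  edge? i j = (onOrbit? i ×-dec (h i ≟ j)) ⊎-dec (onOrbit? j ×-dec (h j ≟ i))

  C : Rel₂ n
  C i j = does (edge? i j)

  C-edge : ∀ {i j} → C i j ≡ true → (OnOrbit i × h i ≡ j) ⊎ (OnOrbit j × h j ≡ i)
  C-edge {i} {j} = does-true (edge? i j)

  C-next : ∀ {i} → OnOrbit i → C i (h i) ≡ true
  C-next {i} o = dec-true (edge? i (h i)) (inj₁ (o , refl))

  on-u : OnOrbit u
  on-u = 0 , s≤s z≤n , refl

  C-sym : Symmetric₂ C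
  C-sym i j = does-⇔ (mk⇔ swap swap) (edge? i j) (edge? j i)

  C-adj : ∀ i j → C i j ≡ true → adj G i j ≡ true
  C-adj i j c with C-edge c
  ... | inj₁ (_ , refl) = h-adj i
  ... | inj₂ (_ , refl) = trans (Graph.sym G i j) (h-adj j)

  -- The two cycle neighbours are the successor and the predecessor `iter h K i`; they differ
  -- because `h` never turns straight back.
  on-degree : ∀ {i} → OnOrbit i → degR C i ≡ 2
  on-degree {i} o = count-exactly-two (C i) (h i) (iter h K i) (C-next o) pred-edge ne only
    where
    pred : h (iter h K i) ≡ i
    pred = trans (iter-suc h K i) (round o)
    pred-edge : C i (iter h K i) ≡ true
    pred-edge = dec-true (edge? i (iter h K i)) (inj₂ (on-iter K o , pred))
    ne : h i ≢ iter h K i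
    ne e = no2 i (trans (cong h e) pred)
    only : ∀ c → C i c ≡ true → c ≡ h i ⊎ c ≡ iter h K i
    only c e with C-edge e
    ... | inj₁ (_ , hi≡c) = inj₁ (sym hi≡c)
    ... | inj₂ (oc , refl) = inj₂ (sym (round oc))

  off-degree : ∀ {i} → ¬ OnOrbit i → degR C i ≡ 0
  off-degree {i} no-o = sumℕ-const0 none
    where
    none : ∀ j → χ (C i j) ≡ 0
    none j with C i j in eq
    ... | false = refl
    ... | true with C-edge eq
    ...   | inj₁ (o , _) = contradiction o no-o
    ...   | inj₂ (o , refl) = contradiction (on-next o) no-o

  degree-2⇒on : ∀ {i} → degR C i ≡ 2 → OnOrbit i
  degree-2⇒on {i} d2 = decidable-stable (onOrbit? i) (λ ¬o → contradiction (trans (sym (off-degree {i} ¬o)) d2) (λ ()))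

  reach-iter : ∀ m {i} → OnOrbit i → Reach C i (iter h m i)
  reach-iter zero    o = here
  reach-iter (suc m) o = reach-trans (reach-iter m o) (step (C-next (on-iter m o)) here)

  reach-all : ∀ {i j} → OnOrbit i → OnOrbit j → Reach C i j
  reach-all {i} {j} oi@(k , k<K , refl) (l , _ , refl) =
    reach-trans (subst (Reach C i) back (reach-iter (suc K ∸ k) oi)) (reach-iter l on-u)
    where
    back : iter h (suc K ∸ k) (iter h k u) ≡ u
    back = trans (sym (iter-+ h (suc K ∸ k) k u)) (trans (cong (λ z → iter h z u) (ℕ.m∸n+n≡m (ℕ.<⇒≤ k<K))) closed)

  isCycle : IsCycle G C
  isCycle = C-adj , C-sym , (λ i → degrees i (onOrbit? i)) , (u , h u , C-next on-u)
    , (λ i j di dj → reach-all (degree-2⇒on {i} di) (degree-2⇒on {j} dj))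
    where
    degrees : ∀ i → Dec (OnOrbit i) → degR C i ≡ 0 ⊎ degR C i ≡ 2
    degrees i (yes o) = inj₂ (on-degree {i} o)
    degrees i (no ¬o) = inj₁ (off-degree {i} ¬o)

module CloseTree {n} (G : Graph n) (R : Rel₂ n) (R-sym : Symmetric₂ R) (R⊂G : ∀ i j → R i j ≡ true → adj G i j ≡ true)
  {u v : Fin n} (uv : adj G u v ≡ true) (¬uv : R u v ≡ false) (t : SpanningTree R u) where
  open SpanningTree t

  u≢v : u ≢ v
  u≢v refl = contradiction (trans (sym uv) (Graph.irrefl G u)) true≢false

  -- The parent map, with the root `u` sent across the extra edge to `v`. The orbit of `u` runs
  -- through this edge and back along the tree path from `v`, which is the fundamental cycle of the
  -- edge.
  h : Fin n → Fin n
  h x = if does (x ≟ u) then v else parent x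

  h-root : h u ≡ v
  h-root rewrite dec-true (u ≟ u) refl = refl

  h-off : ∀ {x} → x ≢ u → h x ≡ parent x
  h-off {x} ne rewrite dec-false (x ≟ u) ne = refl

  h-adj : ∀ x → adj G x (h x) ≡ true
  h-adj x with x ≟ u
  ... | yes refl = uv
  ... | no ne = R⊂G x (parent x) (parent-edge x ne)

  -- Turning back at the root would make `uv` an edge of `R`; away from the root two steps lower the
  -- distance by two.
  no2 : ∀ x → h (h x) ≢ x
  no2 x e with x ≟ u
  ... | yes refl = contradiction (trans (sym (trans (R-sym u v) (subst (λ z → R v z ≡ true) (trans (sym (h-off (u≢v ∘ sym))) e) (parent-edge v (u≢v ∘ sym))))) ¬uv) true≢false
  ... | no x≢u with parent x ≟ u
  ...   | yes px≡u = contradiction (trans (sym (trans (R-sym u v) (subst₂ (λ a b → R a b ≡ true) (sym e) px≡u (parent-edge x x≢u)))) ¬uv) true≢false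
  ...   | no px≢u = contradiction (trans (parent-dist x x≢u) (cong suc (trans (parent-dist (parent x) px≢u) (cong (suc ∘ dist) e)))) (ℕ.m≢1+n+m (dist x) {1})

  abstract
    reach-root : ∀ x → Σ ℕ λ k → iter h k x ≡ u
    reach-root x = go (dist x) x ℕ.≤-refl
      where
      go : ∀ k x → dist x ≤ k → Σ ℕ λ m → iter h m x ≡ u
      go k x le with x ≟ u
      ... | yes e = 0 , e
      go zero    x le | no ne = contradiction (ℕ.≤-trans (ℕ.≤-reflexive (sym (parent-dist x ne))) le) (λ ())
      go (suc k) x le | no ne with go k (parent x) (ℕ.≤-pred (ℕ.≤-trans (ℕ.≤-reflexive (sym (parent-dist x ne))) le))
      ... | m , e = suc m , trans (iter-suc h m x) (trans (cong (iter h m) (h-off ne)) e)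

  closed : iter h (suc (proj₁ (reach-root v))) u ≡ u
  closed = trans (iter-suc h (proj₁ (reach-root v)) u) (trans (cong (iter h (proj₁ (reach-root v))) h-root) (proj₂ (reach-root v)))

  open OrbitCycle G h u (proj₁ (reach-root v)) closed h-adj no2 public using (C; isCycle; C-edge; C-next; on-u)

  C-uv : C u v ≡ true
  C-uv = subst (λ z → C u z ≡ true) h-root (C-next on-u)

  h-edge : ∀ {i j} → h i ≡ j → R i j ≡ true ⊎ ((i ≡ u × j ≡ v) ⊎ (i ≡ v × j ≡ u))
  h-edge {i} refl with i ≟ u
  ... | yes e = inj₂ (inj₁ (e , refl))
  ... | no ne = inj₁ (parent-edge i ne)

  C⊂ : ∀ {i j} → C i j ≡ true → R i j ≡ true ⊎ ((i ≡ u × j ≡ v) ⊎ (i ≡ v × j ≡ u))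
  C⊂ {i} {j} c with C-edge c
  ... | inj₁ (_ , e) = h-edge e
  ... | inj₂ (_ , e) with h-edge e
  ...   | inj₁ r = inj₁ (trans (R-sym i j) r)
  ...   | inj₂ (inj₁ (a , b)) = inj₂ (inj₂ (b , a))
  ...   | inj₂ (inj₂ (a , b)) = inj₂ (inj₁ (b , a))

record Orientation {n} (G : Graph n) : Set where
  field
    f     : Fin n → Fin n
    f-adj : ∀ v → adj G v (f v) ≡ true
    edge  : ∀ i j → adj G i j ≡ true → f i ≡ j ⊎ f j ≡ i
    no2   : ∀ v → f (f v) ≢ v
    root  : Fin n
    reach : ∀ v → Σ ℕ λ k → iter f k v ≡ root

module _ {n} {G : Graph n} where

  abstract
    -- A vertex of `C` has two neighbours in `C` and at most one of them is its parent. If all edges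
    -- of `C` were tree edges, the other would be a child, and moving to children would give
    -- vertices of `C` at unbounded distance from the root.
    nontree-edge : ∀ {C} → IsCycle G C → ∀ {ρ} (t : SpanningTree (adj G) ρ) → let open SpanningTree t in
      Σ (Fin n) λ i → Σ (Fin n) λ j → C i j ≡ true × (i ≢ ρ → parent i ≢ j) × (j ≢ ρ → parent j ≢ i)
    nontree-edge {C} (C⊂G , C-sym , degs , (i₀ , j₀ , c₀) , _) {ρ} t = conclude found?
      where
      open SpanningTree t
      TreeEdge : Fin n → Fin n → Set
      TreeEdge i j = (i ≢ ρ × parent i ≡ j) ⊎ (j ≢ ρ × parent j ≡ i)
      tree? : ∀ i j → Dec (TreeEdge i j)
      tree? i j = (¬? (i ≟ ρ) ×-dec (parent i ≟ j)) ⊎-dec (¬? (j ≟ ρ) ×-dec (parent j ≟ i))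
      found? : Dec (Σ (Fin n) λ i → Σ (Fin n) λ j → C i j ≡ true × ¬ TreeEdge i j)
      found? = any? (λ i → any? (λ j → (C i j Bool.≟ true) ×-dec ¬? (tree? i j)))
      ascend : (∀ i j → C i j ≡ true → TreeEdge i j) → ∀ i j → C i j ≡ true → Σ (Fin n) λ w → C w i ≡ true × dist w ≡ suc (dist i)
      ascend all i j c = pick (count-other (C i) c (not1 (degs i)))
        where
        not1 : degR C i ≡ 0 ⊎ degR C i ≡ 2 → degR C i ≢ 1
        not1 (inj₁ a) b = contradiction (trans (sym a) b) (λ ())
        not1 (inj₂ a) b = contradiction (trans (sym a) b) (λ ())
        up : ∀ w → w ≢ ρ → parent w ≡ i → dist w ≡ suc (dist i)
        up w ne refl = parent-dist w ne
        pick : (Σ (Fin n) λ b → C i b ≡ true × b ≢ j) → Σ (Fin n) λ w → C w i ≡ true × dist w ≡ suc (dist i)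
        pick (b , cb , b≢j) with all i j c | all i b cb
        ... | inj₂ (ne , e) | _ = j , trans (C-sym j i) c , up j ne e
        ... | inj₁ _ | inj₂ (ne , e) = b , trans (C-sym b i) cb , up b ne e
        ... | inj₁ (_ , e) | inj₁ (_ , e') = contradiction (trans (sym e') e) b≢j
      unbounded : (∀ i j → C i j ≡ true → TreeEdge i j) → ∀ k → Σ (Fin n) λ i → Σ (Fin n) λ j → C i j ≡ true × k ≤ dist i
      unbounded all zero    = i₀ , j₀ , c₀ , z≤n
      unbounded all (suc k) with unbounded all k
      ... | i , j , c , le with ascend all i j c
      ...   | w , cw , e = w , i , cw , ℕ.≤-trans (s≤s le) (ℕ.≤-reflexive (sym e))
      conclude : Dec (Σ (Fin n) λ i → Σ (Fin n) λ j → C i j ≡ true × ¬ TreeEdge i j) →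
        Σ (Fin n) λ i → Σ (Fin n) λ j → C i j ≡ true × (i ≢ ρ → parent i ≢ j) × (j ≢ ρ → parent j ≢ i)
      conclude (yes (i , j , c , nt)) = i , j , c , (λ a b → nt (inj₁ (a , b))) , (λ a b → nt (inj₂ (a , b)))
      conclude (no none) = contradiction
        (ℕ.≤-trans (proj₂ (proj₂ (proj₂ far))) (sum-bound dist (proj₁ far))) (ℕ.<-irrefl refl)
        where
        far : Σ (Fin n) λ i → Σ (Fin n) λ j → C i j ≡ true × suc (sumℕ dist) ≤ dist i
        far = unbounded (λ i j c → decidable-stable (tree? i j) (λ nt → none (i , j , c , nt))) (suc (sumℕ dist))

  -- An edge `uv` of the cycle lies outside some spanning tree, so `G` stays connected without it.
  -- The map is the parent map of a spanning tree avoiding `uv` and rooted at `u`, closed up by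
  -- sending `u` to `v`.
  orientation : Unicyclic G → Orientation G
  orientation (conn , C , cyc@(C⊂G , _ , _ , (ρ , _) , _) , unique) = build (nontree-edge cyc t₀)
    where
    t₀ = spanningTree (adj G) ρ (λ v → conn v ρ)
    open SpanningTree t₀ renaming (parent to parent₀; parent-edge to parent-edge₀)
    build : (Σ (Fin n) λ i → Σ (Fin n) λ j → C i j ≡ true × (i ≢ ρ → parent₀ i ≢ j) × (j ≢ ρ → parent₀ j ≢ i)) → Orientation G
    build (u , v , cuv , nt₁ , nt₂) = record
      { f = T₁.h ; f-adj = T₁.h-adj ; edge = covered ; no2 = T₁.no2 ; root = u ; reach = T₁.reach-root }
      where
      R : Rel₂ n
      R = delete (adj G) u v
      R-sym = delete-sym {R = adj G} {u} {v} (Graph.sym G)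
      R⊂G : ∀ i j → R i j ≡ true → adj G i j ≡ true
      R⊂G i j = delete-⊂ {R = adj G} {u} {v} {i} {j}
      R-keep : ∀ x → x ≢ ρ → R x (parent₀ x) ≡ true
      R-keep x ne = delete-keep {R = adj G} {u} {v} {x} {parent₀ x} (parent-edge₀ x ne) λ { (inj₁ (refl , e)) → nt₁ ne e ; (inj₂ (refl , e)) → nt₂ ne e }
      t₁ : SpanningTree R u
      t₁ = spanningTree R u (λ x → tree-connects t₀ R R-sym R-keep x u)
      module T₁ = CloseTree G R R-sym R⊂G (C⊂G u v cuv) (delete-gone {R = adj G} {u} {v}) t₁
      covered : ∀ i j → adj G i j ≡ true → T₁.h i ≡ j ⊎ T₁.h j ≡ i
      covered i j ij with T₁.h i ≟ j | T₁.h j ≟ i | sameEdge u v i j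
      ... | yes e | _ | _ = inj₁ e
      ... | no _ | yes e | _ = inj₂ e
      ... | no _ | no _ | yes (inj₁ (refl , refl)) = inj₁ T₁.h-root
      ... | no _ | no _ | yes (inj₂ (refl , refl)) = inj₂ T₁.h-root
      -- An uncovered edge `ij` is not in `t₁` either, so a spanning tree without `uv` and `ij`
      -- exists. Closing it with `ij` gives a cycle that misses `uv`, while `T₁.C` contains `uv`.
      ... | no ¬hij | no ¬hji | no ¬uv = contradiction (trans (sym T₁.C-uv) (trans (unique T₁.C T₁.isCycle u v) (sym (unique T₂.C T₂.isCycle u v)))) second
        where
        R₂ : Rel₂ n
        R₂ = delete R i j
        R₂-sym = delete-sym {R = R} {i} {j} R-sym
        R₂⊂R : ∀ k l → R₂ k l ≡ true → R k l ≡ true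
        R₂⊂R k l = delete-⊂ {R = R} {i} {j} {k} {l}
        R₂⊂G : ∀ k l → R₂ k l ≡ true → adj G k l ≡ true
        R₂⊂G k l r = R⊂G k l (R₂⊂R k l r)
        R₂-keep : ∀ x → x ≢ u → R₂ x (SpanningTree.parent t₁ x) ≡ true
        R₂-keep x ne = delete-keep {R = R} {i} {j} {x} {SpanningTree.parent t₁ x} (SpanningTree.parent-edge t₁ x ne)
          λ { (inj₁ (refl , e)) → ¬hij (trans (T₁.h-off ne) e) ; (inj₂ (refl , e)) → ¬hji (trans (T₁.h-off ne) e) }
        t₂ : SpanningTree R₂ i
        t₂ = spanningTree R₂ i (λ x → tree-connects t₁ R₂ R₂-sym R₂-keep x i)
        module T₂ = CloseTree G R₂ R₂-sym R₂⊂G ij (delete-gone {R = R} {i} {j}) t₂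
        avoids : R₂ u v ≡ true ⊎ ((u ≡ i × v ≡ j) ⊎ (u ≡ j × v ≡ i)) → ⊥
        avoids (inj₁ r) = contradiction (trans (sym (R₂⊂R u v r)) (delete-gone {R = adj G} {u} {v})) true≢false
        avoids (inj₂ (inj₁ (refl , refl))) = ¬uv (inj₁ (refl , refl))
        avoids (inj₂ (inj₂ (refl , refl))) = ¬uv (inj₂ (refl , refl))
        second : true ≢ T₂.C u v
        second e = avoids (T₂.C⊂ (sym e))

-- The cycle as the periodic points of `f`, vertex kinds, and the support of an eigenvector.

module OrientationProperties {n} {G : Graph n} (o : Orientation G) where
  open Orientation o

  private
    period-1 : ℕ
    period-1 = proj₁ (reach (f root))

    closes : iter f (suc period-1) root ≡ root
    closes = trans (iter-suc f period-1 root) (proj₂ (reach (f root)))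

  module Orbit = OrbitCycle G f root period-1 closes f-adj no2

  -- As every vertex reaches `root` under `f`, the orbit of `root` consists of all periodic points,
  -- that is, of the vertices of the cycle.
  Per : Fin n → Set
  Per = Orbit.OnOrbit

  per? : ∀ v → Dec (Per v)
  per? = Orbit.onOrbit?

  per-f : ∀ {v} → Per v → Per (f v)
  per-f = Orbit.on-next

  per-iter : ∀ k {v} → Per v → Per (iter f k v)
  per-iter = Orbit.on-iter

  pred : Fin n → Fin n
  pred = iter f period-1

  per-pred : ∀ {v} → Per v → Per (pred v)
  per-pred = per-iter period-1

  pred-f : ∀ {v} → Per v → pred (f v) ≡ v
  pred-f = Orbit.round

  f-pred : ∀ {v} → Per v → f (pred v) ≡ v
  f-pred {v} pv = trans (iter-suc f period-1 v) (pred-f pv)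

  per-injective : ∀ {v w} → Per v → Per w → f v ≡ f w → v ≡ w
  per-injective pv pw e = trans (sym (pred-f pv)) (trans (cong pred e) (pred-f pw))

  per-reach : ∀ {a} → Per a → ∀ v → Σ ℕ λ k → iter f k v ≡ a
  per-reach (l , _ , e) v with reach v
  ... | k , e' = l + k , trans (iter-+ f l k v) (trans (cong (iter f l) e') e)

  adj-f⁻¹ : ∀ {i j} → f j ≡ i → adj G i j ≡ true
  adj-f⁻¹ {j = j} refl = trans (Graph.sym G _ j) (f-adj j)

  adj-sym : ∀ {i j} → adj G i j ≡ true → adj G j i ≡ true
  adj-sym {i} {j} e = trans (Graph.sym G j i) e

  adj-≢ : ∀ {i j} → adj G i j ≡ true → i ≢ j
  adj-≢ {i} e refl = true≢false (trans (sym e) (Graph.irrefl G i))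

  f≢ : ∀ v → f v ≢ v
  f≢ v e = adj-≢ (f-adj v) (sym e)

  pred≢f : ∀ {v} → Per v → pred v ≢ f v
  pred≢f {v} pv e = no2 v (trans (sym (cong f e)) (f-pred pv))

  pendant? : ∀ v → Dec (Pendant G v)
  pendant? v = isPendant G v Bool.≟ true

  quasi? : ∀ v → Dec (Quasi G v)
  quasi? v = isQuasiPendant G v Bool.≟ true

  pendant-only : ∀ {v w} → Pendant G v → adj G v w ≡ true → f v ≡ w
  pendant-only {v} pv e = count-unique (adj G v) (pendant⇒deg G pv) e (f-adj v)

  pendant-f : ∀ {v w} → Pendant G v → adj G w v ≡ true → f v ≡ w
  pendant-f pv e = pendant-only pv (adj-sym e)

  pendant-f-quasi : ∀ {v} → Pendant G v → Quasi G (f v)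
  pendant-f-quasi {v} pv = pendant-quasi G (adj-f⁻¹ refl) pv

  per-nonpendant : ∀ {v} → Per v → ¬ Pendant G v
  per-nonpendant {v} pv pend = pred≢f pv (sym (pendant-only pend (adj-f⁻¹ (f-pred pv))))

  pendant-nonquasi : ∀ {v} → Pendant G v → ¬ Quasi G v
  pendant-nonquasi {v} pend qv with quasi-pendant G qv
  ... | w , vw , pw = no2 v (trans (cong f (pendant-only pend vw)) (pendant-f pw vw))

  -- A second neighbour besides `f v` exists, and the edge to it can only be oriented towards `v`.
  preimage : ∀ {v} → ¬ Pendant G v → Σ (Fin n) λ w → f w ≡ v
  preimage {v} np with count-other (adj G v) (f-adj v) (λ d1 → np (deg⇒pendant G d1))
  ... | w , vw , w≢fv with edge v w vw
  ...   | inj₁ e = contradiction (sym e) w≢fv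
  ...   | inj₂ e = w , e

  nonpendant-degree : ∀ {v} → ¬ Pendant G v → Σ ℕ λ d → deg G v ≡ suc (suc d)
  nonpendant-degree {v} np = count-≥2 (adj G v) (f-adj v) (λ d1 → np (deg⇒pendant G d1))

  module Rooted {a : Fin n} (pa : Per a) where
    private
      hits : Fin n → ℕ → Bool
      hits v k = does (iter f k v ≟ a)

      first : ∀ v → Σ ℕ λ m → hits v m ≡ true × (∀ j → hits v j ≡ true → m ≤ j)
      first v = least (hits v) (proj₁ (per-reach pa v)) (dec-true (iter f (proj₁ (per-reach pa v)) v ≟ a) (proj₂ (per-reach pa v)))

    abstract
      depth : Fin n → ℕ
      depth v = proj₁ (first v)

      depth-hits : ∀ v → iter f (depth v) v ≡ a
      depth-hits v = does-true (iter f (depth v) v ≟ a) (proj₁ (proj₂ (first v)))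

      depth-least : ∀ v k → iter f k v ≡ a → depth v ≤ k
      depth-least v k e = proj₂ (proj₂ (first v)) k (dec-true (iter f k v ≟ a) e)

    depth-root : depth a ≡ 0
    depth-root = ℕ.n≤0⇒n≡0 (depth-least a 0 refl)

    depth-step : ∀ {v} → v ≢ a → depth v ≡ suc (depth (f v))
    depth-step {v} v≢a with depth v | depth-hits v | depth-least v
    ... | zero  | e | _   = contradiction e v≢a
    ... | suc k | e | min = ℕ.≤-antisym (min (suc (depth (f v))) (trans (iter-suc f (depth (f v)) v) (depth-hits (f v))))
                              (s≤s (depth-least (f v) k (trans (sym (iter-suc f k v)) e)))

    -- Going backwards along f the depth increases, so a backward-closed set of vertices contains the root.
    back : {A : Set} {H : Fin n → Set} → (∀ h → H h → A ⊎ Σ (Fin n) λ h' → H h' × f h' ≡ h) → ∀ h → H h → A ⊎ H a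
    back {A} {H} next h Hh = go (sumℕ depth) h Hh (ℕ.m≤n+m _ _)
      where
      go : ∀ k h → H h → sumℕ depth ≤ depth h + k → A ⊎ H a
      go k h Hh le with next h Hh
      ... | inj₁ x = inj₁ x
      ... | inj₂ (h' , Hh' , refl) with h' ≟ a
      ...   | yes refl = inj₂ Hh'
      go zero h Hh le | inj₂ (h' , Hh' , refl) | no ne = contradiction
        (ℕ.≤-trans (ℕ.≤-trans (ℕ.≤-reflexive (sym (depth-step ne))) (sum-bound depth h')) (ℕ.≤-trans le (ℕ.≤-reflexive (ℕ.+-identityʳ _))))
        (ℕ.<-irrefl refl)
      go (suc k) h Hh le | inj₂ (h' , Hh' , refl) | no ne = go k h' Hh'
        (ℕ.≤-trans le (ℕ.≤-reflexive (trans (ℕ.+-suc (depth (f h')) k) (cong (_+ k) (sym (depth-step ne))))))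

  -- Preimages of nonperiodic vertices are nonperiodic, so a backward walk off the cycle never meets
  -- the root and has to stop.
  back-nonper : {A : Set} {H : Fin n → Set} → (∀ h → ¬ Per h → H h → A ⊎ Σ (Fin n) λ h' → H h' × f h' ≡ h) →
    ∀ h → ¬ Per h → H h → A
  back-nonper {A} {H} next h np Hh = conclude (back earlier h (np , Hh))
    where
    open Rooted Orbit.on-u
    earlier : ∀ h → ¬ Per h × H h → A ⊎ Σ (Fin n) λ h' → (¬ Per h' × H h') × f h' ≡ h
    earlier h (np , Hh) with next h np Hh
    ... | inj₁ x = inj₁ x
    ... | inj₂ (h' , Hh' , refl) = inj₂ (h' , ((λ ph' → np (per-f ph')) , Hh') , refl)
    conclude : A ⊎ (¬ Per root × H root) → A
    conclude (inj₁ x)        = x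
    conclude (inj₂ (np , _)) = contradiction Orbit.on-u np

  PendantInjective : Set
  PendantInjective = ∀ {v w} → Pendant G v → Pendant G w → f v ≡ f w → v ≡ w

  -- `f` maps the pendant vertices onto the quasi-pendant ones. If two of them had the same image,
  -- one could be dropped and `q G` would be smaller than `p G`.
  pendant-injective : p G ≡ q G → PendantInjective
  pendant-injective pq {v} {w} pv pw e with v ≟ w
  ... | yes v≡w = v≡w
  ... | no v≢w = contradiction (ℕ.≤-trans (ℕ.≤-reflexive (sym (count-∖₁ (isPendant G) w pw)))
                    (ℕ.≤-trans (ℕ.≤-reflexive pq) (count-surj (isPendant G ∖₁ w) (isQuasiPendant G) f onto))) (ℕ.<-irrefl refl)
    where
    onto : ∀ u → Quasi G u → Σ (Fin n) λ x → (isPendant G ∖₁ w) x ≡ true × f x ≡ u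
    onto u qu with quasi-pendant G qu
    ... | x , ux , px with x ≟ w
    ...   | yes refl = v , ∖₁-intro (isPendant G) w pv v≢w , trans e (pendant-f px ux)
    ...   | no x≢w   = x , ∖₁-intro (isPendant G) w px x≢w , pendant-f px ux

  inner : Fin n → Bool
  inner v = not (isPendant G v) ∧ not (isQuasiPendant G v)

  Inner : Fin n → Set
  Inner v = inner v ≡ true

  inner-nonpendant : ∀ {v} → Inner v → ¬ Pendant G v
  inner-nonpendant {v} iv pv rewrite pv = contradiction iv λ ()

  inner-nonquasi : ∀ {v} → Inner v → ¬ Quasi G v
  inner-nonquasi {v} iv qv rewrite qv = contradiction (proj₂ (∧-true {not (isPendant G v)} iv)) λ ()

  inner-intro : ∀ {v} → ¬ Pendant G v → ¬ Quasi G v → Inner v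
  inner-intro np nq rewrite ¬true np | ¬true nq = refl

  data Kind (v : Fin n) : Set where
    isP : Pendant G v → Kind v
    isQ : Quasi G v → Kind v
    isI : Inner v → Kind v

  kind : ∀ v → Kind v
  kind v with pendant? v | quasi? v
  ... | yes pv | _      = isP pv
  ... | no _   | yes qv = isQ qv
  ... | no np  | no nq  = isI (inner-intro np nq)

  vertex-count : n ≡ p G + (q G + count inner)
  vertex-count = trans (sym (count-true n)) (trans (count-split (λ _ → true) (isPendant G)) (cong (p G +_)
    (trans (count-split (λ v → not (isPendant G v)) (isQuasiPendant G)) (cong (_+ count inner) (count-cong same)))))
    where
    same : ∀ v → not (isPendant G v) ∧ isQuasiPendant G v ≡ isQuasiPendant G v
    same v with isQuasiPendant G v in eq
    ... | false = Bool.∧-zeroʳ _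
    ... | true rewrite ¬true (λ pv → pendant-nonquasi {v} pv eq) = refl

  module Eigenvector {x : Vector n} (ex : Eig G x) where

    pendant-f-zero : ∀ {v} → Pendant G v → x (f v) ≡ 0ℚ
    pendant-f-zero {v} pv = pendant-neighbour-zero G ex (pendant⇒deg G pv) (f-adj v)

    quasi-zero : ∀ {u} → Quasi G u → x u ≡ 0ℚ
    quasi-zero qu with quasi-pendant G qu
    ... | v , uv , pv = subst (λ w → x w ≡ 0ℚ) (pendant-f pv uv) (pendant-f-zero pv)

    -- The edge from h to f h meets the support of x.
    Active : Fin n → Set
    Active h = x h ≢ 0ℚ ⊎ x (f h) ≢ 0ℚ

    zero? : ∀ v → Dec (x v ≡ 0ℚ)
    zero? v = x v ℚ.≟ 0ℚ

    inactive : ∀ {h} → x h ≡ 0ℚ → x (f h) ≡ 0ℚ → ¬ Active h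
    inactive a b (inj₁ ne) = ne a
    inactive a b (inj₂ ne) = ne b

    inactive-zero : ∀ {h} → ¬ Active h → x h ≡ 0ℚ
    inactive-zero {h} na = decidable-stable (zero? h) (na ∘ inj₁)

    -- If `x h` is nonzero, any preimage will do. If it is zero, then `x (f h)` is not, and since
    -- the neighbours of `h` sum to zero some preimage must balance it. Only a pendant vertex could
    -- stop this.
    active-preimage : ∀ {h} → Active h → (Pendant G h → x h ≡ 0ℚ) → Σ (Fin n) λ h' → Active h' × f h' ≡ h
    active-preimage {h} act zp with pendant? h
    ... | yes ph = contradiction act (inactive (zp ph) (pendant-f-zero ph))
    ... | no np with zero? h
    ...   | no xh≢0 with preimage np
    ...     | w , refl = w , inj₂ xh≢0 , refl
    active-preimage {h} act zp | no np | yes xh with any? (λ w → (f w ≟ h) ×-dec ¬? (zero? w))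
    ... | yes (w , e , ne) = w , inj₁ ne , e
    ... | no none = contradiction act (inactive xh (forcing G ex xh (f-adj h) rest))
      where
      rest : ∀ j → adj G h j ≡ true → j ≢ f h → x j ≡ 0ℚ
      rest j hj j≢ with edge h j hj
      ... | inj₁ e = contradiction (sym e) j≢
      ... | inj₂ e = decidable-stable (zero? j) (λ ne → none (j , e , ne))

    -- An active nonpendant vertex has an active nonpendant preimage, so activity would travel back
    -- to `a`, where it is excluded. Hence all nonpendant values are zero, and a pendant value is
    -- the only unknown in the equation at its neighbour. The second alternative for a pendant `v`
    -- is what lets `v` be left out of a determining set.
    vanishing : PendantInjective → ∀ {a} → Per a → (∀ v → Pendant G v → x v ≡ 0ℚ ⊎ ¬ Active (f v)) → ¬ Active a →
      ∀ v → x v ≡ 0ℚ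
    vanishing inj {a} pa pend na = all
      where
      open Rooted pa
      earlier : ∀ h → Active h × ¬ Pendant G h → ⊥ ⊎ Σ (Fin n) λ h' → (Active h' × ¬ Pendant G h') × f h' ≡ h
      earlier h (act , np) with active-preimage act (λ ph → contradiction ph np)
      ... | h' , act' , refl = inj₂ (h' , (act' , np') , refl)
        where
        np' : ¬ Pendant G h'
        np' ph' with pend h' ph'
        ... | inj₁ z = inactive z (pendant-f-zero ph') act'
        ... | inj₂ nact = nact act
      nonpendant-inactive : ∀ {h} → ¬ Pendant G h → ¬ Active h
      nonpendant-inactive np act with back earlier _ (act , np)
      ... | inj₂ (act-a , _) = na act-a
      nonpendant-zero : ∀ {h} → ¬ Pendant G h → x h ≡ 0ℚ
      nonpendant-zero np = inactive-zero (nonpendant-inactive np)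
      all : ∀ v → x v ≡ 0ℚ
      all v with pendant? v
      ... | no np = nonpendant-zero np
      ... | yes pv = forcing G ex (pendant-f-zero pv) (adj-f⁻¹ refl) rest
        where
        rest : ∀ j → adj G (f v) j ≡ true → j ≢ v → x j ≡ 0ℚ
        rest j e j≢v with pendant? j
        ... | no npj = nonpendant-zero npj
        ... | yes pj = contradiction (inj pj pv (pendant-f pj e)) j≢v

-- Propagation of zeros in an eigenvector

fromℕℚ-* : ∀ a b → fromℕℚ (a * b) ≡ fromℕℚ a *ℚ fromℕℚ b
fromℕℚ-* zero    b = sym (ℚ.*-zeroˡ (fromℕℚ b))
fromℕℚ-* (suc a) b = trans (fromℕℚ-+ b (a * b)) (trans (cong (fromℕℚ b +ℚ_) (fromℕℚ-* a b))
  (solve 2 (λ u v → v :+ u :* v := (con 1ℚ :+ u) :* v) refl (fromℕℚ a) (fromℕℚ b)))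
  where open +-*-Solver

square-nonNeg : ∀ t → 0ℚ ≤ℚ t *ℚ t
square-nonNeg t with ℚ.≤-total 0ℚ t
... | inj₁ 0≤t = subst (_≤ℚ t *ℚ t) (ℚ.*-zeroʳ t) (ℚ.*-monoˡ-≤-nonNeg t {{nonNegative 0≤t}} 0≤t)
... | inj₂ t≤0 = subst (_≤ℚ t *ℚ t) (ℚ.*-zeroʳ t) (ℚ.*-monoˡ-≤-nonPos t {{nonPositive t≤0}} t≤0)

square-zero : ∀ t → t *ℚ t ≡ 0ℚ → t ≡ 0ℚ
square-zero t e with t ℚ.≟ 0ℚ
... | yes t≡0 = t≡0
... | no t≢0 = trans (sym (ℚ.*-identityˡ t)) (trans (cong (_*ℚ t) (sym (ℚ.*-inverseˡ t)))
    (trans (ℚ.*-assoc (1/ t) t t) (trans (cong (1/ t *ℚ_) e) (ℚ.*-zeroʳ (1/ t)))))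
  where instance nz = ≢-nonZero t≢0

double-zero : ∀ t → t +ℚ t ≡ 0ℚ → t ≡ 0ℚ
double-zero t e = fromℕℚ-cancel-0 1 (trans (cong (_*ℚ t) (cong (1ℚ +ℚ_) (ℚ.+-identityʳ 1ℚ)))
  (trans (solve 1 (λ u → (con 1ℚ :+ con 1ℚ) :* u := u :+ u) refl t) e))
  where open +-*-Solver

count-injection : ∀ {n} k (P : Fin n → Bool) (e : ℕ → Fin n) → (∀ i → i < k → P (e i) ≡ true) →
  (∀ i j → i < j → j < k → e i ≢ e j) → k ≤ count P
count-injection zero    P e on inj = z≤n
count-injection (suc k) P e on inj = ℕ.≤-trans
  (s≤s (count-injection k (P ∖₁ e k) e (λ i lt → ∖₁-intro P (e k) (on i (ℕ.m<n⇒m<1+n lt)) (inj i k lt ℕ.≤-refl))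
                                       (λ i j i<j j<k → inj i j i<j (ℕ.m<n⇒m<1+n j<k))))
  (ℕ.≤-reflexive (sym (count-∖₁ P (e k) (on k ℕ.≤-refl))))

parity : ℕ → Bool
parity zero    = false
parity (suc k) = not (parity k)

module EigenProperties {n} {G : Graph n} (o : Orientation G) where
  open Orientation o
  open OrientationProperties o

  Above : Fin n → Fin n → Set
  Above d h = Σ ℕ λ k → iter f k h ≡ d

  -- Going backwards from `d` continues at every nonpendant vertex and cannot go on forever off the
  -- cycle.
  pendant-above : ∀ {d} → ¬ Per d → Σ (Fin n) λ v → Pendant G v × Above d v
  pendant-above {d} np = back-nonper earlier d np (0 , refl)
    where
    earlier : ∀ h → ¬ Per h → Above d h → (Σ (Fin n) λ v → Pendant G v × Above d v) ⊎ Σ (Fin n) λ h' → Above d h' × f h' ≡ h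
    earlier h _ (k , e) with pendant? h
    ... | yes ph = inj₁ (h , ph , k , e)
    ... | no nph with preimage nph
    ...   | w , refl = inj₂ (w , (suc k , trans (iter-suc f k w) e) , refl)

  later-branch : ∀ {d d' v k l} → ¬ Per d' → Per (f d) → iter f k v ≡ d → iter f l v ≡ d' → ¬ k < l
  later-branch {v = v} {k} {l} nd' pd refl e k<l = nd' (subst Per
    (trans (sym (iter-+ f (l ∸ suc k) (suc k) v)) (trans (cong (λ z → iter f z v) (ℕ.m∸n+n≡m k<l)) e)) (per-iter (l ∸ suc k) pd))

  -- A forward path enters the cycle once and stays there, so it has only one last vertex off the
  -- cycle.
  branches-disjoint : ∀ {d d' v} → ¬ Per d → ¬ Per d' → Per (f d) → Per (f d') → Above d v → Above d' v → d ≡ d'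
  branches-disjoint nd nd' pd pd' (k , ek) (l , el) with ℕ.<-cmp k l
  ... | tri≈ _ refl _ = trans (sym ek) el
  ... | tri< k<l _ _  = contradiction k<l (later-branch nd' pd ek el)
  ... | tri> _ _ l<k  = contradiction l<k (later-branch nd pd' el ek)

  iter-injective : ∀ k {v w} → Per v → Per w → iter f k v ≡ iter f k w → v ≡ w
  iter-injective zero    pv pw e = e
  iter-injective (suc k) pv pw e = iter-injective k pv pw (per-injective (per-iter k pv) (per-iter k pw) e)

  iter-collision : ∀ {a} → Per a → ∀ i j → i ≤ j → iter f i a ≡ iter f j a → iter f (j ∸ i) a ≡ a
  iter-collision {a} pa i j i≤j e = sym (iter-injective i pa (per-iter (j ∸ i) pa)
    (trans e (trans (cong (λ z → iter f z a) (sym (ℕ.m+[n∸m]≡n i≤j))) (iter-+ f i (j ∸ i) a))))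

  inner-neighbour-nonpendant : ∀ {i j} → ¬ Quasi G i → adj G i j ≡ true → ¬ Pendant G j
  inner-neighbour-nonpendant ni e pj = ni (pendant-quasi G e pj)

  module _ {x : Vector n} (ex : Eig G x) where
    open Eigenvector ex

    branch-inactive : ∀ {d} → ¬ Per d → (∀ v → Pendant G v → Above d v → x v ≡ 0ℚ) → ¬ Active d
    branch-inactive {d} np zero-on act = back-nonper {⊥} {λ h → Active h × Above d h} earlier d np (act , 0 , refl)
      where
      earlier : ∀ h → ¬ Per h → Active h × Above d h → ⊥ ⊎ Σ (Fin n) λ h' → (Active h' × Above d h') × f h' ≡ h
      earlier h _ (act , k , e) with active-preimage act (λ ph → zero-on h ph (k , e))
      ... | h' , act' , refl = inj₂ (h' , (act' , suc k , trans (iter-suc f k h') e) , refl)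

    -- The forward path of a pendant v with x v ≠ 0 stays active until it meets an inactive periodic vertex c:
    -- at its first inactive vertex nothing could balance the equation.
    path-vanishing : ∀ {c v} → Per c → ¬ Active c → (∀ w → Pendant G w → w ≢ v → x w ≡ 0ℚ) → x v ≡ 0ℚ
    path-vanishing {c} {v} pc nc zero-on = decidable-stable (zero? v) (λ ne →
      nc (subst Active (proj₂ (per-reach pc v)) (all-active ne (proj₁ (per-reach pc v)) (proj₁ (per-reach pc v)) ℕ.≤-refl)))
      where
      open Rooted pc
      extend : ∀ i → (∀ l → l ≤ i → Active (iter f l v)) → Active (iter f (suc i) v)
      extend i act with zero? (iter f (suc i) v) | zero? (f (iter f (suc i) v))
      ... | no ne | _ = inj₁ ne
      ... | yes _ | no ne = inj₂ ne
      ... | yes z | yes z' = contradiction (act i ℕ.≤-refl) (inactive (forcing G ex z (adj-f⁻¹ refl) rest) z)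
        where
        w w₁ : Fin n
        w  = iter f i v
        w₁ = f w
        Off : Fin n → Set
        Off h = Active h × (∀ l → l ≤ i → h ≢ iter f l v)
        earlier : ∀ h → Off h → ⊥ ⊎ Σ (Fin n) λ h' → Off h' × f h' ≡ h
        earlier h (acth , off) with active-preimage acth (λ ph → zero-on h ph (off 0 z≤n))
        ... | h' , acth' , refl = inj₂ (h' , (acth' , off') , refl)
          where
          off' : ∀ l → l ≤ i → h' ≢ iter f l v
          off' l l≤i refl with ℕ.m≤n⇒m<n∨m≡n l≤i
          ... | inj₁ l<i  = off (suc l) l<i refl
          ... | inj₂ refl = inactive z z' acth
        off-zero : ∀ j → f j ≡ w₁ → j ≢ w → x j ≡ 0ℚ
        off-zero j fj j≢w = decidable-stable (zero? j) (λ ne → escape (back earlier j (inj₁ ne , off)))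
          where
          escape : ⊥ ⊎ Off c → ⊥
          escape (inj₂ (actc , _)) = nc actc
          off : ∀ l → l ≤ i → j ≢ iter f l v
          off l l≤i refl with ℕ.m≤n⇒m<n∨m≡n l≤i
          ... | inj₁ l<i  = inactive z z' (subst Active fj (act (suc l) l<i))
          ... | inj₂ refl = j≢w refl
        rest : ∀ j → adj G w₁ j ≡ true → j ≢ w → x j ≡ 0ℚ
        rest j e j≢w with edge w₁ j e
        ... | inj₁ e' = subst (λ k → x k ≡ 0ℚ) e' z'
        ... | inj₂ e' = off-zero j e' j≢w
      all-active : x v ≢ 0ℚ → ∀ i l → l ≤ i → Active (iter f l v)
      all-active ne i zero _ = inj₁ ne
      all-active ne (suc i) (suc l) (s≤s l≤i) = extend l (λ l' l'≤l → all-active ne i l' (ℕ.≤-trans l'≤l l≤i))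

    -- No neighbour of an inner vertex is pendant and its quasi-pendant neighbours carry zero; the
    -- factor `deg - 1` is positive.
    inner-zero : ∀ {i} → Inner i → (∀ j → adj G i j ≡ true → Inner j → x j ≡ 0ℚ) → x i ≡ 0ℚ
    inner-zero {i} ii h = all-neighbours-zero G ex (proj₂ (nonpendant-degree (inner-nonpendant ii))) nbs
      where
      nbs : ∀ j → adj G i j ≡ true → x j ≡ 0ℚ
      nbs j e with kind j
      ... | isP pj = contradiction pj (inner-neighbour-nonpendant (inner-nonquasi ii) e)
      ... | isQ qj = quasi-zero qj
      ... | isI ij = h j e ij

    -- With the inner values all nonpendant values vanish, so every edge between nonpendant vertices
    -- is inactive and the pendant values follow.
    inner-vanishing : PendantInjective → (∀ i → Inner i → x i ≡ 0ℚ) → ∀ v → x v ≡ 0ℚ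
    inner-vanishing inj h = vanishing inj Orbit.on-u (λ v pv → inj₂ (inactive (pendant-f-zero pv) (nonpendant-zero (ff-nonpendant pv))))
      (inactive (nonpendant-zero (per-nonpendant Orbit.on-u)) (nonpendant-zero (per-nonpendant (per-f Orbit.on-u))))
      where
      nonpendant-zero : ∀ {j} → ¬ Pendant G j → x j ≡ 0ℚ
      nonpendant-zero {j} np with kind j
      ... | isP pj = contradiction pj np
      ... | isQ qj = quasi-zero qj
      ... | isI ij = h j ij
      ff-nonpendant : ∀ {v} → Pendant G v → ¬ Pendant G (f (f v))
      ff-nonpendant {v} pv pff = no2 (f v) (pendant-only pff (adj-f⁻¹ refl))

    -- After scaling x so that its value at i₀ is nonnegative, all neighbours of j carry nonnegative values;
    -- they sum to zero at j, so the common neighbour h of i₀ and j carries zero.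
    sign-kill : ∀ {i₀ j h} → x j ≡ 0ℚ → adj G j h ≡ true → adj G h i₀ ≡ true → ¬ Pendant G h →
      (∀ l → adj G h l ≡ true → l ≢ i₀ → x l ≡ 0ℚ) →
      (∀ k → adj G j k ≡ true → k ≢ i₀ → x k ≡ 0ℚ ⊎ (¬ Pendant G k × ∀ l → adj G k l ≡ true → l ≢ i₀ → x l ≡ 0ℚ)) →
      x i₀ ≡ 0ℚ
    sign-kill {i₀} {j} {h} xj jh hi nph around-h around = square-zero t (begin
        t *ℚ t              ≡⟨ cong (t *ℚ_) (sym (nbSum-single G x hi around-h)) ⟩
        t *ℚ nbSum G x h    ≡⟨ cong (t *ℚ_) (sym (degree-scaled G ex dh)) ⟩
        t *ℚ (D *ℚ x h)     ≡⟨ solve 3 (λ u v w → u :* (v :* w) := v :* (u :* w)) refl t D (x h) ⟩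
        D *ℚ (t *ℚ x h)     ≡⟨ cong (D *ℚ_) (sign-forcing G ex t xj nonneg h jh) ⟩
        D *ℚ 0ℚ             ≡⟨ ℚ.*-zeroʳ D ⟩
        0ℚ ∎)
      where
      open ≡-Reasoning
      open +-*-Solver
      t = x i₀
      dh = proj₂ (nonpendant-degree nph)
      D = fromℕℚ (suc (proj₁ (nonpendant-degree nph)))
      nonneg : ∀ k → adj G j k ≡ true → 0ℚ ≤ℚ t *ℚ x k
      nonneg k jk with k ≟ i₀
      ... | yes refl = square-nonNeg t
      ... | no k≢ with around k jk k≢
      ...   | inj₁ z = ℚ.≤-reflexive (sym (trans (cong (t *ℚ_) z) (ℚ.*-zeroʳ t)))
      ...   | inj₂ (npk , around-k) = fromℕℚ-cancel-≤ e (subst₂ _≤ℚ_ (sym (ℚ.*-zeroʳ E)) (begin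
                t *ℚ nbSum G x k     ≡⟨ cong (t *ℚ_) (sym (degree-scaled G ex (proj₂ (nonpendant-degree npk)))) ⟩
                t *ℚ (E *ℚ x k)      ≡⟨ solve 3 (λ u v w → u :* (v :* w) := v :* (u :* w)) refl t E (x k) ⟩
                E *ℚ (t *ℚ x k) ∎) (nb k around-k))
        where
        e = proj₁ (nonpendant-degree npk)
        E = fromℕℚ (suc e)
        nb : ∀ k → (∀ l → adj G k l ≡ true → l ≢ i₀ → x l ≡ 0ℚ) → 0ℚ ≤ℚ t *ℚ nbSum G x k
        nb k around-k with adj G k i₀ Bool.≟ true
        ... | yes ki = subst (λ z → 0ℚ ≤ℚ t *ℚ z) (sym (nbSum-single G x ki around-k)) (square-nonNeg t)
        ... | no ¬ki = ℚ.≤-reflexive (sym (trans (cong (t *ℚ_) (nbSum-zero G x off)) (ℚ.*-zeroʳ t)))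
          where
          off : ∀ l → adj G k l ≡ true → x l ≡ 0ℚ
          off l kl with l ≟ i₀
          ... | yes refl = contradiction kl ¬ki
          ... | no l≢ = around-k l kl l≢

    -- The equations at `i` and `j` are `(a + 2) * x i = x j` and `(b + 1) * x j = x i`, with
    -- `b + 2` the degree of `j`. Together they give `((a + 2) * (b + 1) - 1) * x i = 0` with a
    -- positive factor. If both degrees were 2 the factor would be zero, hence the degree at least 3
    -- at `i`.
    pair-kill : ∀ {i j a} → deg G i ≡ suc (suc (suc a)) → ¬ Pendant G j → adj G i j ≡ true →
      (∀ k → adj G i k ≡ true → k ≢ j → x k ≡ 0ℚ) → (∀ k → adj G j k ≡ true → k ≢ i → x k ≡ 0ℚ) → x i ≡ 0ℚ
    pair-kill {i} {j} {a} di npj ij around-i around-j = fromℕℚ-cancel-0 (b + (b + a * suc b)) (begin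
        fromℕℚ (suc (b + (b + a * suc b))) *ℚ x i
          ≡⟨ solve 2 (λ u v → u :* v := (con 1ℚ :+ u) :* v :- v) refl (fromℕℚ (suc (b + (b + a * suc b)))) (x i) ⟩
        fromℕℚ (suc (suc (b + (b + a * suc b)))) *ℚ x i -ℚ x i
          ≡⟨ cong (λ k → fromℕℚ k *ℚ x i -ℚ x i) shape ⟩
        fromℕℚ (suc (suc a) * suc b) *ℚ x i -ℚ x i
          ≡⟨ cong (_-ℚ x i) scaled ⟩
        x i -ℚ x i
          ≡⟨ ℚ.+-inverseʳ (x i) ⟩
        0ℚ ∎)
      where
      open ≡-Reasoning
      open +-*-Solver
      b = proj₁ (nonpendant-degree npj)
      A = fromℕℚ (suc (suc a))
      B = fromℕℚ (suc b)
      shape : suc (suc (b + (b + a * suc b))) ≡ suc (suc a) * suc b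
      shape = cong suc (sym (ℕ.+-suc b (b + a * suc b)))
      scaled : fromℕℚ (suc (suc a) * suc b) *ℚ x i ≡ x i
      scaled = begin
        fromℕℚ (suc (suc a) * suc b) *ℚ x i ≡⟨ cong (_*ℚ x i) (fromℕℚ-* (suc (suc a)) (suc b)) ⟩
        (A *ℚ B) *ℚ x i ≡⟨ solve 3 (λ u v w → (u :* v) :* w := v :* (u :* w)) refl A B (x i) ⟩
        B *ℚ (A *ℚ x i) ≡⟨ cong (B *ℚ_) (trans (degree-scaled G ex di) (nbSum-single G x ij around-i)) ⟩
        B *ℚ x j ≡⟨ trans (degree-scaled G ex (proj₂ (nonpendant-degree npj))) (nbSum-single G x (adj-sym ij) around-j) ⟩
        x i ∎

-- Determining sets

module DimensionBounds {n} {G : Graph n} (o : Orientation G) (pq : p G ≡ q G) {m : ℕ} (fam : IndepEigenFamily (Laplacian G) 1ℚ m) where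
  open Orientation o
  open OrientationProperties o
  open EigenProperties o

  inj : PendantInjective
  inj = pendant-injective pq

  determining : (Z : Fin n → Bool) → (∀ x → Eig G x → (∀ i → Z i ≡ true → x i ≡ 0ℚ) → ∀ i → x i ≡ 0ℚ) → m ≤ count Z
  determining Z h = determining-bound (Laplacian G) 1ℚ Z h fam

  -- The graph is a bare cycle, where the values at two consecutive vertices determine all others.
  bound-no-pendant : (∀ v → ¬ Pendant G v) → m ≤ 2
  bound-no-pendant none = ℕ.≤-trans (determining Z h) (ℕ.≤-trans (count-∪₁ _ (f root)) (s≤s (ℕ.≤-trans (count-∪₁ _ root) (s≤s (ℕ.≤-reflexive (sumℕ-const0 {n} (λ _ → refl)))))))
    where
    Z = ((λ _ → false) ∪₁ root) ∪₁ f root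
    h : ∀ x → Eig G x → (∀ i → Z i ≡ true → x i ≡ 0ℚ) → ∀ i → x i ≡ 0ℚ
    h x ex z = vanishing inj Orbit.on-u (λ v pv → contradiction pv (none v))
      (inactive (z root (∪₁-there ((λ _ → false) ∪₁ root) (f root) {root} (∪₁-here (λ _ → false) root))) (z (f root) (∪₁-here ((λ _ → false) ∪₁ root) (f root))))
      where open Eigenvector ex

  -- Putting `f u` into the set makes the edge from `u` to `f u` inactive. This both blocks the root
  -- `u` and excuses the pendant vertex `v` at `u`.
  bound-cycle-quasi : ∀ {u} → Per u → Quasi G u → m ≤ p G
  bound-cycle-quasi {u} pu qu with quasi-pendant G qu
  ... | v , uv , pv = ℕ.≤-trans (determining Z h) (ℕ.≤-trans (count-∪₁ _ (f u)) (ℕ.≤-reflexive (sym (count-∖₁ (isPendant G) v pv))))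
    where
    Z = (isPendant G ∖₁ v) ∪₁ f u
    h : ∀ x → Eig G x → (∀ i → Z i ≡ true → x i ≡ 0ℚ) → ∀ i → x i ≡ 0ℚ
    h x ex z = vanishing inj pu pend na
      where
      open Eigenvector ex
      na : ¬ Active u
      na = inactive (quasi-zero qu) (z (f u) (∪₁-here (isPendant G ∖₁ v) (f u)))
      pend : ∀ w → Pendant G w → x w ≡ 0ℚ ⊎ ¬ Active (f w)
      pend w pw with w ≟ v
      ... | yes refl = inj₂ (subst (¬_ ∘ Active) (sym (pendant-f pw uv)) na)
      ... | no w≢v   = inj₁ (z w (∪₁-there (isPendant G ∖₁ v) (f u) (∖₁-intro (isPendant G) v pw w≢v)))

  module _ {d : Fin n} (nd : ¬ Per d) (pd : Per (f d)) where
    private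
      c : Fin n
      c = f d

    -- If all pendant values are zero, no activity can start in the branch of `d`, so `x` vanishes
    -- at `c`; the extra vertex `f c` then blocks the root.
    bound-branch : m ≤ suc (p G)
    bound-branch = ℕ.≤-trans (determining (isPendant G ∪₁ f c) h) (count-∪₁ (isPendant G) (f c))
      where
      h : ∀ x → Eig G x → (∀ i → (isPendant G ∪₁ f c) i ≡ true → x i ≡ 0ℚ) → ∀ i → x i ≡ 0ℚ
      h x ex z = vanishing inj pd (λ v pv → inj₁ (zp v pv)) (inactive xc (z (f c) (∪₁-here (isPendant G) (f c))))
        where
        open Eigenvector ex
        zp : ∀ v → Pendant G v → x v ≡ 0ℚ
        zp v pv = z v (∪₁-there (isPendant G) (f c) pv)
        xc : x c ≡ 0ℚ
        xc = decidable-stable (zero? c) (λ ne → branch-inactive ex nd (λ v pv _ → zp v pv) (inj₂ ne))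

    -- The branch of `d` alone forces `x c = 0`, so a pendant vertex above `d'` can be left out; its
    -- value is recovered by following its forward path to `c`.
    bound-two-branches : ∀ {d'} → ¬ Per d' → Per (f d') → d' ≢ d → m ≤ p G
    bound-two-branches {d'} nd' pd' d'≢d with pendant-above nd'
    ... | v , pv , above = ℕ.≤-trans (determining Z h) (ℕ.≤-trans (count-∪₁ _ (f c)) (ℕ.≤-reflexive (sym (count-∖₁ (isPendant G) v pv))))
      where
      Z = (isPendant G ∖₁ v) ∪₁ f c
      h : ∀ x → Eig G x → (∀ i → Z i ≡ true → x i ≡ 0ℚ) → ∀ i → x i ≡ 0ℚ
      h x ex z = vanishing inj pd all-pend na
        where
        open Eigenvector ex
        zp : ∀ w → Pendant G w → w ≢ v → x w ≡ 0ℚ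
        zp w pw w≢v = z w (∪₁-there (isPendant G ∖₁ v) (f c) (∖₁-intro (isPendant G) v pw w≢v))
        xc : x c ≡ 0ℚ
        xc = decidable-stable (zero? c) (λ ne → branch-inactive ex nd
          (λ w pw ab → zp w pw λ { refl → d'≢d (branches-disjoint nd' nd pd' pd above ab) }) (inj₂ ne))
        na : ¬ Active c
        na = inactive xc (z (f c) (∪₁-here (isPendant G ∖₁ v) (f c)))
        all-pend : ∀ w → Pendant G w → x w ≡ 0ℚ ⊎ ¬ Active (f w)
        all-pend w pw with w ≟ v
        ... | yes refl = inj₁ (path-vanishing ex pd na zp)
        ... | no w≢v   = inj₁ (zp w pw w≢v)

  module Colouring {a : Fin n} (pa : Per a) where
    open Rooted pa public

    colour : Fin n → Bool
    colour v = parity (depth v)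

    colour-step : ∀ {v} → v ≢ a → colour v ≡ not (colour (f v))
    colour-step ne = cong parity (depth-step ne)

    class : Bool → Fin n → Bool
    class b v = inner v ∧ does (colour v Bool.≟ b)

    class-intro : ∀ {b v} → Inner v → colour v ≡ b → class b v ≡ true
    class-intro {b} {v} iv e rewrite iv = dec-true (colour v Bool.≟ b) e

    class-sum : count inner ≡ count (class true) + count (class false)
    class-sum = count-split-does inner colour

    -- The depth drops by one along every edge from `v` to `f v` except the one leaving the root
    -- `a`.
    proper : ∀ {i j} → adj G i j ≡ true → colour i ≡ colour j → (i ≡ a × j ≡ f a) ⊎ (j ≡ a × i ≡ f a)
    proper {i} {j} e same with edge i j e
    ... | inj₁ refl with i ≟ a
    ...   | yes refl = inj₁ (refl , refl)
    ...   | no ne = contradiction (trans (sym (colour-step ne)) same) (Bool.not-¬ refl ∘ sym)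
    proper {i} {j} e same | inj₂ refl with j ≟ a
    ...   | yes refl = inj₂ (refl , refl)
    ...   | no ne = contradiction (trans (sym (colour-step ne)) (sym same)) (Bool.not-¬ refl ∘ sym)

-- Bounds from the two colour classes of inner vertices.

module ClassBounds {n} {G : Graph n} (o : Orientation G) (pq : p G ≡ q G) {m : ℕ} (fam : IndepEigenFamily (Laplacian G) 1ℚ m) where
  open Orientation o
  open OrientationProperties o
  open EigenProperties o
  open DimensionBounds o pq fam

  bool-flip : ∀ {a b} → a ≢ b → a ≡ not b
  bool-flip {true}  {true}  h = contradiction refl h
  bool-flip {true}  {false} h = refl
  bool-flip {false} {true}  h = refl
  bool-flip {false} {false} h = contradiction refl h

  module CycleQuasi {u : Fin n} (pu : Per u) (qu : Quasi G u) where
    open Colouring pu public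

    -- The only possibly monochromatic edge ends at `u`, which is quasi-pendant and therefore not
    -- inner.
    alternate : ∀ {i j} → Inner i → Inner j → adj G i j ≡ true → colour i ≢ colour j
    alternate ii ij e same with proper e same
    ... | inj₁ (refl , _) = inner-nonquasi ii qu
    ... | inj₂ (refl , _) = inner-nonquasi ij qu

    alternate-to : ∀ {i j} → Inner i → Inner j → adj G i j ≡ true → colour j ≡ not (colour i)
    alternate-to ii ij e = bool-flip (alternate ii ij e ∘ sym)

    class-vanishing : ∀ {x} → Eig G x → ∀ b → (∀ i → Inner i → colour i ≡ b → x i ≡ 0ℚ) → ∀ i → x i ≡ 0ℚ
    class-vanishing {x} ex b z = inner-vanishing ex inj all
      where
      all : ∀ i → Inner i → x i ≡ 0ℚ
      all i ii with colour i Bool.≟ b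
      ... | yes e = z i ii e
      ... | no ne = inner-zero ex ii (λ j e ij → z j ij
                      (trans (alternate-to ii ij e) (trans (cong not (bool-flip ne)) (Bool.not-involutive b))))

    bound-class : ∀ b → m ≤ count (class b)
    bound-class b = determining (class b) (λ x ex z → class-vanishing ex b (λ i ii e → z i (class-intro ii e)))

    -- A vertex whose value follows from the rest of its class can be left out. These savings are
    -- what the equality case rules out.
    bound-class-strict : ∀ {i} → Inner i →
      (∀ x → Eig G x → (∀ j → Inner j → colour j ≡ colour i → j ≢ i → x j ≡ 0ℚ) → x i ≡ 0ℚ) →
      suc m ≤ count (class (colour i))
    bound-class-strict {i} ii kill = ℕ.≤-trans (s≤s (determining (class b ∖₁ i) h)) (ℕ.≤-reflexive (sym (count-∖₁ (class b) i (class-intro ii refl))))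
      where
      b = colour i
      h : ∀ x → Eig G x → (∀ j → (class b ∖₁ i) j ≡ true → x j ≡ 0ℚ) → ∀ j → x j ≡ 0ℚ
      h x ex z = class-vanishing ex b all
        where
        others : ∀ j → Inner j → colour j ≡ b → j ≢ i → x j ≡ 0ℚ
        others j ij e j≢i = z j (∖₁-intro (class b) i (class-intro ij e) j≢i)
        all : ∀ j → Inner j → colour j ≡ b → x j ≡ 0ℚ
        all j ij e with j ≟ i
        ... | yes refl = kill x ex others
        ... | no j≢i   = others j ij e j≢i

    strict-no-neighbour : ∀ {i} → Inner i → (∀ h → adj G i h ≡ true → ¬ Inner h) → suc m ≤ count (class (colour i))
    strict-no-neighbour ii none = bound-class-strict ii (λ x ex _ → inner-zero ex ii (λ j e ij → contradiction ij (none j e)))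

    around-other : ∀ {x} (ex : Eig G x) {i k} → Inner k → colour k ≡ not (colour i) →
      (∀ j → Inner j → colour j ≡ colour i → j ≢ i → x j ≡ 0ℚ) → ∀ l → adj G k l ≡ true → l ≢ i → x l ≡ 0ℚ
    around-other {x} ex {i} {k} ik ck z l kl l≢i with kind l
    ... | isP pl = contradiction pl (inner-neighbour-nonpendant (inner-nonquasi ik) kl)
    ... | isQ ql = Eigenvector.quasi-zero ex ql
    ... | isI il = z l il (trans (alternate-to ik il kl) (trans (cong not ck) (Bool.not-involutive _))) l≢i

    -- If `x` vanishes on the class of `i` except at `i`, a neighbour of `j` is zero or a positive
    -- multiple of its own neighbour sum, which is `x i` or zero. So all neighbours of `j` have the
    -- sign of `x i`, and they sum to zero.
    strict-common-neighbour : ∀ {i h j} → Inner i → Inner h → Inner j → adj G h i ≡ true → adj G h j ≡ true → i ≢ j →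
      suc m ≤ count (class (colour i))
    strict-common-neighbour {i} {h} {j} ii ih ij hi hj i≢j = bound-class-strict ii kill
      where
      ch : colour h ≡ not (colour i)
      ch = alternate-to ii ih (adj-sym hi)
      cj : colour j ≡ colour i
      cj = trans (alternate-to ih ij hj) (trans (cong not ch) (Bool.not-involutive _))
      kill : ∀ x → Eig G x → (∀ j → Inner j → colour j ≡ colour i → j ≢ i → x j ≡ 0ℚ) → x i ≡ 0ℚ
      kill x ex z = sign-kill ex (z j ij cj (i≢j ∘ sym)) (adj-sym hj) hi (inner-nonpendant ih) (around-other ex ih ch z) around
        where
        around : ∀ k → adj G j k ≡ true → k ≢ i → x k ≡ 0ℚ ⊎ (¬ Pendant G k × ∀ l → adj G k l ≡ true → l ≢ i → x l ≡ 0ℚ)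
        around k jk _ with kind k
        ... | isP pk = contradiction pk (inner-neighbour-nonpendant (inner-nonquasi ij) jk)
        ... | isQ qk = inj₁ (Eigenvector.quasi-zero ex qk)
        ... | isI ik = inj₂ (inner-nonpendant ik , around-other ex ik (trans (alternate-to ij ik jk) (cong not cj)) z)

    -- With a single inner neighbour `h`, the values at `i` and `h` are the only ones in the
    -- equations at both vertices, and degree 3 makes this system nonsingular.
    strict-high-degree : ∀ {i h a} → Inner i → Inner h → adj G i h ≡ true → deg G i ≡ suc (suc (suc a)) →
      (∀ k → Inner k → adj G i k ≡ true → k ≡ h) → suc m ≤ count (class (colour i))
    strict-high-degree {i} {h} ii ih e di only = bound-class-strict ii
      (λ x ex z → pair-kill ex di (inner-nonpendant ih) e (around-i x ex) (around-other ex ih (alternate-to ii ih e) z))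
      where
      around-i : ∀ x → Eig G x → ∀ k → adj G i k ≡ true → k ≢ h → x k ≡ 0ℚ
      around-i x ex k ik k≢h with kind k
      ... | isP pk = contradiction pk (inner-neighbour-nonpendant (inner-nonquasi ii) ik)
      ... | isQ qk = Eigenvector.quasi-zero ex qk
      ... | isI k' = contradiction (only k k' ik) k≢h

  module CycleInner {d : Fin n} (nd : ¬ Per d) (pc : Per (f d)) (allInner : ∀ {v} → Per v → Inner v) where
    c : Fin n
    c = f d

    open Colouring pc public

    d≢fc : d ≢ f c
    d≢fc e = no2 d (sym e)

    pred≢d : pred c ≢ d
    pred≢d e = nd (subst Per e (per-pred pc))

    c-degree : Σ ℕ λ a → deg G c ≡ suc (suc (suc a))
    c-degree = _ , trans (count-∖₁ A (f c) (f-adj c)) (cong suc (trans (count-∖₁ (A ∖₁ f c) (pred c) in₂)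
      (cong suc (count-∖₁ ((A ∖₁ f c) ∖₁ pred c) d in₃))))
      where
      A = adj G c
      in₂ = ∖₁-intro A (f c) {pred c} (adj-f⁻¹ (f-pred pc)) (pred≢f pc)
      in₃ = ∖₁-intro (A ∖₁ f c) (pred c) {d} (∖₁-intro A (f c) (adj-f⁻¹ refl) d≢fc) (pred≢d ∘ sym)

    c-colour : colour c ≡ false
    c-colour = cong parity depth-root

    f-≢c : ∀ {v} → f v ≡ c → v ≢ c
    f-≢c e refl = f≢ c e

    f-colour : ∀ {v} → f v ≡ c → colour v ≡ true
    f-colour {v} e = trans (colour-step (f-≢c e)) (cong not (trans (cong colour e) c-colour))

    inner-neighbours-zero : ∀ {x} (ex : Eig G x) {i} → Inner i → ∀ {A : Fin n → Set} → (∀ j → Inner j → adj G i j ≡ true → A j → x j ≡ 0ℚ) →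
      ∀ j → adj G i j ≡ true → A j → x j ≡ 0ℚ
    inner-neighbours-zero ex ii z j e aj with kind j
    ... | isP pj = contradiction pj (inner-neighbour-nonpendant (inner-nonquasi ii) e)
    ... | isQ qj = Eigenvector.quasi-zero ex qj
    ... | isI ij = z j ij e aj

    -- Both even vertices of the only improper edge c – f c are determined because deg c ≥ 3.
    bound-odd : m ≤ count (class true)
    bound-odd = determining (class true) h
      where
      h : ∀ x → Eig G x → (∀ i → class true i ≡ true → x i ≡ 0ℚ) → ∀ i → x i ≡ 0ℚ
      h x ex z = inner-vanishing ex inj all
        where
        odd : ∀ i → Inner i → colour i ≡ true → x i ≡ 0ℚ
        odd i ii e = z i (class-intro ii e)
        even-nbr : ∀ {i} → colour i ≡ false → ∀ {w} → (∀ j → adj G i j ≡ true → colour j ≡ false → j ≡ w) →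
          Inner i → ∀ j → adj G i j ≡ true → j ≢ w → x j ≡ 0ℚ
        even-nbr {i} ci only ii = inner-neighbours-zero ex ii λ j ij e j≢w → odd j ij (bool-flip (λ cj → j≢w (only j e cj)))
        c-only : ∀ j → adj G c j ≡ true → colour j ≡ false → j ≡ f c
        c-only j e cj with proper e (trans c-colour (sym cj))
        ... | inj₁ (_ , e') = e'
        ... | inj₂ (refl , e') = contradiction (sym e') (f≢ c)
        fc-only : ∀ j → colour (f c) ≡ false → adj G (f c) j ≡ true → colour j ≡ false → j ≡ c
        fc-only j cfc e cj with proper e (trans cfc (sym cj))
        ... | inj₁ (e' , _) = contradiction e' (f≢ c)
        ... | inj₂ (e' , _) = e'
        xc : x c ≡ 0ℚ
        xc with colour (f c) Bool.≟ false
        ... | yes cfc = pair-kill ex (proj₂ c-degree) (per-nonpendant (per-f pc)) (f-adj c)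
                (even-nbr c-colour c-only (allInner pc)) (even-nbr cfc (λ j → fc-only j cfc) (allInner (per-f pc)))
        ... | no ne = all-neighbours-zero G ex (proj₂ c-degree) around
          where
          around : ∀ j → adj G c j ≡ true → x j ≡ 0ℚ
          around j e with j ≟ f c
          ... | yes refl = odd (f c) (allInner (per-f pc)) (bool-flip ne)
          ... | no j≢    = even-nbr c-colour c-only (allInner pc) j e j≢
        all : ∀ i → Inner i → x i ≡ 0ℚ
        all i ii with colour i Bool.≟ true | i ≟ c
        ... | yes e | _ = odd i ii e
        ... | no _  | yes refl = xc
        ... | no ne | no i≢c = inner-zero ex ii around
          where
          around : ∀ j → adj G i j ≡ true → Inner j → x j ≡ 0ℚ
          around j e ij with colour j Bool.≟ true | j ≟ c
          ... | yes cj | _ = odd j ij cj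
          ... | no _   | yes refl = xc
          ... | no nj  | no j≢c with proper e (trans (bool-flip ne) (sym (bool-flip nj)))
          ...   | inj₁ (i≡c , _) = contradiction i≡c i≢c
          ...   | inj₂ (j≡c , _) = contradiction j≡c j≢c

    -- The root `c` itself can be left out. Two steps before it on the cycle lies another even
    -- vertex `i₂`, distinct from `c`, and their common neighbour `i₁` is odd. No edge joins two odd
    -- vertices, so the sign argument at `i₂` recovers `x c`.
    bound-even : suc m ≤ count (class false)
    bound-even = ℕ.≤-trans (s≤s (determining (class false ∖₁ c) h))
        (ℕ.≤-reflexive (sym (count-∖₁ (class false) c (class-intro (allInner pc) c-colour))))
      where
      i₁ i₂ : Fin n
      i₁ = pred c
      i₂ = pred i₁
      p₁ : Per i₁
      p₁ = per-pred pc
      p₂ : Per i₂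
      p₂ = per-pred p₁
      h : ∀ x → Eig G x → (∀ i → (class false ∖₁ c) i ≡ true → x i ≡ 0ℚ) → ∀ i → x i ≡ 0ℚ
      h x ex z = inner-vanishing ex inj all
        where
        even : ∀ i → Inner i → colour i ≡ false → i ≢ c → x i ≡ 0ℚ
        even i ii e i≢c = z i (∖₁-intro (class false) c (class-intro ii e) i≢c)
        around-odd : ∀ {k} → Inner k → colour k ≡ true → ∀ l → adj G k l ≡ true → l ≢ c → x l ≡ 0ℚ
        around-odd {k} ik ck = inner-neighbours-zero ex ik λ l il e l≢c → even l il (bool-flip λ cl → clash l cl (proper e (trans ck (sym cl)))) l≢c
          where
          clash : ∀ l → colour l ≡ true → (k ≡ c × l ≡ f c) ⊎ (l ≡ c × k ≡ f c) → ⊥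
          clash l cl (inj₁ (refl , _)) = true≢false (trans (sym ck) c-colour)
          clash l cl (inj₂ (refl , _)) = true≢false (trans (sym cl) c-colour)
        i₂≢c : i₂ ≢ c
        i₂≢c e = no2 i₂ (trans (cong f (f-pred p₁)) (trans (f-pred pc) (sym e)))
        c₂ : colour i₂ ≡ false
        c₂ = trans (colour-step i₂≢c) (cong not (trans (cong colour (f-pred p₁)) (f-colour (f-pred pc))))
        xc : x c ≡ 0ℚ
        xc = sign-kill ex (even i₂ (allInner p₂) c₂ i₂≢c) (subst (λ w → adj G i₂ w ≡ true) (f-pred p₁) (f-adj i₂))
               (subst (λ w → adj G i₁ w ≡ true) (f-pred pc) (f-adj i₁)) (per-nonpendant p₁)
               (around-odd (allInner p₁) (f-colour (f-pred pc))) around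
          where
          around : ∀ k → adj G i₂ k ≡ true → k ≢ c → x k ≡ 0ℚ ⊎ (¬ Pendant G k × ∀ l → adj G k l ≡ true → l ≢ c → x l ≡ 0ℚ)
          around k e k≢c with kind k
          ... | isP pk = contradiction pk (inner-neighbour-nonpendant (inner-nonquasi (allInner p₂)) e)
          ... | isQ qk = inj₁ (Eigenvector.quasi-zero ex qk)
          ... | isI ik with colour k Bool.≟ true
          ...   | yes ck = inj₂ (inner-nonpendant ik , around-odd ik ck)
          ...   | no nk  = inj₁ (even k ik (bool-flip nk) k≢c)
        even' : ∀ i → Inner i → colour i ≡ false → x i ≡ 0ℚ
        even' i ii e with i ≟ c
        ... | yes refl = xc
        ... | no i≢c   = even i ii e i≢c
        all : ∀ i → Inner i → x i ≡ 0ℚ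
        all i ii with colour i Bool.≟ true
        ... | no ne = even' i ii (bool-flip ne)
        ... | yes ci = inner-zero ex ii around
          where
          around : ∀ j → adj G i j ≡ true → Inner j → x j ≡ 0ℚ
          around j e ij with j ≟ c
          ... | yes refl = xc
          ... | no j≢c   = around-odd ii ci j e j≢c

-- The sequences with x₍ᵢ₊₂₎ = x₍ᵢ₊₁₎ - xᵢ through (s , 0) run with period 6 through these pairs.
data Hexagon (s : ℚ) : ℚ → ℚ → Set where
  hex₀ : Hexagon s s 0ℚ
  hex₁ : Hexagon s 0ℚ (- s)
  hex₂ : Hexagon s (- s) (- s)
  hex₃ : Hexagon s (- s) 0ℚ
  hex₄ : Hexagon s 0ℚ s
  hex₅ : Hexagon s s s

hexagon-step : ∀ {s a b} → Hexagon s a b → Hexagon s b (b -ℚ a)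
hexagon-step {s} hex₀ = subst (Hexagon s 0ℚ) (sym (ℚ.+-identityˡ (- s))) hex₁
hexagon-step {s} hex₁ = subst (Hexagon s (- s)) (sym (ℚ.+-identityʳ (- s))) hex₂
hexagon-step {s} hex₂ = subst (Hexagon s (- s)) (sym (ℚ.+-inverseʳ (- s))) hex₃
hexagon-step {s} hex₃ = subst (Hexagon s 0ℚ) (solve 1 (λ u → u := con 0ℚ :- :- u) refl s) hex₄
  where open +-*-Solver
hexagon-step {s} hex₄ = subst (Hexagon s s) (sym (ℚ.+-identityʳ s)) hex₅
hexagon-step {s} hex₅ = subst (Hexagon s s) (sym (ℚ.+-inverseʳ s)) hex₀

-- The first entry of a pair is always `s`, `- s` or zero, and doubling `s` gives one of these only
-- for `s` zero.
hexagon-double : ∀ {s a b} → Hexagon s a b → s +ℚ s ≡ a → s ≡ 0ℚ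
hexagon-double {s} {a} hex e = cases hex e
  where
  open +-*-Solver
  same : s +ℚ s ≡ s → s ≡ 0ℚ
  same e = trans (solve 1 (λ u → u := (u :+ u) :- u) refl s) (trans (cong (_-ℚ s) e) (ℚ.+-inverseʳ s))
  opposite : s +ℚ s ≡ - s → s ≡ 0ℚ
  opposite e = fromℕℚ-cancel-0 2 (trans (solve 1 (λ u → con (fromℕℚ 3) :* u := (u :+ u) :+ u) refl s) (trans (cong (_+ℚ s) e) (ℚ.+-inverseˡ s)))
  cases : ∀ {a b} → Hexagon s a b → s +ℚ s ≡ a → s ≡ 0ℚ
  cases hex₀ = same
  cases hex₁ = double-zero s
  cases hex₂ = opposite
  cases hex₃ = opposite
  cases hex₄ = double-zero s
  cases hex₅ = same

hexagon-zero : ∀ {s a b} → s ≡ 0ℚ → Hexagon s a b → a ≡ 0ℚ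
hexagon-zero refl hex₀ = refl
hexagon-zero refl hex₁ = refl
hexagon-zero refl hex₂ = refl
hexagon-zero refl hex₃ = refl
hexagon-zero refl hex₄ = refl
hexagon-zero refl hex₅ = refl

-- An all-inner cycle with one branch vertex of degree 3.

module SingleBranch {n} {G : Graph n} (o : Orientation G) (pq : p G ≡ q G) {m : ℕ} (fam : IndepEigenFamily (Laplacian G) 1ℚ m) where
  open Orientation o
  open OrientationProperties o
  open EigenProperties o
  open DimensionBounds o pq fam
  open ClassBounds o pq fam using (bool-flip; module CycleInner)

  module _ {d : Fin n} (nd : ¬ Per d) (pc : Per (f d)) (allInner : ∀ {v} → Per v → Inner v)
    (only-d : ∀ d' → ¬ Per d' → Per (f d') → d' ≡ d) where
    open CycleInner nd pc allInner

    c-neighbours : ∀ j → adj G c j ≡ true → j ≡ f c ⊎ j ≡ pred c ⊎ j ≡ d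
    c-neighbours j e with edge c j e
    ... | inj₁ e' = inj₁ (sym e')
    ... | inj₂ e' with per? j
    ...   | yes pj = inj₂ (inj₁ (per-injective pj (per-pred pc) (trans e' (sym (f-pred pc)))))
    ...   | no nj  = inj₂ (inj₂ (only-d j nj (subst Per (sym e') pc)))

    cycle-neighbours : ∀ {v} → Per v → v ≢ c → ∀ j → adj G v j ≡ true → j ≡ pred v ⊎ j ≡ f v
    cycle-neighbours {v} pv v≢c j e with edge v j e
    ... | inj₁ e' = inj₂ (sym e')
    ... | inj₂ e' with per? j
    ...   | yes pj = inj₁ (per-injective pj (per-pred pv) (trans e' (sym (f-pred pv))))
    ...   | no nj  = contradiction (trans (sym e') (cong f (only-d j nj (subst Per (sym e') pv)))) v≢c

    module _ {x : Vector n} (ex : Eig G x) where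
      open Eigenvector ex

      at-c : x c +ℚ x c ≡ x (f c) +ℚ (x (pred c) +ℚ x d)
      at-c = eig-three G ex (f-adj c) (adj-f⁻¹ (f-pred pc)) (adj-f⁻¹ refl) (pred≢f pc ∘ sym) (d≢fc ∘ sym) pred≢d c-neighbours

      along : ∀ {v} → Per v → f v ≢ c → x (f (f v)) ≡ x (f v) -ℚ x v
      along {v} pv ne = subst (λ w → x (f (f v)) ≡ x (f v) -ℚ x w) (pred-f pv)
        (eig-two G ex (adj-f⁻¹ (f-pred (per-f pv))) (f-adj (f v)) (pred≢f (per-f pv)) (cycle-neighbours (per-f pv) ne))

      -- With `x (f c) = 0` the recurrence starts at `(x c , 0)`. It holds at all cycle vertices
      -- other than `c`, and at `c` the sequence starts afresh.
      hexagon : x (f c) ≡ 0ℚ → ∀ {v} → Per v → Hexagon (x c) (x v) (x (f v))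
      hexagon z {v} pv = subst (λ w → Hexagon (x c) (x w) (x (f w))) (proj₂ (per-reach pv c)) (go (proj₁ (per-reach pv c)))
        where
        start : Hexagon (x c) (x c) (x (f c))
        start = subst (Hexagon (x c) (x c)) (sym z) hex₀
        go : ∀ k → Hexagon (x c) (x (iter f k c)) (x (f (iter f k c)))
        go zero = start
        go (suc k) with f (iter f k c) ≟ c
        ... | yes e = subst (λ w → Hexagon (x c) (x w) (x (f w))) (sym e) start
        ... | no ne = subst (Hexagon (x c) (x (f (iter f k c)))) (sym (along (per-iter k pc) ne)) (hexagon-step (go k))

      -- The equation at `c` reduces to `2 * x c = x (pred c)`, and the period-6 pattern allows this
      -- only for `x c = 0`, which makes the whole pattern zero.
      cycle-zero : x (f c) ≡ 0ℚ → x d ≡ 0ℚ → ∀ {v} → Per v → x v ≡ 0ℚ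
      cycle-zero z zd pv = hexagon-zero (hexagon-double (hexagon z (per-pred pc))
        (trans at-c (trans (cong₂ _+ℚ_ z (cong (x (pred c) +ℚ_) zd)) (trans (ℚ.+-identityˡ _) (ℚ.+-identityʳ _))))) (hexagon z pv)

      pred-c : ∀ k → iter f (suc k) c ≡ c → pred c ≡ iter f k c
      pred-c k e = trans (cong pred (sym e)) (pred-f (per-iter k pc))

      -- The cycle has length `depth (f c) + 1`, at most 5, and from `c` on carries the values
      -- `0, t, t, 0, -t, ...`. Neither the equation at `c` nor closing up is possible for nonzero
      -- `t` at both places. At length 6 the values `0, t, t, 0, -t, -t` satisfy both, whence the
      -- threshold.
      short-cycle-zero : depth (f c) < 5 → x c ≡ 0ℚ → x d ≡ 0ℚ → x (f c) ≡ 0ℚ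
      short-cycle-zero lt xc xd = go (depth (f c)) lt (trans (iter-suc f (depth (f c)) c) (depth-hits (f c)))
        where
        open +-*-Solver
        t = x (f c)
        balance : ∀ k → iter f (suc k) c ≡ c → 0ℚ ≡ t +ℚ x (iter f k c)
        balance k e = trans (sym (cong₂ _+ℚ_ xc xc)) (trans at-c (cong (t +ℚ_) (trans (cong₂ _+ℚ_ (cong x (pred-c k e)) xd) (ℚ.+-identityʳ _))))
        next : ∀ k → iter f (suc k) c ≢ c → x (iter f (suc (suc k)) c) ≡ x (iter f (suc k) c) -ℚ x (iter f k c)
        next k ne = along (per-iter k pc) ne
        x₂ : x (iter f 2 c) ≡ t
        x₂ = trans (next 0 (f≢ c)) (trans (cong (t -ℚ_) xc) (ℚ.+-identityʳ t))
        x₃ : x (iter f 3 c) ≡ 0ℚ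
        x₃ = trans (next 1 (no2 c)) (trans (cong (_-ℚ t) x₂) (ℚ.+-inverseʳ t))
        go : ∀ k → k < 5 → iter f (suc k) c ≡ c → t ≡ 0ℚ
        go 0 _ e = contradiction e (f≢ c)
        go 1 _ e = contradiction e (no2 c)
        go 2 _ e = double-zero t (sym (trans (balance 2 e) (cong (t +ℚ_) x₂)))
        go 3 _ e = sym (trans (balance 3 e) (trans (cong (t +ℚ_) x₃) (ℚ.+-identityʳ t)))
        -- At length 5 the equation at `c` only says `t - t = 0`; the contradiction comes from the
        -- recurrence, which would give `c` the value `-t`. The recurrence requires that the cycle
        -- has not closed before.
        go 4 _ e with iter f 3 c ≟ c | iter f 4 c ≟ c
        ... | yes e' | _ = go 2 (s≤s (s≤s (s≤s z≤n))) e'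
        ... | no _ | yes e' = go 3 (s≤s (s≤s (s≤s (s≤s z≤n)))) e'
        ... | no n₃ | no n₄ = begin
          t                 ≡⟨ solve 1 (λ u → u := con 0ℚ :- (con 0ℚ :- u)) refl t ⟩
          0ℚ -ℚ (0ℚ -ℚ t)   ≡⟨ cong₂ (λ a b → a -ℚ (a -ℚ b)) (sym x₃) (sym x₂) ⟩
          x (iter f 3 c) -ℚ (x (iter f 3 c) -ℚ x (iter f 2 c)) ≡⟨ cong (x (iter f 3 c) -ℚ_) (sym (next 2 n₃)) ⟩
          x (iter f 3 c) -ℚ x (iter f 4 c) ≡⟨ solve 2 (λ a b → a :- b := :- (b :- a)) refl (x (iter f 3 c)) (x (iter f 4 c)) ⟩
          - (x (iter f 4 c) -ℚ x (iter f 3 c)) ≡⟨ cong -_ (trans (sym (next 3 n₄)) (trans (cong x e) xc)) ⟩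
          0ℚ ∎
          where open ≡-Reasoning
        go (suc (suc (suc (suc (suc k))))) (s≤s (s≤s (s≤s (s≤s (s≤s ()))))) _

    bound-short : depth (f c) < 5 → m ≤ p G
    bound-short short = determining (isPendant G) h
      where
      h : ∀ x → Eig G x → (∀ i → isPendant G i ≡ true → x i ≡ 0ℚ) → ∀ i → x i ≡ 0ℚ
      h x ex z = vanishing inj pc (λ v pv → inj₁ (z v pv)) (inactive xc (short-cycle-zero ex short xc xd))
        where
        open Eigenvector ex
        na : ¬ Active d
        na = branch-inactive ex nd (λ v pv _ → z v pv)
        xd : x d ≡ 0ℚ
        xd = inactive-zero na
        xc : x c ≡ 0ℚ
        xc = decidable-stable (zero? c) (na ∘ inj₂)

    cyc : Fin n → Bool
    cyc v = does (per? v)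

    off : Bool → Fin n → Bool
    off b v = (inner v ∧ not (cyc v)) ∧ does (colour v Bool.≟ b)

    off-intro : ∀ {b v} → Inner v → ¬ Per v → colour v ≡ b → off b v ≡ true
    off-intro {b} {v} iv nv e rewrite iv | dec-false (per? v) nv = dec-true (colour v Bool.≟ b) e

    off-sum : count inner ≡ count (λ v → inner v ∧ cyc v) + (count (off true) + count (off false))
    off-sum = trans (count-split inner cyc)
      (cong (count (λ v → inner v ∧ cyc v) +_) (count-split-does (λ v → inner v ∧ not (cyc v)) colour))

    -- Zeros at `f c` and `d` clear the whole cycle, and the one possibly monochromatic edge
    -- `c – f c` lies on it. Off the cycle, one colour therefore determines the other.
    off-vanishing : ∀ {x} → Eig G x → ∀ b → (∀ v → Inner v → ¬ Per v → colour v ≡ b → x v ≡ 0ℚ) → x (f c) ≡ 0ℚ → x d ≡ 0ℚ →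
      ∀ v → x v ≡ 0ℚ
    off-vanishing {x} ex b z zf zd = inner-vanishing ex inj all
      where
      all : ∀ i → Inner i → x i ≡ 0ℚ
      all i ii with per? i | colour i Bool.≟ b
      ... | yes pi | _ = cycle-zero ex zf zd pi
      ... | no ni | yes e = z i ii ni e
      ... | no ni | no ne = inner-zero ex ii nbs
        where
        nbs : ∀ j → adj G i j ≡ true → Inner j → x j ≡ 0ℚ
        nbs j e ij with per? j | colour j Bool.≟ b
        ... | yes pj | _ = cycle-zero ex zf zd pj
        ... | no nj | yes e' = z j ij nj e'
        ... | no nj | no ne' with proper e (trans (bool-flip ne) (sym (bool-flip ne')))
        ...   | inj₁ (refl , _) = contradiction pc ni
        ...   | inj₂ (refl , _) = contradiction pc nj

    -- Only `f c` has to be added: `d` is quasi-pendant, hence zero, or an inner vertex of odd depth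
    -- and already in the set. For the even class `d` must be added too.
    bound-off-odd : m ≤ suc (count (off true))
    bound-off-odd = ℕ.≤-trans (determining (off true ∪₁ f c) h) (count-∪₁ (off true) (f c))
      where
      h : ∀ x → Eig G x → (∀ i → (off true ∪₁ f c) i ≡ true → x i ≡ 0ℚ) → ∀ i → x i ≡ 0ℚ
      h x ex z = off-vanishing ex true on (z (f c) (∪₁-here (off true) (f c))) xd
        where
        on : ∀ v → Inner v → ¬ Per v → colour v ≡ true → x v ≡ 0ℚ
        on v iv nv e = z v (∪₁-there (off true) (f c) {v} (off-intro iv nv e))
        xd : x d ≡ 0ℚ
        xd with kind d
        ... | isP pd = contradiction pd (inner-neighbour-nonpendant (inner-nonquasi (allInner pc)) (adj-f⁻¹ refl))
        ... | isQ qd = Eigenvector.quasi-zero ex qd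
        ... | isI id = on d id nd (f-colour refl)

    bound-off-even : m ≤ 2 + count (off false)
    bound-off-even = ℕ.≤-trans (determining ((off false ∪₁ f c) ∪₁ d) h)
      (ℕ.≤-trans (count-∪₁ (off false ∪₁ f c) d) (s≤s (count-∪₁ (off false) (f c))))
      where
      h : ∀ x → Eig G x → (∀ i → ((off false ∪₁ f c) ∪₁ d) i ≡ true → x i ≡ 0ℚ) → ∀ i → x i ≡ 0ℚ
      h x ex z = off-vanishing ex false
        (λ v iv nv e → z v (∪₁-there (off false ∪₁ f c) d {v} (∪₁-there (off false) (f c) {v} (off-intro iv nv e))))
        (z (f c) (∪₁-there (off false ∪₁ f c) d {f c} (∪₁-here (off false) (f c)))) (z d (∪₁-here (off false ∪₁ f c) d))

    long-cycle : 5 ≤ depth (f c) → 6 ≤ count (λ v → inner v ∧ cyc v)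
    long-cycle long = count-injection 6 _ (λ i → iter f i c) on distinct
      where
      on : ∀ i → i < 6 → inner (iter f i c) ∧ cyc (iter f i c) ≡ true
      on i _ = cong₂ _∧_ (allInner (per-iter i pc)) (dec-true (per? (iter f i c)) (per-iter i pc))
      distinct : ∀ i j → i < j → j < 6 → iter f i c ≢ iter f j c
      distinct i j i<j j<6 e = apart (j ∸ i) (ℕ.m<n⇒0<n∸m i<j) (ℕ.≤-<-trans (ℕ.m∸n≤m j i) j<6) (iter-collision pc i j (ℕ.<⇒≤ i<j) e)
        where
        apart : ∀ k → 0 < k → k < 6 → iter f k c ≢ c
        apart (suc k) _ (s≤s k<5) e = ℕ.<-irrefl refl (ℕ.<-≤-trans k<5 (ℕ.≤-trans long (depth-least (f c) k (trans (sym (iter-suc f k c)) e))))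

-- Combining the bounds to four times `m` at most `n`.

module UpperBound {n} {G : Graph n} (o : Orientation G) (pq : p G ≡ q G) {m : ℕ} (fam : IndepEigenFamily (Laplacian G) 1ℚ m) where
  open Orientation o
  open OrientationProperties o
  open EigenProperties o
  open DimensionBounds o pq fam
  open ClassBounds o pq fam
  open SingleBranch o pq fam

  entry : ∀ {v} → ¬ Per v → Σ (Fin n) λ d → ¬ Per d × Per (f d)
  entry {v} nv = go (proj₁ (reach v)) v nv (proj₂ (reach v))
    where
    go : ∀ k v → ¬ Per v → iter f k v ≡ root → Σ (Fin n) λ d → ¬ Per d × Per (f d)
    go zero    v nv refl = contradiction Orbit.on-u nv
    go (suc k) v nv e with per? (f v)
    ... | yes pf = v , nv , pf
    ... | no nf  = go k (f v) nf (trans (sym (iter-suc f k v)) e)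

  n-split : n ≡ p G + (p G + count inner)
  n-split = trans vertex-count (cong (λ k → p G + (k + count inner)) (sym pq))

  sum-bounds : ∀ {a b} → m + m ≤ a + a → m + m ≤ b → 4 * m ≤ a + (a + b)
  sum-bounds {a} {b} h₁ h₂ = begin
    4 * m             ≡⟨ fourfold m ⟩
    (m + m) + (m + m) ≤⟨ ℕ.+-mono-≤ h₁ h₂ ⟩
    (a + a) + b       ≡⟨ ℕ.+-assoc a a b ⟩
    a + (a + b)       ∎
    where
    open ℕ.≤-Reasoning
    fourfold : ∀ m → 4 * m ≡ (m + m) + (m + m)
    fourfold = solve-∀

  sum-bounds-< : ∀ {a b} → m + m ≤ a + a → suc (m + m) ≤ b → 4 * m < a + (a + b)
  sum-bounds-< {a} {b} h₁ h₂ = begin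
    suc (4 * m)             ≡⟨ fourfold m ⟩
    (m + m) + suc (m + m) ≤⟨ ℕ.+-mono-≤ h₁ h₂ ⟩
    (a + a) + b       ≡⟨ ℕ.+-assoc a a b ⟩
    a + (a + b)       ∎
    where
    open ℕ.≤-Reasoning
    fourfold : ∀ m → suc (4 * m) ≡ (m + m) + suc (m + m)
    fourfold = solve-∀

  -- A second branch or a short cycle gives `m ≤ p G`, and the even class supplies the strictness.
  -- What remains is one branch on a cycle of length at least 6.
  strict-cycle-inner : (∀ {v} → Per v → Inner v) → ∀ {d} → ¬ Per d → Per (f d) → 4 * m < n
  strict-cycle-inner allInner {d} nd pc = subst (4 * m <_) (sym n-split) (cases (any? (λ d' → ¬? (per? d') ×-dec (per? (f d') ×-dec ¬? (d' ≟ d)))))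
    where
    open CycleInner nd pc allInner
    via-pendants : m ≤ p G → 4 * m < p G + (p G + count inner)
    via-pendants m≤p = sum-bounds-< {p G} (ℕ.+-mono-≤ m≤p m≤p) (subst (suc (m + m) ≤_) (sym class-sum)
      (subst (_≤ count (class true) + count (class false)) (ℕ.+-suc m m) (ℕ.+-mono-≤ bound-odd bound-even)))
    cases : Dec (Σ (Fin n) λ d' → ¬ Per d' × (Per (f d') × d' ≢ d)) → 4 * m < p G + (p G + count inner)
    cases (yes (d' , nd' , pd' , d'≢d)) = via-pendants (bound-two-branches nd pc nd' pd' d'≢d)
    cases (no none) with depth (f c) ℕ.<? 5
    ... | yes short = via-pendants (bound-short nd pc allInner single short)
      where
      single : ∀ d' → ¬ Per d' → Per (f d') → d' ≡ d
      single d' nd' pd' = decidable-stable (d' ≟ d) (λ ne → none (d' , nd' , pd' , ne))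
    ... | no ¬short = begin
      suc (4 * m)           ≡⟨ rearrange m ⟩
      suc ((m + m) + (m + m)) ≤⟨ s≤s (ℕ.+-mono-≤ (ℕ.+-mono-≤ m≤ m≤) (ℕ.+-mono-≤ odd even)) ⟩
      -- The four bounds exceed `p + p + X + Y` by `1 + 1 + 1 + 2 = 5`, while the cycle contributes
      -- at least 6 further inner vertices: strict by one.
      suc ((suc (p G) + suc (p G)) + (suc X + (2 + Y))) ≡⟨ collect (p G) X Y ⟩
      p G + (p G + (6 + (X + Y))) ≤⟨ ℕ.+-monoʳ-≤ (p G) (ℕ.+-monoʳ-≤ (p G) (ℕ.+-monoˡ-≤ (X + Y) long)) ⟩
      p G + (p G + (count (λ v → inner v ∧ cyc nd pc allInner single v) + (X + Y))) ≡⟨ cong (λ k → p G + (p G + k)) (sym (off-sum nd pc allInner single)) ⟩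
      p G + (p G + count inner) ∎
      where
      open ℕ.≤-Reasoning
      single : ∀ d' → ¬ Per d' → Per (f d') → d' ≡ d
      single d' nd' pd' = decidable-stable (d' ≟ d) (λ ne → none (d' , nd' , pd' , ne))
      m≤ = bound-branch nd pc
      X = count (off nd pc allInner single true)
      Y = count (off nd pc allInner single false)
      odd = bound-off-odd nd pc allInner single
      even = bound-off-even nd pc allInner single
      long = long-cycle nd pc allInner single (ℕ.≮⇒≥ ¬short)
      rearrange : ∀ m → suc (4 * m) ≡ suc ((m + m) + (m + m))
      rearrange = solve-∀
      collect : ∀ a X Y → suc ((suc a + suc a) + (suc X + (2 + Y))) ≡ a + (a + (6 + (X + Y)))
      collect = solve-∀

  strict-or-cycle-quasi : 10 ≤ n → 4 * m < n ⊎ Σ (Fin n) λ u → Per u × Quasi G u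
  strict-or-cycle-quasi 10≤n with any? (λ u → per? u ×-dec quasi? u) | any? pendant?
  ... | yes uq | _ = inj₂ uq
  -- On a bare cycle `4 * m` is at most 8, which is where the size of `n` enters.
  ... | no _ | no none = inj₁ (ℕ.≤-trans (s≤s (ℕ.*-monoʳ-≤ 4 (bound-no-pendant (λ v pv → none (v , pv))))) (ℕ.≤-trans (ℕ.n≤1+n 9) 10≤n))
  ... | no nq | yes (v , pv) with entry (λ per → per-nonpendant per pv)
  ...   | d , nd , pc = inj₁ (strict-cycle-inner (λ {w} pw → inner-intro (per-nonpendant pw) (λ qw → nq (w , pw , qw))) nd pc)

  bound-cycle-quasi-4 : ∀ {u} → Per u → Quasi G u → 4 * m ≤ n
  bound-cycle-quasi-4 pu qu = subst (4 * m ≤_) (sym n-split) (sum-bounds {p G} (ℕ.+-mono-≤ m≤p m≤p)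
    (subst (m + m ≤_) (sym class-sum) (ℕ.+-mono-≤ (bound-class true) (bound-class false))))
    where
    open CycleQuasi pu qu
    m≤p = bound-cycle-quasi pu qu

  bound : 10 ≤ n → 4 * m ≤ n
  bound 10≤n with strict-or-cycle-quasi 10≤n
  ... | inj₁ lt = ℕ.<⇒≤ lt
  ... | inj₂ (u , pu , qu) = bound-cycle-quasi-4 pu qu

-- The equality case

module Equality {n} {G : Graph n} (o : Orientation G) (pq : p G ≡ q G) {m : ℕ} (fam : IndepEigenFamily (Laplacian G) 1ℚ m)
  (noP3 : ¬ HasPendantP3 G) (tight : 4 * m ≡ n) {u : Fin n} (pu : OrientationProperties.Per o u) (qu : Quasi G u) where
  open Orientation o
  open OrientationProperties o
  open EigenProperties o
  open DimensionBounds o pq fam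
  open ClassBounds o pq fam
  open UpperBound o pq fam
  open CycleQuasi pu qu

  m≤p : m ≤ p G
  m≤p = bound-cycle-quasi pu qu

  n-classes : 4 * m ≡ p G + (p G + (count (class true) + count (class false)))
  n-classes = trans tight (trans n-split (cong (λ k → p G + (p G + k)) class-sum))

  -- Four numbers that are at least `m` and sum to `4 * m` leave no room for one of them to be
  -- larger.
  not-exceeded : ∀ {a b c d} → m ≤ a → m ≤ b → m ≤ c → m ≤ d → 4 * m ≡ a + (b + (c + d)) → ¬ (suc m ≤ a)
  not-exceeded {a} {b} {c} {d} _ hb hc hd e ha = ℕ.<-irrefl e (ℕ.≤-trans (ℕ.≤-reflexive (shape m)) (ℕ.+-mono-≤ ha (ℕ.+-mono-≤ hb (ℕ.+-mono-≤ hc hd))))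
    where
    shape : ∀ m → suc (4 * m) ≡ suc m + (m + (m + m))
    shape = solve-∀

  p≡m : p G ≡ m
  p≡m = ℕ.≤-antisym (ℕ.≮⇒≥ (not-exceeded m≤p m≤p (bound-class true) (bound-class false) n-classes)) m≤p

  class-attained : ∀ b → ¬ (suc m ≤ count (class b))
  class-attained true = not-exceeded (bound-class true) m≤p m≤p (bound-class false)
    (trans n-classes (rotate (p G) (count (class true)) (count (class false))))
    where
    rotate : ∀ a b c → a + (a + (b + c)) ≡ b + (a + (a + c))
    rotate = solve-∀
  class-attained false = not-exceeded (bound-class false) m≤p m≤p (bound-class true)
    (trans n-classes (rotate (p G) (count (class true)) (count (class false))))
    where
    rotate : ∀ a b c → a + (a + (b + c)) ≡ c + (a + (a + b))
    rotate = solve-∀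

  inner-neighbour : ∀ {i} → Inner i → Σ (Fin n) λ h → adj G i h ≡ true × Inner h
  inner-neighbour {i} ii = decidable-stable (any? (λ h → (adj G i h Bool.≟ true) ×-dec (inner h Bool.≟ true)))
    (λ none → class-attained (colour i) (strict-no-neighbour ii (λ h e ih → none (h , e , ih))))

  inner-neighbour-unique : ∀ {h i j} → Inner h → Inner i → Inner j → adj G h i ≡ true → adj G h j ≡ true → i ≡ j
  inner-neighbour-unique {h} {i} {j} ih ii ij hi hj = decidable-stable (i ≟ j)
    (λ i≢j → class-attained (colour i) (strict-common-neighbour ii ih ij hi hj i≢j))

  inner-degree : ∀ {i} → Inner i → deg G i ≡ 2
  inner-degree {i} ii = cases (nonpendant-degree (inner-nonpendant ii)) (inner-neighbour ii)
    where
    cases : (Σ ℕ λ d → deg G i ≡ suc (suc d)) → (Σ (Fin n) λ h → adj G i h ≡ true × Inner h) → deg G i ≡ 2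
    cases (zero  , e) _ = e
    cases (suc a , e) (h , ih-adj , ih) = contradiction
      (strict-high-degree ii ih ih-adj e (λ k ik e' → inner-neighbour-unique ii ik ih e' ih-adj)) (class-attained (colour i))

  -- Otherwise the edge from `w` to `f w` is inactive for every eigenvector, which excuses the
  -- pendant vertex `v` at `w`. If `w` is on the cycle it can serve as root, and the remaining
  -- `p - 1` pendant vertices determine. If not, the root is `u`: `v` and the pendant vertex `t` at
  -- `u` leave, `f u` enters. Either set has fewer than `p = m` elements.
  quasi-f-nonquasi : ∀ {w} → Quasi G w → ¬ Quasi G (f w)
  quasi-f-nonquasi {w} qw qfw with quasi-pendant G qw | per? w
  ... | v , wv , pv | yes pw = ℕ.<-irrefl refl (ℕ.≤-trans (s≤s (determining (isPendant G ∖₁ v) h))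
          (ℕ.≤-trans (ℕ.≤-reflexive (sym (count-∖₁ (isPendant G) v pv))) (ℕ.≤-reflexive p≡m)))
    where
    h : ∀ x → Eig G x → (∀ i → (isPendant G ∖₁ v) i ≡ true → x i ≡ 0ℚ) → ∀ i → x i ≡ 0ℚ
    h x ex z = vanishing inj pw pend na
      where
      open Eigenvector ex
      na : ¬ Active w
      na = inactive (quasi-zero qw) (quasi-zero qfw)
      pend : ∀ v' → Pendant G v' → x v' ≡ 0ℚ ⊎ ¬ Active (f v')
      pend v' pv' with v' ≟ v
      ... | yes refl = inj₂ (subst (¬_ ∘ Active) (sym (pendant-f pv wv)) na)
      ... | no ne    = inj₁ (z v' (∖₁-intro (isPendant G) v pv' ne))
  ... | v , wv , pv | no nw with quasi-pendant G qu
  ...   | t , ut , pt = ℕ.<-irrefl refl (ℕ.≤-trans (s≤s (ℕ.≤-trans (determining (B ∪₁ f u) h) (count-∪₁ B (f u))))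
          (ℕ.≤-trans (ℕ.≤-reflexive (sym (trans (count-∖₁ (isPendant G) v pv) (cong suc (count-∖₁ (isPendant G ∖₁ v) t (∖₁-intro (isPendant G) v pt t≢v))))))
                     (ℕ.≤-reflexive p≡m)))
    where
    B : Fin n → Bool
    B = (isPendant G ∖₁ v) ∖₁ t
    t≢v : t ≢ v
    t≢v refl = nw (subst Per (trans (sym (pendant-f pt ut)) (pendant-f pv wv)) pu)
    h : ∀ x → Eig G x → (∀ i → (B ∪₁ f u) i ≡ true → x i ≡ 0ℚ) → ∀ i → x i ≡ 0ℚ
    h x ex z = vanishing inj pu pend na
      where
      open Eigenvector ex
      na : ¬ Active u
      na = inactive (quasi-zero qu) (z (f u) (∪₁-here B (f u)))
      pend : ∀ v' → Pendant G v' → x v' ≡ 0ℚ ⊎ ¬ Active (f v')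
      pend v' pv' with v' ≟ v | v' ≟ t
      ... | yes refl | _ = inj₂ (subst (¬_ ∘ Active) (sym (pendant-f pv wv)) (inactive (quasi-zero qw) (quasi-zero qfw)))
      ... | no _ | yes refl = inj₂ (subst (¬_ ∘ Active) (sym (pendant-f pt ut)) na)
      ... | no v'≢v | no v'≢t = inj₁ (z v' (∪₁-there B (f u) {v'} (∖₁-intro (isPendant G ∖₁ v) t (∖₁-intro (isPendant G) v pv' v'≢v) v'≢t)))

  f-nonpendant : ∀ {v} → ¬ Pendant G (f v)
  f-nonpendant {v} pfv = no2 v (pendant-only pfv (adj-f⁻¹ refl))

  -- A nonperiodic vertex all of whose preimages are pendant would be the middle of a pendant P₃.
  nonpendant-per : ∀ {v} → ¬ Pendant G v → Per v
  nonpendant-per {v} npv = decidable-stable (per? v) (λ nv → back-nonper {⊥} {λ h → ¬ Pendant G h} earlier v nv npv)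
    where
    earlier : ∀ h → ¬ Per h → ¬ Pendant G h → ⊥ ⊎ Σ (Fin n) λ h' → ¬ Pendant G h' × f h' ≡ h
    earlier h nh np with any? (λ h' → ¬? (pendant? h') ×-dec (f h' ≟ h))
    ... | yes (h' , np' , e) = inj₂ (h' , np' , e)
    ... | no none with preimage np
    ...   | w , refl = contradiction
              (w , f w , f (f w) , f (f (f w)) , f-adj w , f-adj (f w) , f-adj (f (f w)) , no2 (f w) ,
               pendant⇒deg G pw , degree , inner-degree (inner-intro f-nonpendant (quasi-f-nonquasi (pendant-f-quasi pw)))) noP3
      where
      all-pendant : ∀ w' → f w' ≡ f w → Pendant G w'
      all-pendant w' e = decidable-stable (pendant? w') (λ np' → none (w' , np' , e))
      pw : Pendant G w
      pw = all-pendant w refl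
      degree : deg G (f w) ≡ 2
      degree = count-exactly-two (adj G (f w)) (f (f w)) w (f-adj (f w)) (adj-f⁻¹ refl) (no2 w) only
        where
        only : ∀ j → adj G (f w) j ≡ true → j ≡ f (f w) ⊎ j ≡ w
        only j e with edge (f w) j e
        ... | inj₁ e' = inj₁ (sym e')
        ... | inj₂ e' = inj₂ (inj (all-pendant j e') pw e')

  inner-two : ∀ {i a b} → Inner i → adj G i a ≡ true → adj G i b ≡ true → a ≢ b → ∀ {j} → adj G i j ≡ true → j ≡ a ⊎ j ≡ b
  inner-two {i} ii ia ib a≢b ij = count-two (adj G i) (inner-degree ii) ia ib a≢b ij

  quasi-next : ∀ {v} → Quasi G v → Inner (f v)
  quasi-next qv = inner-intro f-nonpendant (quasi-f-nonquasi qv)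

  -- `f v` has degree 2 and an inner neighbour, and its other neighbour `v` is quasi-pendant.
  inner-next : ∀ {v} → Quasi G v → Inner (f (f v))
  inner-next {v} qv = choose (inner-neighbour (quasi-next qv))
    where
    second : ∀ {h} → h ≡ v ⊎ h ≡ f (f v) → Inner h → Inner (f (f v))
    second (inj₁ refl) ih = contradiction qv (inner-nonquasi ih)
    second (inj₂ refl) ih = ih
    choose : (Σ (Fin n) λ h → adj G (f v) h ≡ true × Inner h) → Inner (f (f v))
    choose (h , e , ih) = second (inner-two (quasi-next qv) (adj-f⁻¹ {f v} {v} refl) (f-adj (f v)) (no2 v ∘ sym) e) ih

  -- The inner vertex `f (f v)` already has `f v` as its one inner neighbour.
  quasi-third : ∀ {v} → Quasi G v → Quasi G (f (f (f v)))
  quasi-third {v} qv = cases (kind (f (f (f v))))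
    where
    cases : Kind (f (f (f v))) → Quasi G (f (f (f v)))
    cases (isP pw) = contradiction pw f-nonpendant
    cases (isQ qw) = qw
    cases (isI iw) = contradiction (inner-neighbour-unique (inner-next qv) iw (quasi-next qv) (f-adj (f (f v))) (adj-f⁻¹ refl)) (no2 (f v))

  quasi-every-third : ∀ s → Quasi G (iter f (3 * s) u)
  quasi-every-third s = subst (λ k → Quasi G (iter f k u)) (ℕ.*-comm s 3) (go s)
    where
    go : ∀ s → Quasi G (iter f (s * 3) u)
    go zero    = qu
    go (suc s) = quasi-third (go s)

  period : ℕ
  period = suc (depth (f u))

  period-closes : iter f period u ≡ u
  period-closes = trans (iter-suc f (depth (f u)) u) (depth-hits (f u))

  iter-reduce : ∀ l → Σ ℕ λ i → i < period × iter f i u ≡ iter f l u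
  iter-reduce zero = 0 , s≤s z≤n , refl
  iter-reduce (suc l) with iter-reduce l
  ... | i , lt , e with suc i ℕ.<? period
  ...   | yes lt' = suc i , lt' , cong f e
  ...   | no ¬lt  = 0 , s≤s z≤n , trans (sym period-closes) (trans (cong (λ k → iter f k u) (ℕ.≤-antisym (ℕ.≮⇒≥ ¬lt) lt)) (cong f e))

  per-index : ∀ {v} → Per v → Σ ℕ λ i → i < period × iter f i u ≡ v
  per-index pv with per-reach pv u
  ... | l , refl = iter-reduce l

  -- The cycle consists exactly of the nonpendant vertices, and their number is `n - p = 4 * m - m`.
  period≡ : period ≡ 3 * m
  period≡ = ℕ.+-cancelˡ-≡ m period (3 * m) (trans (cong (m +_) (ℕ.≤-antisym lower upper)) (trans (cong (_+ count nonpend) (sym p≡m)) (sym (trans tight count-n))))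
    where
    nonpend : Fin n → Bool
    nonpend v = not (isPendant G v)
    nonpend-intro : ∀ {v} → ¬ Pendant G v → nonpend v ≡ true
    nonpend-intro np = cong not (¬true np)
    nonpend-elim : ∀ {v} → nonpend v ≡ true → ¬ Pendant G v
    nonpend-elim {v} h pv rewrite pv = contradiction h λ ()
    count-n : n ≡ p G + count nonpend
    count-n = trans (sym (count-true n)) (count-split (λ _ → true) (isPendant G))
    lower : period ≤ count nonpend
    lower = count-injection period nonpend (λ i → iter f i u) (λ i _ → nonpend-intro (per-nonpendant (per-iter i pu))) distinct
      where
      distinct : ∀ i j → i < j → j < period → iter f i u ≢ iter f j u
      distinct i j i<j j<N e = apart (j ∸ i) (ℕ.m<n⇒0<n∸m i<j) (ℕ.≤-<-trans (ℕ.m∸n≤m j i) j<N) (iter-collision pu i j (ℕ.<⇒≤ i<j) e)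
        where
        apart : ∀ k → 0 < k → k < period → iter f k u ≢ u
        apart (suc k) _ (s≤s lt) e = ℕ.<-irrefl refl (ℕ.<-≤-trans lt (depth-least (f u) k (trans (sym (iter-suc f k u)) e)))
    upper : count nonpend ≤ period
    upper = ℕ.≤-trans (count-surj {period} (λ _ → true) nonpend (λ i → iter f (toℕ i) u) onto) (ℕ.≤-reflexive (count-true period))
      where
      onto : ∀ v → nonpend v ≡ true → Σ (Fin period) λ i → true ≡ true × iter f (toℕ i) u ≡ v
      onto v h with per-index (nonpendant-per (nonpend-elim h))
      ... | i , lt , e = fromℕ< lt , refl , trans (cong (λ k → iter f k u) (toℕ-fromℕ< lt)) e

  cycle-closes : iter f (3 * m) u ≡ u
  cycle-closes = subst (λ k → iter f k u ≡ u) period≡ period-closes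

  cycle-index : ∀ {v} → ¬ Pendant G v → Σ ℕ λ i → i < 3 * m × iter f i u ≡ v
  cycle-index np with per-index (nonpendant-per np)
  ... | i , lt , e = i , subst (i <_) period≡ lt , e

-- The extremal graphs

module Extremal (k : ℕ) where

  -- inj₁ (s , 0), inj₁ (s , 1), inj₁ (s , 2) are c, a, b of the s-th block, inj₂ s is the pendant vertex at c.
  Label : Set
  Label = (Fin k × Fin 3) ⊎ Fin k

  private
    size : k * 3 + k ≡ 4 * k
    size = trans (cong (_+ k) (ℕ.*-comm k 3)) (ℕ.+-comm (3 * k) k)

    pack : Label → Fin (k * 3) ⊎ Fin k
    pack (inj₁ (s , r)) = inj₁ (combine s r)
    pack (inj₂ s)       = inj₂ s

    unpack : Fin (k * 3) ⊎ Fin k → Label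
    unpack (inj₁ i) = inj₁ (remQuot {k} 3 i)
    unpack (inj₂ s) = inj₂ s

    pack-unpack : ∀ z → pack (unpack z) ≡ z
    pack-unpack (inj₁ i) = cong inj₁ (combine-remQuot {k} 3 i)
    pack-unpack (inj₂ s) = refl

    unpack-pack : ∀ v → unpack (pack v) ≡ v
    unpack-pack (inj₁ (s , r)) = cong inj₁ (remQuot-combine s r)
    unpack-pack (inj₂ s)       = refl

  num : Label → ℕ
  num (inj₁ (s , r)) = 3 * toℕ s + toℕ r
  num (inj₂ s)       = 3 * k + toℕ s

  abstract
    code : Label → Fin (4 * k)
    code v = cast size (join (k * 3) k (pack v))

    decode : Fin (4 * k) → Label
    decode j = unpack (splitAt (k * 3) (cast (sym size) j))

    code-decode : ∀ j → code (decode j) ≡ j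
    code-decode j = trans (cong (λ z → cast size (join (k * 3) k z)) (pack-unpack (splitAt (k * 3) (cast (sym size) j))))
      (trans (cong (cast size) (join-splitAt (k * 3) k (cast (sym size) j))) (cast-involutive size (sym size) j))

    decode-code : ∀ v → decode (code v) ≡ v
    decode-code v = trans (cong (λ z → unpack (splitAt (k * 3) z)) (cast-involutive (sym size) size (join (k * 3) k (pack v))))
      (trans (cong unpack (splitAt-join (k * 3) k (pack v))) (unpack-pack v))

    toℕ-code : ∀ v → toℕ (code v) ≡ num v
    toℕ-code (inj₁ (s , r)) = trans (toℕ-cast size (join (k * 3) k (inj₁ (combine s r)))) (trans (toℕ-↑ˡ (combine s r) k) (toℕ-combine s r))
    toℕ-code (inj₂ s) = trans (toℕ-cast size (join (k * 3) k (inj₂ s))) (trans (toℕ-↑ʳ (k * 3) s) (cong (_+ toℕ s) (ℕ.*-comm k 3)))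

  num-injective : ∀ {v w} → num v ≡ num w → v ≡ w
  num-injective {v} {w} e = trans (sym (decode-code v)) (trans (cong decode (toℕ-injective (trans (toℕ-code v) (trans e (sym (toℕ-code w)))))) (decode-code w))

next : ∀ {k} → Fin k → Fin k
next {suc k} s with suc (toℕ s) ℕ.<? suc k
... | yes lt = fromℕ< lt
... | no _   = fzero

next-spec : ∀ {k} (s : Fin k) → (suc (toℕ s) < k × toℕ (next s) ≡ suc (toℕ s)) ⊎ (suc (toℕ s) ≡ k × toℕ (next s) ≡ 0)
next-spec {suc k} s with suc (toℕ s) ℕ.<? suc k
... | yes lt = inj₁ (lt , toℕ-fromℕ< lt)
... | no ¬lt = inj₂ (ℕ.≤-antisym (toℕ<n s) (ℕ.≮⇒≥ ¬lt) , refl)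

next-injective : ∀ {k} {s t : Fin k} → next s ≡ next t → s ≡ t
next-injective {s = s} {t} e with next-spec s | next-spec t
... | inj₁ (_ , a) | inj₁ (_ , b) = toℕ-injective (ℕ.suc-injective (trans (sym a) (trans (cong toℕ e) b)))
... | inj₂ (a , _) | inj₂ (b , _) = toℕ-injective (ℕ.suc-injective (trans a (sym b)))
... | inj₁ (_ , a) | inj₂ (_ , b) = contradiction (trans (sym a) (trans (cong toℕ e) b)) (λ ())
... | inj₂ (_ , a) | inj₁ (_ , b) = contradiction (trans (sym b) (trans (cong toℕ (sym e)) a)) (λ ())

prev : ∀ {k} → Fin k → Fin k
prev {suc k} fzero    = fromℕ k
prev {suc k} (fsuc s) = inject₁ s

next-prev : ∀ {k} (s : Fin k) → next (prev s) ≡ s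
next-prev {suc k} fzero with next-spec (fromℕ k)
... | inj₁ (lt , _) = contradiction (subst (λ z → suc z < suc k) (toℕ-fromℕ k) lt) (ℕ.<-irrefl refl)
... | inj₂ (_ , e)  = toℕ-injective e
next-prev {suc k} (fsuc s) with next-spec (inject₁ s)
... | inj₁ (_ , e) = toℕ-injective (trans e (cong suc (toℕ-inject₁ s)))
... | inj₂ (e , _) = contradiction (trans (cong suc (sym (toℕ-inject₁ s))) e) (λ e' → ℕ.<⇒≢ (s≤s (toℕ<n s)) e')

module ExtremalEdges (k : ℕ) where
  open Extremal k

  -- The orientation of the extremal graph: its edges are exactly the pairs `v`, `F v`. An
  -- isomorphism then only has to carry `F` to `f`.
  F : Label → Label
  F (inj₁ (s , fzero))             = inj₁ (s , fsuc fzero)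
  F (inj₁ (s , fsuc fzero))        = inj₁ (s , fsuc (fsuc fzero))
  F (inj₁ (s , fsuc (fsuc fzero))) = inj₁ (next s , fzero)
  F (inj₂ s)                       = inj₁ (s , fzero)

  <ᵇ-true : ∀ {i j} → (i <ᵇ j) ≡ true → i < j
  <ᵇ-true {i} {j} h = ℕ.<ᵇ⇒< i j (subst T (sym h) _)

  true-<ᵇ : ∀ {i j} → i < j → (i <ᵇ j) ≡ true
  true-<ᵇ lt = Equivalence.to Bool.T-≡ (ℕ.<⇒<ᵇ lt)

  ≤ᵇ-true : ∀ {i j} → (i ≤ᵇ j) ≡ true → i ≤ j
  ≤ᵇ-true {i} {j} h = ℕ.≤ᵇ⇒≤ i j (subst T (sym h) _)

  true-≤ᵇ : ∀ {i j} → i ≤ j → (i ≤ᵇ j) ≡ true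
  true-≤ᵇ le = Equivalence.to Bool.T-≡ (ℕ.≤⇒≤ᵇ le)

  ∨-true : ∀ {a b} → a ∨ b ≡ true → a ≡ true ⊎ b ≡ true
  ∨-true {true}  h = inj₁ refl
  ∨-true {false} h = inj₂ h

  true-∨ˡ : ∀ {a b} → a ≡ true → a ∨ b ≡ true
  true-∨ˡ refl = refl

  true-∨ʳ : ∀ {a b} → b ≡ true → a ∨ b ≡ true
  true-∨ʳ {true}  h = refl
  true-∨ʳ {false} h = h

  CycArc PenArc : ℕ → ℕ → Set
  CycArc i j = i < 3 * k × j < 3 * k × (suc i ≡ j ⊎ (suc i ≡ 3 * k × j ≡ 0))
  PenArc i j = 3 * k ≤ i × i < 4 * k × j ≡ 3 * (i ∸ 3 * k)

  cycE⇒ : ∀ i j → cycE k i j ≡ true → CycArc i j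
  cycE⇒ i j h with ∧-true h
  ... | ij , e with ∧-true ij
  ...   | a , b = <ᵇ-true a , <ᵇ-true b , alt (∨-true e)
    where
    alt : (suc i ≡ᵇ j) ≡ true ⊎ ((suc i ≡ᵇ 3 * k) ∧ (j ≡ᵇ 0)) ≡ true → suc i ≡ j ⊎ (suc i ≡ 3 * k × j ≡ 0)
    alt (inj₁ x) = inj₁ (≡ᵇ-true (suc i) j x)
    alt (inj₂ x) = inj₂ (≡ᵇ-true (suc i) (3 * k) (proj₁ (∧-true x)) , ≡ᵇ-true j 0 (proj₂ (∧-true {suc i ≡ᵇ 3 * k} x)))

  ⇒cycE : ∀ i j → CycArc i j → cycE k i j ≡ true
  ⇒cycE i j (a , b , e) = cong₂ _∧_ (cong₂ _∧_ (true-<ᵇ a) (true-<ᵇ b)) (alt e)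
    where
    alt : suc i ≡ j ⊎ (suc i ≡ 3 * k × j ≡ 0) → (suc i ≡ᵇ j) ∨ ((suc i ≡ᵇ 3 * k) ∧ (j ≡ᵇ 0)) ≡ true
    alt (inj₁ x)       = true-∨ˡ (true-≡ᵇ (suc i) j x)
    alt (inj₂ (x , y)) = true-∨ʳ {suc i ≡ᵇ j} (cong₂ _∧_ (true-≡ᵇ (suc i) (3 * k) x) (true-≡ᵇ j 0 y))

  penE⇒ : ∀ i j → penE k i j ≡ true → PenArc i j
  penE⇒ i j h with ∧-true h
  ... | ii , e with ∧-true ii
  ...   | a , b = ≤ᵇ-true a , <ᵇ-true b , ≡ᵇ-true j (3 * (i ∸ 3 * k)) e

  ⇒penE : ∀ i j → PenArc i j → penE k i j ≡ true
  ⇒penE i j (a , b , e) = cong₂ _∧_ (cong₂ _∧_ (true-≤ᵇ a) (true-<ᵇ b)) (true-≡ᵇ j (3 * (i ∸ 3 * k)) e)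

  block< : ∀ (s : Fin k) (r : Fin 3) → 3 * toℕ s + toℕ r < 3 * k
  block< s r = ℕ.<-≤-trans (ℕ.+-monoʳ-< (3 * toℕ s) (toℕ<n r))
    (ℕ.≤-trans (ℕ.≤-reflexive (trans (ℕ.+-comm (3 * toℕ s) 3) (sym (ℕ.*-suc 3 (toℕ s))))) (ℕ.*-monoʳ-≤ 3 (toℕ<n s)))

  Arc : ℕ → ℕ → Set
  Arc i j = CycArc i j ⊎ PenArc i j

  not-pen : ∀ (s : Fin k) (r : Fin 3) {j} → ¬ PenArc (3 * toℕ s + toℕ r) j
  not-pen s r (le , _) = ℕ.<-irrefl refl (ℕ.<-≤-trans (block< s r) le)

  3*next : ∀ (s : Fin k) → suc (3 * toℕ s + 2) ≡ 3 * suc (toℕ s)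
  3*next s = trans (sym (ℕ.+-suc (3 * toℕ s) 2)) (trans (ℕ.+-comm (3 * toℕ s) 3) (sym (ℕ.*-suc 3 (toℕ s))))

  num-F-short : ∀ (s : Fin k) {r r' : Fin 3} → toℕ r' ≡ suc (toℕ r) → ∀ j → Arc (3 * toℕ s + toℕ r) j → 3 * toℕ s + toℕ r' ≡ j
  num-F-short s {r} {r'} e j (inj₂ pa) = contradiction pa (not-pen s r)
  num-F-short s {r} {r'} e j (inj₁ (_ , _ , inj₁ eq)) = trans (trans (cong (3 * toℕ s +_) e) (ℕ.+-suc (3 * toℕ s) (toℕ r))) eq
  num-F-short s {r} {r'} e j (inj₁ (_ , _ , inj₂ (eq , _))) = contradiction
    (trans (cong (3 * toℕ s +_) e) (trans (ℕ.+-suc (3 * toℕ s) (toℕ r)) eq)) (ℕ.<⇒≢ (block< s r'))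

  arc⇒F : ∀ v j → Arc (num v) j → num (F v) ≡ j
  arc⇒F (inj₁ (s , fzero)) j h = num-F-short s {fzero} {fsuc fzero} refl j h
  arc⇒F (inj₁ (s , fsuc fzero)) j h = num-F-short s {fsuc fzero} {fsuc (fsuc fzero)} refl j h
  arc⇒F (inj₁ (s , fsuc (fsuc fzero))) j (inj₂ pa) = contradiction pa (not-pen s (fsuc (fsuc fzero)))
  arc⇒F (inj₁ (s , fsuc (fsuc fzero))) j (inj₁ (_ , j< , e)) with next-spec s | e
  ... | inj₁ (_ , n) | inj₁ eq = trans (ℕ.+-identityʳ _) (trans (cong (3 *_) n) (trans (sym (3*next s)) eq))
  ... | inj₁ (lt , _) | inj₂ (eq , _) = contradiction (trans (sym (3*next s)) eq) (λ e' → ℕ.<⇒≢ lt (ℕ.*-cancelˡ-≡ (suc (toℕ s)) k 3 e'))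
  ... | inj₂ (n , _) | inj₁ eq = contradiction (trans (sym eq) (trans (3*next s) (cong (3 *_) n))) (ℕ.<⇒≢ j<)
  ... | inj₂ (_ , n) | inj₂ (_ , eq) = trans (ℕ.+-identityʳ _) (trans (cong (3 *_) n) (sym eq))
  arc⇒F (inj₂ s) j (inj₁ (lt , _)) = contradiction lt (ℕ.≤⇒≯ (ℕ.m≤m+n (3 * k) (toℕ s)))
  arc⇒F (inj₂ s) j (inj₂ (_ , _ , e)) = trans (ℕ.+-identityʳ _) (trans (cong (3 *_) (sym (ℕ.m+n∸m≡n (3 * k) (toℕ s)))) (sym e))

  F⇒arc : ∀ v → Arc (num v) (num (F v))
  F⇒arc (inj₁ (s , fzero)) = inj₁ (block< s fzero , block< s (fsuc fzero) , inj₁ (sym (ℕ.+-suc (3 * toℕ s) 0)))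
  F⇒arc (inj₁ (s , fsuc fzero)) = inj₁ (block< s (fsuc fzero) , block< s (fsuc (fsuc fzero)) , inj₁ (sym (ℕ.+-suc (3 * toℕ s) 1)))
  F⇒arc (inj₁ (s , fsuc (fsuc fzero))) = inj₁ (block< s (fsuc (fsuc fzero)) , block< (next s) fzero , wrap (next-spec s))
    where
    wrap : (suc (toℕ s) < k × toℕ (next s) ≡ suc (toℕ s)) ⊎ (suc (toℕ s) ≡ k × toℕ (next s) ≡ 0) →
      suc (3 * toℕ s + 2) ≡ 3 * toℕ (next s) + 0 ⊎ (suc (3 * toℕ s + 2) ≡ 3 * k × 3 * toℕ (next s) + 0 ≡ 0)
    wrap (inj₁ (_ , n)) = inj₁ (trans (3*next s) (trans (cong (3 *_) (sym n)) (sym (ℕ.+-identityʳ _))))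
    wrap (inj₂ (e , n)) = inj₂ (trans (3*next s) (cong (3 *_) e) , trans (ℕ.+-identityʳ _) (cong (3 *_) n))
  F⇒arc (inj₂ s) = inj₂ (ℕ.m≤m+n (3 * k) (toℕ s) , ℕ.<-≤-trans (ℕ.+-monoʳ-< (3 * k) (toℕ<n s)) (ℕ.≤-reflexive (ℕ.+-comm (3 * k) k)) ,
    trans (ℕ.+-identityʳ _) (cong (3 *_) (sym (ℕ.m+n∸m≡n (3 * k) (toℕ s)))))

  adjH⇒ : ∀ v w → adjH k (code v) (code w) ≡ true → F v ≡ w ⊎ F w ≡ v
  adjH⇒ v w h rewrite toℕ-code v | toℕ-code w with ∨-true {cycE k (num v) (num w)} h
  ... | inj₁ a = inj₁ (num-injective (arc⇒F v (num w) (inj₁ (cycE⇒ (num v) (num w) a))))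
  ... | inj₂ h₁ with ∨-true {cycE k (num w) (num v)} h₁
  ...   | inj₁ b = inj₂ (num-injective (arc⇒F w (num v) (inj₁ (cycE⇒ (num w) (num v) b))))
  ...   | inj₂ h₂ with ∨-true {penE k (num v) (num w)} h₂
  ...     | inj₁ c = inj₁ (num-injective (arc⇒F v (num w) (inj₂ (penE⇒ (num v) (num w) c))))
  ...     | inj₂ d = inj₂ (num-injective (arc⇒F w (num v) (inj₂ (penE⇒ (num w) (num v) d))))

  ⇒adjH : ∀ v w → F v ≡ w ⊎ F w ≡ v → adjH k (code v) (code w) ≡ true
  ⇒adjH v w h rewrite toℕ-code v | toℕ-code w = pick h
    where
    i = num v
    j = num w
    pick : F v ≡ w ⊎ F w ≡ v → cycE k i j ∨ cycE k j i ∨ penE k i j ∨ penE k j i ≡ true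
    pick (inj₁ refl) with F⇒arc v
    ... | inj₁ c = true-∨ˡ (⇒cycE i j c)
    ... | inj₂ c = true-∨ʳ {cycE k i j} (true-∨ʳ {cycE k j i} (true-∨ˡ (⇒penE i j c)))
    pick (inj₂ refl) with F⇒arc w
    ... | inj₁ c = true-∨ʳ {cycE k i j} (true-∨ˡ (⇒cycE j i c))
    ... | inj₂ c = true-∨ʳ {cycE k i j} (true-∨ʳ {cycE k j i} (true-∨ʳ {penE k i j} (⇒penE j i c)))

bool-≡ : ∀ {a b} → (a ≡ true → b ≡ true) → (b ≡ true → a ≡ true) → a ≡ b
bool-≡ {true}  {b}     h h' = sym (h refl)
bool-≡ {false} {true}  h h' = h' refl
bool-≡ {false} {false} h h' = refl

-- `to` is injective. If it missed `j`, punching `j` out would inject a finite set into a smaller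
-- one.
one-sided-inverse : ∀ {n k} → n ≡ k → (to : Fin n → Fin k) (from : Fin k → Fin n) → (∀ v → from (to v) ≡ v) → ∀ j → to (from j) ≡ j
one-sided-inverse {suc n} refl to from left j with any? (λ v → to v ≟ j)
... | yes (v , refl) = cong to (left v)
... | no none = clash (pigeonhole ℕ.≤-refl (λ v → punchOut (missed v)))
  where
  missed : ∀ v → j ≢ to v
  missed v e = none (v , sym e)
  clash : (Σ (Fin (suc n)) λ v → Σ (Fin (suc n)) λ w → toℕ v < toℕ w × punchOut (missed v) ≡ punchOut (missed w)) → to (from j) ≡ j
  clash (v , w , v<w , e) = contradiction
    (cong toℕ (trans (sym (left v)) (trans (cong from (punchOut-injective (missed v) (missed w) e)) (left w)))) (ℕ.<⇒≢ v<w)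

-- The isomorphism in the equality case.

module ToExtremal {n} {G : Graph n} (o : Orientation G) (pq : p G ≡ q G) {m : ℕ} (fam : IndepEigenFamily (Laplacian G) 1ℚ m)
  (noP3 : ¬ HasPendantP3 G) (tight : 4 * m ≡ n) {u : Fin n} (pu : OrientationProperties.Per o u) (qu : Quasi G u) where
  open Orientation o
  open OrientationProperties o
  open DimensionBounds o pq fam using (inj)
  open Equality o pq fam noP3 tight pu qu
  open Extremal m
  open ExtremalEdges m

  place : Label → Fin n
  place (inj₁ (s , r)) = iter f (3 * toℕ s + toℕ r) u
  place (inj₂ s)       = proj₁ (quasi-pendant G (quasi-every-third (toℕ s)))

  at : ∀ {i j} → i ≡ j → iter f i u ≡ iter f j u
  at = cong (λ k → iter f k u)

  place-pendant : ∀ s → Pendant G (place (inj₂ s))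
  place-pendant s = proj₂ (proj₂ (quasi-pendant G (quasi-every-third (toℕ s))))

  f-place-pendant : ∀ s → f (place (inj₂ s)) ≡ iter f (3 * toℕ s) u
  f-place-pendant s = pendant-f (place-pendant s) (proj₁ (proj₂ (quasi-pendant G (quasi-every-third (toℕ s)))))

  -- `place` carries `F` to `f`; at the end of the last block this uses that `3 * m` steps close the
  -- cycle.
  f-place : ∀ v → f (place v) ≡ place (F v)
  f-place (inj₁ (s , fzero))      = at (sym (ℕ.+-suc (3 * toℕ s) 0))
  f-place (inj₁ (s , fsuc fzero)) = at (sym (ℕ.+-suc (3 * toℕ s) 1))
  f-place (inj₁ (s , fsuc (fsuc fzero))) = wrap (next-spec s)
    where
    wrap : (suc (toℕ s) < m × toℕ (next s) ≡ suc (toℕ s)) ⊎ (suc (toℕ s) ≡ m × toℕ (next s) ≡ 0) →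
      iter f (suc (3 * toℕ s + 2)) u ≡ iter f (3 * toℕ (next s) + 0) u
    wrap (inj₁ (_ , e)) = at (trans (3*next s) (trans (cong (3 *_) (sym e)) (sym (ℕ.+-identityʳ _))))
    wrap (inj₂ (e , z)) = trans (at (trans (3*next s) (cong (3 *_) e))) (trans cycle-closes (at (sym (trans (ℕ.+-identityʳ _) (cong (3 *_) z)))))
  f-place (inj₂ s) = trans (f-place-pendant s) (at (sym (ℕ.+-identityʳ (3 * toℕ s))))

  cycle-label : ∀ {v} → ¬ Pendant G v → Σ (Fin m × Fin 3) λ sr → place (inj₁ sr) ≡ v
  cycle-label {v} np = split (cycle-index np)
    where
    split : (Σ ℕ λ i → i < 3 * m × iter f i u ≡ v) → Σ (Fin m × Fin 3) λ sr → place (inj₁ sr) ≡ v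
    split (i , lt , e) = remQuot {m} 3 z , trans (at (trans (sym (toℕ-combine (proj₁ (remQuot {m} 3 z)) (proj₂ (remQuot {m} 3 z))))
            (trans (cong toℕ (combine-remQuot {m} 3 z)) (toℕ-fromℕ< lt')))) e
      where
      lt' : i < m * 3
      lt' = subst (i <_) (ℕ.*-comm 3 m) lt
      z : Fin (m * 3)
      z = fromℕ< lt'

  -- A nonpendant vertex lies on the cycle. A pendant one hangs at a quasi-pendant vertex, whose
  -- residue must be 0 because the residues 1 and 2 are inner, and each such vertex has only one
  -- pendant neighbour.
  label : ∀ v → Σ Label λ w → place w ≡ v
  label v = cases (pendant? v)
    where
    cases : Dec (Pendant G v) → Σ Label λ w → place w ≡ v
    cases (no np) = inj₁ (proj₁ (cycle-label np)) , proj₂ (cycle-label np)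
    cases (yes pv) = quasi-case (cycle-label {f v} (f-nonpendant))
      where
      qfv : Quasi G (f v)
      qfv = pendant-f-quasi pv
      quasi-case : (Σ (Fin m × Fin 3) λ sr → place (inj₁ sr) ≡ f v) → Σ Label λ w → place w ≡ v
      quasi-case ((s , fzero) , e) = inj₂ s , inj (place-pendant s) pv (trans (f-place-pendant s) (trans (at (sym (ℕ.+-identityʳ (3 * toℕ s)))) e))
      quasi-case ((s , fsuc fzero) , e) = contradiction (subst (Quasi G) (trans (sym e) (at (ℕ.+-comm (3 * toℕ s) 1))) qfv)
        (inner-nonquasi (quasi-next (quasi-every-third (toℕ s))))
      quasi-case ((s , fsuc (fsuc fzero)) , e) = contradiction (subst (Quasi G) (trans (sym e) (at (ℕ.+-comm (3 * toℕ s) 2))) qfv)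
        (inner-nonquasi (inner-next (quasi-every-third (toℕ s))))

  to : Fin n → Fin (4 * m)
  to v = code (proj₁ (label v))

  from : Fin (4 * m) → Fin n
  from j = place (decode j)

  from-to : ∀ v → from (to v) ≡ v
  from-to v = trans (cong place (decode-code (proj₁ (label v)))) (proj₂ (label v))

  to-from : ∀ j → to (from j) ≡ j
  to-from = one-sided-inverse (sym tight) to from from-to

  place-injective : ∀ {v w} → place v ≡ place w → v ≡ w
  place-injective {v} {w} e = trans (sym (back v)) (trans (cong (λ i → decode (to i)) e) (back w))
    where
    back : ∀ v → decode (to (place v)) ≡ v
    back v = trans (cong (λ z → decode (to (place z))) (sym (decode-code v))) (trans (cong decode (to-from (code v))) (decode-code v))

  preserves : ∀ i j → adjH m (to i) (to j) ≡ adj G i j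
  preserves i j = bool-≡ (λ h → forth (adjH⇒ a b h)) (λ h → ⇒adjH a b (split (edge i j h)))
    where
    a b : Label
    a = proj₁ (label i)
    b = proj₁ (label j)
    step-eq : ∀ i j → F (proj₁ (label i)) ≡ proj₁ (label j) → f i ≡ j
    step-eq i j e = trans (cong f (sym (proj₂ (label i)))) (trans (f-place (proj₁ (label i))) (trans (cong place e) (proj₂ (label j))))
    eq-step : ∀ i j → f i ≡ j → F (proj₁ (label i)) ≡ proj₁ (label j)
    eq-step i j e = place-injective (trans (sym (f-place (proj₁ (label i)))) (trans (cong f (proj₂ (label i))) (trans e (sym (proj₂ (label j))))))
    forth : F a ≡ b ⊎ F b ≡ a → adj G i j ≡ true
    forth (inj₁ e) = subst (λ z → adj G i z ≡ true) (step-eq i j e) (f-adj i)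
    forth (inj₂ e) = adj-f⁻¹ (step-eq j i e)
    split : f i ≡ j ⊎ f j ≡ i → F a ≡ b ⊎ F b ≡ a
    split (inj₁ e) = inj₁ (eq-step i j e)
    split (inj₂ e) = inj₂ (eq-step j i e)

  iso : IsoTo G (adjH m)
  iso = mk↔ₛ′ to from to-from from-to , preserves

-- Independent eigenvectors of the extremal graph.

module FromExtremal {k} (G : Graph (4 * k)) (iso : IsoTo G (adjH k)) where
  open Extremal k
  open ExtremalEdges k
  open Inverse (proj₁ iso) using (to; from; strictlyInverseˡ; strictlyInverseʳ)

  label : Fin (4 * k) → Label
  label i = decode (to i)

  vertex : Label → Fin (4 * k)
  vertex v = from (code v)

  label-vertex : ∀ v → label (vertex v) ≡ v
  label-vertex v = trans (cong decode (strictlyInverseˡ (code v))) (decode-code v)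

  vertex-label : ∀ i → vertex (label i) ≡ i
  vertex-label i = trans (cong from (code-decode (to i))) (strictlyInverseʳ i)

  vertex-injective : ∀ {v w} → vertex v ≡ vertex w → v ≡ w
  vertex-injective {v} {w} e = trans (sym (label-vertex v)) (trans (cong label e) (label-vertex w))

  vertex-≢ : ∀ {v w} → v ≢ w → vertex v ≢ vertex w
  vertex-≢ ne e = ne (vertex-injective e)

  adj-vertex : ∀ v w → adjH k (code v) (code w) ≡ adj G (vertex v) (vertex w)
  adj-vertex v w = trans (cong₂ (adjH k) (sym (strictlyInverseˡ (code v))) (sym (strictlyInverseˡ (code w)))) (proj₂ iso (vertex v) (vertex w))

  adj-arc : ∀ {v w} → F v ≡ w ⊎ F w ≡ v → adj G (vertex v) (vertex w) ≡ true
  adj-arc {v} {w} h = trans (sym (adj-vertex v w)) (⇒adjH v w h)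

  arc-adj : ∀ {v} j → adj G (vertex v) j ≡ true → F v ≡ label j ⊎ F (label j) ≡ v
  arc-adj {v} j h = adjH⇒ v (label j) (trans (adj-vertex v (label j)) (trans (cong (adj G (vertex v)) (vertex-label j)) h))

  is-vertex : ∀ {j w} → label j ≡ w → j ≡ vertex w
  is-vertex {j} e = trans (sym (vertex-label j)) (cong vertex e)

  c a b : Fin k → Label
  c s = inj₁ (s , fzero)
  a s = inj₁ (s , fsuc fzero)
  b s = inj₁ (s , fsuc (fsuc fzero))

  F≡c : ∀ {s} w → F w ≡ c s → w ≡ b (prev s) ⊎ w ≡ inj₂ s
  F≡c (inj₁ (s' , fsuc (fsuc fzero))) refl = inj₁ (cong b (next-injective (sym (next-prev (next s')))))
  F≡c (inj₂ s') refl = inj₂ refl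

  F≡a : ∀ {s} w → F w ≡ a s → w ≡ c s
  F≡a (inj₁ (s' , fzero)) refl = refl
  F≡a (inj₁ (s' , fsuc fzero)) ()
  F≡a (inj₁ (s' , fsuc (fsuc fzero))) ()

  F≡b : ∀ {s} w → F w ≡ b s → w ≡ a s
  F≡b (inj₁ (s' , fsuc fzero)) refl = refl
  F≡b (inj₁ (s' , fsuc (fsuc fzero))) ()

  F≢pendant : ∀ {s} w → F w ≢ inj₂ s
  F≢pendant (inj₁ (s' , fzero)) ()
  F≢pendant (inj₁ (s' , fsuc fzero)) ()
  F≢pendant (inj₁ (s' , fsuc (fsuc fzero))) ()
  F≢pendant (inj₂ s') ()

  module _ (t : Fin k) where
    -- One eigenvector per block: 1 at its `a` and `b`, and at the pendant vertices of the two
    -- adjacent `c` vertices the values that make the neighbours of each `c` sum to zero.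
    value : Label → ℚ
    value (inj₁ (s , fzero))  = 0ℚ
    value (inj₁ (s , fsuc _)) = δ t s
    value (inj₂ s)            = - (δ t s +ℚ δ t (prev s))

    x : Vector (4 * k)
    x i = value (label i)

    x-vertex : ∀ v → x (vertex v) ≡ value v
    x-vertex v = cong value (label-vertex v)

    minus-x : ∀ v w → x (vertex v) -ℚ x (vertex w) ≡ value v -ℚ value w
    minus-x v w = cong₂ _-ℚ_ (x-vertex v) (x-vertex w)

    Balanced : Label → Set
    Balanced v = sumℚ (λ j → ind (adj G (vertex v) j) (x (vertex v) -ℚ x j)) ≡ x (vertex v)

    open +-*-Solver

    balanced : ∀ v → Balanced v
    balanced (inj₁ (s , fzero)) = trans
      (difference-three G x (adj-arc (inj₁ refl)) (adj-arc (inj₂ (cong c (next-prev s)))) (adj-arc (inj₂ refl))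
        (vertex-≢ λ ()) (vertex-≢ λ ()) (vertex-≢ λ ()) only)
      (trans (cong₂ _+ℚ_ (minus-x (c s) (a s)) (cong₂ _+ℚ_ (minus-x (c s) (b (prev s))) (minus-x (c s) (inj₂ s))))
        (trans (solve 2 (λ y z → (con 0ℚ :- y) :+ ((con 0ℚ :- z) :+ (con 0ℚ :- (:- (y :+ z)))) := con 0ℚ) refl (δ t s) (δ t (prev s))) (sym (x-vertex (c s)))))
      where
      only : ∀ j → adj G (vertex (c s)) j ≡ true → j ≡ vertex (a s) ⊎ j ≡ vertex (b (prev s)) ⊎ j ≡ vertex (inj₂ s)
      only j h with arc-adj j h
      ... | inj₁ e = inj₁ (is-vertex (sym e))
      ... | inj₂ e with F≡c (label j) e
      ...   | inj₁ e' = inj₂ (inj₁ (is-vertex e'))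
      ...   | inj₂ e' = inj₂ (inj₂ (is-vertex e'))
    balanced (inj₁ (s , fsuc fzero)) = trans
      (difference-two G x (adj-arc (inj₂ refl)) (adj-arc (inj₁ refl)) (vertex-≢ λ ()) only)
      (trans (cong₂ _+ℚ_ (minus-x (a s) (c s)) (minus-x (a s) (b s)))
        (trans (solve 1 (λ y → (y :- con 0ℚ) :+ (y :- y) := y) refl (δ t s)) (sym (x-vertex (a s)))))
      where
      only : ∀ j → adj G (vertex (a s)) j ≡ true → j ≡ vertex (c s) ⊎ j ≡ vertex (b s)
      only j h with arc-adj j h
      ... | inj₁ e = inj₂ (is-vertex (sym e))
      ... | inj₂ e = inj₁ (is-vertex (F≡a (label j) e))
    balanced (inj₁ (s , fsuc (fsuc fzero))) = trans
      (difference-two G x (adj-arc (inj₂ refl)) (adj-arc (inj₁ refl)) (vertex-≢ λ ()) only)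
      (trans (cong₂ _+ℚ_ (minus-x (b s) (a s)) (minus-x (b s) (c (next s))))
        (trans (solve 1 (λ y → (y :- y) :+ (y :- con 0ℚ) := y) refl (δ t s)) (sym (x-vertex (b s)))))
      where
      only : ∀ j → adj G (vertex (b s)) j ≡ true → j ≡ vertex (a s) ⊎ j ≡ vertex (c (next s))
      only j h with arc-adj j h
      ... | inj₁ e = inj₂ (is-vertex (sym e))
      ... | inj₂ e = inj₁ (is-vertex (F≡b (label j) e))
    balanced (inj₂ s) = trans (difference-one G x (adj-arc (inj₁ refl)) only)
      (trans (minus-x (inj₂ s) (c s)) (trans (ℚ.+-identityʳ (value (inj₂ s))) (sym (x-vertex (inj₂ s)))))
      where
      only : ∀ j → adj G (vertex (inj₂ s)) j ≡ true → j ≡ vertex (c s)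
      only j h with arc-adj j h
      ... | inj₁ e = is-vertex (sym e)
      ... | inj₂ e = contradiction e (F≢pendant (label j))

    eigenvector : Eig G x
    eigenvector = difference-eig G (λ i → subst (λ i → sumℚ (λ j → ind (adj G i j) (x i -ℚ x j)) ≡ x i) (vertex-label i) (balanced (label i)))

  -- Independence is read off at the `a` vertices, where the vectors form an identity matrix.
  family : ∀ {d} → d ≤ k → IndepEigenFamily (Laplacian G) 1ℚ d
  family {d} d≤k = (λ t → x (ι t)) , independent , (λ t → eigenvector (ι t))
    where
    ι : Fin d → Fin k
    ι t = inject≤ t d≤k
    independent : LinIndep (λ t → x (ι t))
    independent coeff h t = trans (sym (trans (sumℚ-single (λ t' → coeff t' *ℚ x (ι t') (vertex (a (ι t)))) t off) here')) (h (vertex (a (ι t))))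
      where
      off : ∀ t' → t' ≢ t → coeff t' *ℚ x (ι t') (vertex (a (ι t))) ≡ 0ℚ
      off t' ne = trans (cong (coeff t' *ℚ_) (trans (x-vertex (ι t') (a (ι t))) (δ-≢ (λ e → ne (inject≤-injective d≤k d≤k t' t e))))) (ℚ.*-zeroʳ (coeff t'))
      here' : coeff t *ℚ x (ι t) (vertex (a (ι t))) ≡ coeff t
      here' = trans (cong (coeff t *ℚ_) (trans (x-vertex (ι t) (a (ι t))) (δ-refl (ι t)))) (ℚ.*-identityʳ (coeff t))

-- If `m` were below `k`, the first `m + 1` block vectors would contradict the maximality of `m`;
-- the upper bound gives the other inequality.
extremal-multiplicity : ∀ {n k m} (G : Graph n) → n ≡ 4 * k → IsoTo G (adjH k) → IsMultL1 G m → 4 * m ≤ n → 4 * m ≡ n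
extremal-multiplicity {k = k} {m} G refl iso (_ , ¬more) 4m≤4k = cong (4 *_)
  (ℕ.≤-antisym (ℕ.*-cancelˡ-≤ 4 4m≤4k) (ℕ.≮⇒≥ (λ m<k → ¬more (FromExtremal.family {k} G iso m<k))))

theorem1p3 : (n : ℕ) → 10 ≤ n → (G : Graph n) → Unicyclic G → p G ≡ q G → ¬ HasPendantP3 G →
    (m : ℕ) → IsMultL1 G m →
    (4 * m ≤ n) × ((4 * m ≡ n) ⇔ (Σ ℕ λ k → Σ (n ≡ 4 * k) λ _ → IsoTo G (adjH k)))
theorem1p3 n 10≤n G uni pq noP3 m mult@(fam , _) = bound 10≤n , mk⇔ forward backward
  where
  o : Orientation G
  o = orientation uni
  open UpperBound o pq fam
  forward : 4 * m ≡ n → Σ ℕ λ k → Σ (n ≡ 4 * k) λ _ → IsoTo G (adjH k)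
  forward tight = cases (strict-or-cycle-quasi 10≤n)
    where
    cases : 4 * m < n ⊎ (Σ (Fin n) λ u → OrientationProperties.Per o u × Quasi G u) → Σ ℕ λ k → Σ (n ≡ 4 * k) λ _ → IsoTo G (adjH k)
    cases (inj₁ lt) = contradiction tight (ℕ.<⇒≢ lt)
    cases (inj₂ (u , pu , qu)) = m , sym tight , ToExtremal.iso o pq fam noP3 tight pu qu
  backward : (Σ ℕ λ k → Σ (n ≡ 4 * k) λ _ → IsoTo G (adjH k)) → 4 * m ≡ n
  backward (k , e , iso) = extremal-multiplicity {k = k} G e iso mult (bound 10≤n)
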